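{- Let $d\ge 2$ be an integer and let $A\subseteq \mathbb{Z}$ be $d$-automatic and stable in $(\mathbb{Z},+)$. Then $A$ is a finite Boolean combination of (i) cosets of subgroups of $(\mathbb{Z},+)$, and (ii) translates $b+C(a_1;\delta_1)+\cdots+C(a_k;\delta_k)$ of finite sums of sets of the form $C(a;\delta)$, with $a,a_i,b\in\mathbb{Z}$ and $\delta,\delta_i$ positive integers.
   Context: For a finite string $k_0k_1\cdots k_n$ of integers put $[k_0k_1\cdots k_n]=\sum_{i=0}^n k_i d^i$ (least significant digit first). Let $\Sigma_\pm=\{ -d+1,\ldots,d-1\}$. A set $A\subseteq\mathbb{Z}$ is $d$-automatic if $\{\sigma\in\Sigma_\pm^*:[\sigma]\in A\}$ is a regular language over the alphabet $\Sigma_\pm$. For a binary relation $R\subseteq X\times X$, an $N$-ladder for $R$ is a sequence $a_0,\ldots,a_N,b_0,\ldots,b_N\in X$ with $(a_i,b_j)\in R$ iff $i\le j$; $R$ is stable if for some $N$ there is no $N$-ladder for $R$. A subset $A$ of an abelian group $(G,+)$ is stable in $(G,+)$ if the relation $\{(x,y)\in G^2: x+y\in A\}$ is stable. For $a\in\mathbb{Z}$ and a positive integer $\delta$, $C(a;\delta)=\{a+d^\delta a+d^{2\delta}a+\cdots+d^{n\delta}a : n\in\mathbb{N}\}$. -}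

module Defs where

open import Data.Nat as ℕ using (ℕ; zero; suc; _∸_)
open import Data.Integer using (ℤ; +_; _+_; _-_; _*_; _^_; -_)
open import Data.Fin using (Fin; toℕ)
open import Data.Fin.Properties using ()
open import Data.List using (List; []; _∷_; foldl)
open import Data.Bool using (Bool; true)
open import Data.Product using (Σ; ∃; _×_; _,_)
open import Data.Sum using (_⊎_)
open import Data.Empty using (⊥)
open import Data.Unit using (⊤)
open import Relation.Binary.PropositionalEquality using (_≡_)
open import Relation.Nullary using (¬_)
open import Function.Bundles using (_⇔_)

-- Signed digit alphabet Σ± = {-d+1,…,d-1}, indexed by Fin (2d-1):
-- index i stands for the digit i - (d-1).
Digit : ℕ → Set
Digit d = Fin (2 ℕ.* d ∸ 1)

digitVal : (d : ℕ) → Digit d → ℤ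
digitVal d i = + toℕ i - + (d ∸ 1)

-- [k₀k₁⋯kₙ] = Σ kᵢ dⁱ (least significant digit first)
eval : (d : ℕ) → List (Digit d) → ℤ
eval d []      = + 0
eval d (k ∷ σ) = digitVal d k + + d * eval d σ

record DFA (d : ℕ) : Set where
  field
    nStates : ℕ
    start   : Fin nStates
    step    : Fin nStates → Digit d → Fin nStates
    final   : Fin nStates → Bool

  run : Fin nStates → List (Digit d) → Fin nStates
  run q []      = q
  run q (k ∷ σ) = run (step q k) σ

  Accepts : List (Digit d) → Set
  Accepts σ = final (run start σ) ≡ true

Regular : (d : ℕ) → (List (Digit d) → Set) → Set
Regular d L = Σ (DFA d) λ M → ∀ σ → DFA.Accepts M σ ⇔ L σ

Automatic : (d : ℕ) → (ℤ → Set) → Set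
Automatic d A = Regular d (λ σ → A (eval d σ))

Ladder : {X : Set} → (X → X → Set) → ℕ → Set
Ladder {X} R N =
  Σ (Fin (suc N) → X) λ a → Σ (Fin (suc N) → X) λ b →
    ∀ i j → R (a i) (b j) ⇔ (toℕ i ℕ.≤ toℕ j)

StableRel : {X : Set} → (X → X → Set) → Set
StableRel R = ∃ λ N → ¬ Ladder R N

StableInℤ : (ℤ → Set) → Set
StableInℤ A = StableRel (λ x y → A (x + y))

record Subgroup : Set₁ where
  field
    carrier  : ℤ → Set
    has-zero : carrier (+ 0)
    +-closed : ∀ {x y} → carrier x → carrier y → carrier (x + y)
    neg-closed : ∀ {x} → carrier x → carrier (- x)

InCoset : ℤ → Subgroup → ℤ → Set
InCoset b H x = Subgroup.carrier H (x - b)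

geomSum : (d : ℕ) → ℤ → ℕ → ℕ → ℤ
geomSum d a δ zero    = a
geomSum d a δ (suc n) = geomSum d a δ n + ((+ d) ^ (suc n ℕ.* δ)) * a

InC : (d : ℕ) → ℤ → ℕ → ℤ → Set
InC d a δ x = ∃ λ n → x ≡ geomSum d a δ n

record CParam : Set where
  constructor cparam
  field
    a   : ℤ
    δ   : ℕ
    δ≥1 : 1 ℕ.≤ δ

InTranslateSum : (d : ℕ) → ℤ → List CParam → ℤ → Set
InTranslateSum d b []                 x = x ≡ b
InTranslateSum d b (cparam a δ _ ∷ cs) x =
  ∃ λ y → InC d a δ y × InTranslateSum d b cs (x - y)

data BoolComb (d : ℕ) : Set₁ where
  coset  : ℤ → Subgroup → BoolComb d
  tsum   : ℤ → List CParam → BoolComb d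
  empty  : BoolComb d
  compl  : BoolComb d → BoolComb d
  union  : BoolComb d → BoolComb d → BoolComb d
  inter  : BoolComb d → BoolComb d → BoolComb d

⟦_⟧ : {d : ℕ} → BoolComb d → ℤ → Set
⟦_⟧ {d} (coset b H)  x = InCoset b H x
⟦_⟧ {d} (tsum b cs)  x = InTranslateSum d b cs x
⟦ empty ⟧      x = ⊥
⟦ compl φ ⟧    x = ¬ ⟦ φ ⟧ x
⟦ union φ ψ ⟧  x = ⟦ φ ⟧ x ⊎ ⟦ ψ ⟧ x
⟦ inter φ ψ ⟧  x = ⟦ φ ⟧ x × ⟦ ψ ⟧ x

{-# OPTIONS --safe #-}

-- Let f be the characteristic function of A, and work in base D = d^δ with δ so divisible that runs of zero digits act
-- idempotently on the states of the automaton. For H ∈ ℤ put E H g z = lim_k g (z + D^k H); the limit is eventually constant.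
-- If an eventually constant double sequence g (a i + b j) had different values for i < j and for i > j, it would contain
-- arbitrarily long ladders; so for the residuals g of f iterated limits commute, and all uses of stability are of this kind.
--
-- Periodic part. Let g have a loop: g (v + D x) = g x. Comparing limits, a perturbation h inside a long run of the digit v
-- can be moved past its end, where it acts as E h. Hence E h g = g implies E (k + h) g = E k g for every k, and if h ≠ 0 this
-- makes g periodic. Two different loops of equal length at g give such an h. A number s = 1 + D² + D⁴ + ⋯ of suitable length
-- satisfies E s (E s g) = E s g for all residuals, so E s g is periodic for every g with a loop, whence E s f is periodic, and
-- E s g = g as soon as g has two different loops. Therefore f and E s f can only differ at numbers whose digits form a bounded
-- number of constant runs, i.e. on finitely many sets S = b + C(a₁;δ) + ⋯ + C(a_k;δ).
--
-- Sparse part. On such an S the value of f at a tuple of run lengths that are pairwise far apart depends only on their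
-- residues modulo some M: by pumping only the order of the lengths could matter, and by stability it does not. Run lengths
-- that are close to each other describe sets of the same shape with fewer summands, so f ∩ S is a Boolean combination by
-- induction on k. No stability of S itself is needed: for P = {x : E s f x = 1} one has A = (P ∖ ⋃ (S ∖ A)) ∪ ⋃ (S ∩ A).

module Submission where

open import Defs
open import Data.Nat as ℕ using (ℕ; zero; suc; _≤_; z≤n; s≤s; NonZero; _!)
import Data.Nat.Properties as ℕₚ
open import Data.Nat.DivMod using (_%_; _/_; m%n<n; m<n⇒m%n≡m; m≡m%n+[m/n]*n; m<n*o⇒m/o<n; m<n⇒m/n≡0)
open import Data.Nat.Divisibility using (_∣_; divides; ∣-trans; m∣m*n; m≤n⇒m!∣n!)
open import Data.Nat.GeneralisedArithmetic using (iterate)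
open import Data.Nat.Tactic.RingSolver using () renaming (solve-∀ to solveℕ)
open import Data.Integer as ℤ using (ℤ; +_; -[1+_]; _+_; _-_; _*_; -_; ∣_∣)
import Data.Integer.Properties as ℤₚ
open import Data.Integer.DivMod using (_/ℕ_; _%ℕ_; n%ℕd<d; a≡a%ℕn+[a/ℕn]*n)
open import Data.Integer.Tactic.RingSolver using (solve-∀)
open import Data.Bool using (Bool; true; false)
open import Data.Fin as Fin using (Fin; toℕ; fromℕ<)
import Data.Fin.Properties as Finₚ
open import Data.List using (List; []; _∷_; _++_; map; concatMap; upTo; length; replicate; take; drop; filter; allFin)
import Data.List.Properties as Listₚ
open import Data.List.Membership.Propositional using (_∈_; lose)
open import Data.List.Membership.Propositional.Properties using (∈-filter⁺; ∈-allFin; ∈-upTo⁺)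
open import Data.List.Relation.Unary.All as All using (All; []; _∷_)
import Data.List.Relation.Unary.All.Properties as Allₚ
open import Data.List.Relation.Unary.Any as Any using (Any; here; there)
import Data.List.Relation.Unary.Any.Properties as Anyₚ
open import Data.Vec as Vec using (Vec; []; _∷_)
open import Data.Vec.Relation.Unary.All using ([]; _∷_) renaming (All to AllV)
open import Data.Product using (Σ; ∃; _×_; _,_; proj₁; proj₂)
open import Data.Sum as Sum using (_⊎_; inj₁; inj₂)
open import Data.Unit using (⊤; tt)
open import Data.Empty using (⊥; ⊥-elim)
open import Function.Bundles using (_⇔_; mk⇔; Equivalence)
open import Relation.Nullary using (¬_; yes; no; Dec)
open import Relation.Nullary.Decidable using (¬?)
open import Relation.Binary.PropositionalEquality

-- Periodicity comes from a nonzero `h` with `E h g = g`. The characteristic function of the powers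
-- of `d` has the loop `v = 0`, but only `h = 0` satisfies this equation for it, so the argument
-- cannot be run on `f` itself. Passing to `E s f` creates the missing direction: idempotence of
-- `E s` states precisely that `E s g` is fixed by the nonzero `s`.
--
-- The perturbations are arbitrary integers, so adding them to a run causes carries, negative ones
-- included. Carries stay bounded, and pairs of a state and a bounded carry are again finite in
-- number; thus pumping holds for runs `s + D s + D² s + ⋯` of any integer `s`. Division rounds
-- down, so negative numbers too are read with the digits from `0` to `d - 1`; they show in the
-- final quotient `-1`, which takes the place of `0`.
--
-- Every limit is taken at an explicit exponent. Since `∣ z ∣ < D ^ ∣ z ∣`, the exponent `suc ∣ z ∣`
-- lies beyond `z` with one digit to spare, and the choice of `δ` makes one spare digit enough.

pw : ℕ → ℕ → ℤ
pw D k = + (D ℕ.^ k)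

pw-+ : ∀ D a b → pw D (a ℕ.+ b) ≡ pw D a * pw D b
pw-+ D a b = trans (cong +_ (ℕₚ.^-distribˡ-+-* D a b)) (ℤₚ.pos-* (D ℕ.^ a) (D ℕ.^ b))

pw-suc : ∀ D a → pw D (suc a) ≡ + D * pw D a
pw-suc D a = ℤₚ.pos-* D (D ℕ.^ a)

pw-* : ∀ D e k → pw (D ℕ.^ e) k ≡ pw D (e ℕ.* k)
pw-* D e k = cong +_ (ℕₚ.^-*-assoc D e k)

-- Constant runs in an arbitrary base

rep : ℕ → ℤ → ℕ → ℤ
rep D s zero    = + 0
rep D s (suc n) = s + + D * rep D s n

rep-+ : ∀ D s m n → rep D s (m ℕ.+ n) ≡ rep D s m + pw D m * rep D s n
rep-+ D s zero n = lem (rep D s n)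
  where
  lem : ∀ r → r ≡ + 0 + + 1 * r
  lem = solve-∀
rep-+ D s (suc m) n = begin
  s + + D * rep D s (m ℕ.+ n)                         ≡⟨ cong (λ r → s + + D * r) (rep-+ D s m n) ⟩
  s + + D * (rep D s m + pw D m * rep D s n)          ≡⟨ lem s (+ D) (rep D s m) (pw D m) (rep D s n) ⟩
  s + + D * rep D s m + + D * pw D m * rep D s n      ≡⟨ cong (λ p → s + + D * rep D s m + p * rep D s n) (pw-suc D m) ⟨
  s + + D * rep D s m + pw D (suc m) * rep D s n      ∎
  where
  open ≡-Reasoning
  lem : ∀ s b q p r → s + b * (q + p * r) ≡ s + b * q + b * p * r
  lem = solve-∀

rep-add : ∀ D s t n → rep D (s + t) n ≡ rep D s n + rep D t n
rep-add D s t zero    = refl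
rep-add D s t (suc n) = trans (cong (λ r → s + t + + D * r) (rep-add D s t n)) (lem s t (+ D) (rep D s n) (rep D t n))
  where
  lem : ∀ s t b q r → s + t + b * (q + r) ≡ s + b * q + (t + b * r)
  lem = solve-∀

rep-scale : ∀ D c s n → rep D (c * s) n ≡ c * rep D s n
rep-scale D c s zero    = sym (ℤₚ.*-zeroʳ c)
rep-scale D c s (suc n) = trans (cong (λ r → c * s + + D * r) (rep-scale D c s n)) (lem c s (+ D) (rep D s n))
  where
  lem : ∀ c s b r → c * s + b * (c * r) ≡ c * (s + b * r)
  lem = solve-∀

rep-zero : ∀ D n → rep D (+ 0) n ≡ + 0
rep-zero D zero    = refl
rep-zero D (suc n) = trans (cong (λ r → + 0 + + D * r) (rep-zero D n)) (lem (+ D))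
  where
  lem : ∀ b → + 0 + b * + 0 ≡ + 0
  lem = solve-∀

rep-* : ∀ D s M t → rep D s (t ℕ.* M) ≡ rep (D ℕ.^ M) (rep D s M) t
rep-* D s M zero    = refl
rep-* D s M (suc t) = trans (rep-+ D s M (t ℕ.* M)) (cong (λ r → rep D s M + pw D M * r) (rep-* D s M t))

rep-split : ∀ B s a b x → rep B s (a ℕ.+ b) + pw B (a ℕ.+ b) * x ≡ rep B s a + pw B a * (rep B s b + pw B b * x)
rep-split B s a b x = trans (cong₂ (λ r p → r + p * x) (rep-+ B s a b) (pw-+ B a b)) (lem (rep B s a) (pw B a) (rep B s b) (pw B b) x)
  where
  lem : ∀ r p q t x → r + p * q + p * t * x ≡ r + p * (q + t * x)
  lem = solve-∀

-- As the step holds for every `x`, all terms after the first `K` can be hidden in `x`; this yields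
-- both the slack `r` and the repetition `t`.
pump-iterate : ∀ (f : ℤ → Bool) (g : ℤ → ℤ) B s K M →
  (∀ x → f (g (rep B s K + pw B K * x)) ≡ f (g (rep B s (K ℕ.+ M) + pw B (K ℕ.+ M) * x))) → ∀ r t x →
  f (g (rep B s (K ℕ.+ r) + pw B (K ℕ.+ r) * x)) ≡ f (g (rep B s (K ℕ.+ r ℕ.+ t ℕ.* M) + pw B (K ℕ.+ r ℕ.+ t ℕ.* M) * x))
pump-iterate f g B s K M step r zero    x = cong (λ k → f (g (rep B s k + pw B k * x))) (sym (ℕₚ.+-identityʳ (K ℕ.+ r)))
pump-iterate f g B s K M step r (suc t) x = begin
  at (K ℕ.+ r)                       ≡⟨ pump-iterate f g B s K M step r t x ⟩
  at (K ℕ.+ r ℕ.+ u)                 ≡⟨ cong at (ℕₚ.+-assoc K r u) ⟩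
  at (K ℕ.+ (r ℕ.+ u))               ≡⟨ cong (λ w → f (g w)) (rep-split B s K (r ℕ.+ u) x) ⟩
  f (g (rep B s K + pw B K * y))     ≡⟨ step y ⟩
  f (g (rep B s (K ℕ.+ M) + pw B (K ℕ.+ M) * y)) ≡⟨ cong (λ w → f (g w)) (rep-split B s (K ℕ.+ M) (r ℕ.+ u) x) ⟨
  at (K ℕ.+ M ℕ.+ (r ℕ.+ u))         ≡⟨ cong at (lem K M r u) ⟩
  at (K ℕ.+ r ℕ.+ (M ℕ.+ u))         ∎
  where
  open ≡-Reasoning
  u = t ℕ.* M
  y = rep B s (r ℕ.+ u) + pw B (r ℕ.+ u) * x
  at : ℕ → Bool
  at k = f (g (rep B s k + pw B k * x))
  lem : ∀ K M r u → K ℕ.+ M ℕ.+ (r ℕ.+ u) ≡ K ℕ.+ r ℕ.+ (M ℕ.+ u)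
  lem = solveℕ

-- The geometric sum, arranged so that multiplication by a power of the base becomes the addition of
-- a run. For `c = 1` it says that `-1` is an endless run of the digit `D - 1`.
pw-rep : ∀ D n c → pw D n * c ≡ c + rep D ((+ D - + 1) * c) n
pw-rep D zero c = lem c
  where
  lem : ∀ c → + 1 * c ≡ c + + 0
  lem = solve-∀
pw-rep D (suc n) c = begin
  pw D (suc n) * c                                              ≡⟨ cong (_* c) (pw-suc D n) ⟩
  + D * pw D n * c                                              ≡⟨ ℤₚ.*-assoc (+ D) (pw D n) c ⟩
  + D * (pw D n * c)                                            ≡⟨ cong (+ D *_) (pw-rep D n c) ⟩
  + D * (c + rep D ((+ D - + 1) * c) n)                         ≡⟨ lem (+ D) c (rep D ((+ D - + 1) * c) n) ⟩
  c + rep D ((+ D - + 1) * c) (suc n)                           ∎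
  where
  open ≡-Reasoning
  lem : ∀ b c r → b * (c + r) ≡ c + ((b - + 1) * c + b * r)
  lem = solve-∀

∣h∣-multiple : ∀ q h → ∃ λ y → q * + ∣ h ∣ ≡ y * h
∣h∣-multiple q (+ n)    = q , refl
∣h∣-multiple q -[1+ n ] = - q , lem q (+ suc n)
  where
  lem : ∀ q n → q * n ≡ - q * - n
  lem = solve-∀

abs-nonZero : ∀ {h} → ¬ h ≡ + 0 → NonZero ∣ h ∣
abs-nonZero {h} h≢0 = ℕ.≢-nonZero (λ e → h≢0 (ℤₚ.∣i∣≡0⇒i≡0 e))

n<D^n : ∀ D → 2 ℕ.≤ D → ∀ n → n ℕ.< D ℕ.^ n
n<D^n D 2≤D zero    = s≤s z≤n
n<D^n D 2≤D (suc n) = begin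
  2 ℕ.+ n                 ≤⟨ ℕₚ.+-monoʳ-≤ 1 (n<D^n D 2≤D n) ⟩
  1 ℕ.+ D ℕ.^ n           ≤⟨ ℕₚ.+-monoˡ-≤ (D ℕ.^ n) (ℕₚ.≤-trans (s≤s z≤n) (n<D^n D 2≤D n)) ⟩
  D ℕ.^ n ℕ.+ D ℕ.^ n     ≡⟨ cong (D ℕ.^ n ℕ.+_) (ℕₚ.+-identityʳ (D ℕ.^ n)) ⟨
  2 ℕ.* D ℕ.^ n           ≤⟨ ℕₚ.*-monoˡ-≤ (D ℕ.^ n) 2≤D ⟩
  D ℕ.* D ℕ.^ n           ∎
  where open ℕₚ.≤-Reasoning

2≤^ : ∀ {D} → 2 ℕ.≤ D → ∀ {e} → 1 ℕ.≤ e → 2 ℕ.≤ D ℕ.^ e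
2≤^ {D} 2≤D {suc e} _ = ℕₚ.≤-trans 2≤D (ℕₚ.m≤m*n D (D ℕ.^ e) {{ℕ.>-nonZero (ℕₚ.≤-<-trans z≤n (n<D^n D 2≤D e))}})

^-mono : ∀ {D} → 2 ℕ.≤ D → ∀ {i j} → i ℕ.≤ j → D ℕ.^ i ℕ.≤ D ℕ.^ j
^-mono {D} 2≤D = ℕₚ.^-monoʳ-≤ D {{ℕ.>-nonZero (ℕₚ.≤-trans (s≤s z≤n) 2≤D)}}

∣+∣≤ : ∀ {x y a b} → ∣ x ∣ ℕ.≤ a → ∣ y ∣ ℕ.≤ b → ∣ x + y ∣ ℕ.≤ a ℕ.+ b
∣+∣≤ {x} {y} p q = ℕₚ.≤-trans (ℤₚ.∣i+j∣≤∣i∣+∣j∣ x y) (ℕₚ.+-mono-≤ p q)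

∣*∣≤ : ∀ {x y a b} → ∣ x ∣ ℕ.≤ a → ∣ y ∣ ℕ.≤ b → ∣ x * y ∣ ℕ.≤ a ℕ.* b
∣*∣≤ {x} {y} p q = ℕₚ.≤-trans (ℕₚ.≤-reflexive (ℤₚ.abs-* x y)) (ℕₚ.*-mono-≤ p q)

-- The bound on `∣ rep D s n ∣` alone is not inductive. With the summand `∣ s ∣`, a new term costs
-- two copies of `∣ s ∣`, which `2 ≤ D` pays for.
∣rep∣+∣s∣≤ : ∀ D → 2 ℕ.≤ D → ∀ s n → ∣ rep D s n ∣ ℕ.+ ∣ s ∣ ℕ.≤ ∣ s ∣ ℕ.* D ℕ.^ n
∣rep∣+∣s∣≤ D 2≤D s zero    = ℕₚ.≤-reflexive (sym (ℕₚ.*-identityʳ ∣ s ∣))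
∣rep∣+∣s∣≤ D 2≤D s (suc n) = begin
  ∣ s + + D * rep D s n ∣ ℕ.+ ∣ s ∣                 ≤⟨ ℕₚ.+-monoˡ-≤ ∣ s ∣ (∣+∣≤ {s} {+ D * rep D s n} ℕₚ.≤-refl (∣*∣≤ {+ D} {rep D s n} ℕₚ.≤-refl ℕₚ.≤-refl)) ⟩
  ∣ s ∣ ℕ.+ D ℕ.* r ℕ.+ ∣ s ∣                       ≡⟨ cong (ℕ._+ ∣ s ∣) (ℕₚ.+-comm ∣ s ∣ (D ℕ.* r)) ⟩
  D ℕ.* r ℕ.+ ∣ s ∣ ℕ.+ ∣ s ∣                       ≡⟨ ℕₚ.+-assoc (D ℕ.* r) ∣ s ∣ ∣ s ∣ ⟩
  D ℕ.* r ℕ.+ (∣ s ∣ ℕ.+ ∣ s ∣)                     ≡⟨ cong (λ t → D ℕ.* r ℕ.+ (∣ s ∣ ℕ.+ t)) (ℕₚ.+-identityʳ ∣ s ∣) ⟨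
  D ℕ.* r ℕ.+ 2 ℕ.* ∣ s ∣                           ≤⟨ ℕₚ.+-monoʳ-≤ (D ℕ.* r) (ℕₚ.*-monoˡ-≤ ∣ s ∣ 2≤D) ⟩
  D ℕ.* r ℕ.+ D ℕ.* ∣ s ∣                           ≡⟨ ℕₚ.*-distribˡ-+ D r ∣ s ∣ ⟨
  D ℕ.* (r ℕ.+ ∣ s ∣)                               ≤⟨ ℕₚ.*-monoʳ-≤ D (∣rep∣+∣s∣≤ D 2≤D s n) ⟩
  D ℕ.* (∣ s ∣ ℕ.* D ℕ.^ n)                         ≡⟨ ℕₚ.*-assoc D ∣ s ∣ (D ℕ.^ n) ⟨
  D ℕ.* ∣ s ∣ ℕ.* D ℕ.^ n                           ≡⟨ cong (ℕ._* D ℕ.^ n) (ℕₚ.*-comm D ∣ s ∣) ⟩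
  ∣ s ∣ ℕ.* D ℕ.* D ℕ.^ n                           ≡⟨ ℕₚ.*-assoc ∣ s ∣ D (D ℕ.^ n) ⟩
  ∣ s ∣ ℕ.* (D ℕ.* D ℕ.^ n)                         ∎
  where
  open ℕₚ.≤-Reasoning
  r = ∣ rep D s n ∣

∣rep∣≤ : ∀ D → 2 ℕ.≤ D → ∀ s n → ∣ rep D s n ∣ ℕ.≤ ∣ s ∣ ℕ.* D ℕ.^ n
∣rep∣≤ D 2≤D s n = ℕₚ.≤-trans (ℕₚ.m≤m+n _ _) (∣rep∣+∣s∣≤ D 2≤D s n)

-- Sums of runs, ladders and pumping

Runs : Set
Runs = List (ℤ × ℕ)

total : ℕ → Runs → ℤ
total B []            = + 0
total B ((a , n) ∷ C) = rep B a n + total B C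

weight : Runs → ℕ
weight []            = 0
weight ((a , n) ∷ C) = ∣ a ∣ ℕ.+ weight C

Below Above : ℕ → ℤ × ℕ → Set
Below c r = proj₂ r ℕ.≤ c
Above c r = c ℕ.≤ proj₂ r

Far : ℕ → ℕ → ℤ × ℕ → Set
Far K n r = proj₂ r ℕ.+ K ℕ.≤ n ⊎ n ℕ.+ K ℕ.≤ proj₂ r

Separated : ℕ → Runs → Set
Separated K []            = ⊤
Separated K ((a , n) ∷ C) = K ℕ.≤ n × All (Far K n) C × Separated K C

lengths : Runs → ℕ
lengths []            = 0
lengths ((a , n) ∷ C) = n ℕ.+ lengths C

lengths-bound : ∀ C → All (Below (lengths C)) C
lengths-bound []            = []
lengths-bound ((a , n) ∷ C) = ℕₚ.m≤m+n n (lengths C) ∷ All.map (λ p → ℕₚ.≤-trans p (ℕₚ.m≤n+m (lengths C) n)) (lengths-bound C)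

NoLadder : ℕ → (ℤ → Bool) → Set
NoLadder N f = ¬ Ladder (λ x y → f (x + y) ≡ true) N

SumLadderFree : ℕ → (ℤ → Set) → Set
SumLadderFree N A = ¬ Ladder (λ x y → A (x + y)) N

-- The bound on `Y` grows with the position `c` of the run, so `K` and `M` depend only on `e` and
-- `B`. This uniformity allows runs to be moved past each other at any height.
Pumpable : ℕ → (ℤ → Bool) → Set
Pumpable d f = ∀ e → 1 ℕ.≤ e → ∀ B → ∃ λ K → ∃ λ M → 1 ℕ.≤ M × (∀ Y c s x → ∣ Y ∣ ℕ.≤ B ℕ.* (d ℕ.^ e) ℕ.^ c → ∣ s ∣ ℕ.≤ B →
  f (Y + pw (d ℕ.^ e) c * (rep (d ℕ.^ e) s K + pw (d ℕ.^ e) K * x)) ≡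
  f (Y + pw (d ℕ.^ e) c * (rep (d ℕ.^ e) s (K ℕ.+ M) + pw (d ℕ.^ e) (K ℕ.+ M) * x)))

-- Even indices for `a` and odd ones for `b` turn `i ≤ j` into `2i < 2j + 1`, so the ladder uses no
-- value on the diagonal. The case with the truth values interchanged reduces to this one by
-- exchanging the two sequences.
double-swap : ∀ {N f} → NoLadder N f → (a b : ℕ → ℤ) (α β : Bool) →
  (∀ i r → f (a i + b (suc (i ℕ.+ r))) ≡ α) →
  (∀ j r → f (a (suc (j ℕ.+ r)) + b j) ≡ β) → α ≡ β
double-swap nl a b true  true  _ _ = refl
double-swap nl a b false false _ _ = refl
double-swap {N} {f} nl a b true false up down = ⊥-elim (nl ((λ i → a (2 ℕ.* toℕ i)) , (λ j → b (suc (2 ℕ.* toℕ j))) , λ i j → mk⇔ (to i j) (from i j)))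
  where
  to : ∀ (i j : Fin (suc N)) → f (a (2 ℕ.* toℕ i) + b (suc (2 ℕ.* toℕ j))) ≡ true → toℕ i ℕ.≤ toℕ j
  to i j e with toℕ i ℕₚ.≤? toℕ j
  ... | yes p = p
  ... | no ¬p with ℕₚ.m≤n⇒∃[o]m+o≡n (ℕₚ.*-monoʳ-≤ 2 (ℕₚ.≰⇒> ¬p))
  ...   | r , eq = ⊥-elim (false≢true (trans (sym (down (suc (2 ℕ.* toℕ j)) r)) (trans (cong (λ k → f (a k + b (suc (2 ℕ.* toℕ j)))) eq′) e)))
    where
    false≢true : ¬ false ≡ true
    false≢true ()
    eq′ : suc (suc (2 ℕ.* toℕ j) ℕ.+ r) ≡ 2 ℕ.* toℕ i
    eq′ = trans (cong (ℕ._+ r) (sym (ℕₚ.*-suc 2 (toℕ j)))) eq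
  from : ∀ (i j : Fin (suc N)) → toℕ i ℕ.≤ toℕ j → f (a (2 ℕ.* toℕ i) + b (suc (2 ℕ.* toℕ j))) ≡ true
  from i j p with ℕₚ.m≤n⇒∃[o]m+o≡n (ℕₚ.*-monoʳ-≤ 2 p)
  ... | r , eq = trans (cong (λ k → f (a (2 ℕ.* toℕ i) + b (suc k))) (sym eq)) (up (2 ℕ.* toℕ i) r)
double-swap {f = f} nl a b false true up down = sym (double-swap {f = f} nl b a true false
  (λ i r → trans (cong f (ℤₚ.+-comm (b i) (a (suc (i ℕ.+ r))))) (down i r))
  (λ j r → trans (cong f (ℤₚ.+-comm (b (suc (j ℕ.+ r))) (a j))) (up j r)))

-- Limits along high powers: loops, perturbations, periodicity

module Tameness (D : ℕ) (2≤D : 2 ℕ.≤ D) where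

  -- Isolates what the limit arguments use of a residual. These properties pass to `E H f`, so the
  -- same lemmas apply to limits of residuals.
  record Tame (f : ℤ → Bool) : Set where
    field
      size     : ℕ
      noLadder : NoLadder size f
      pump     : ∀ B → ∃ λ K → ∃ λ M → 1 ℕ.≤ M × (∀ Y s x → ∣ Y ∣ ℕ.≤ B → ∣ s ∣ ℕ.≤ B →
                   f (Y + (rep D s K + pw D K * x)) ≡ f (Y + (rep D s (K ℕ.+ M) + pw D (K ℕ.+ M) * x)))
      -- The spare digit at position `j` is `0`, or `D - 1` when `z` is negative; a second copy of
      -- it leaves the value unchanged.
      settle   : ∀ j z x → ∣ z ∣ ℕ.< D ℕ.^ j → f (z + pw D (suc j) * x) ≡ f (z + pw D (suc (suc j)) * x)

  1≤D : 1 ℕ.≤ D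
  1≤D = ℕₚ.≤-trans (s≤s z≤n) 2≤D

  size< : ∀ z → ∣ z ∣ ℕ.< D ℕ.^ ∣ z ∣
  size< z = n<D^n D 2≤D ∣ z ∣

  -- For tame f this is the limit of f (z + D^k H).
  E : ℤ → (ℤ → Bool) → ℤ → Bool
  E H f z = f (z + pw D (suc ∣ z ∣) * H)

  settle* : ∀ {f} → Tame f → ∀ i j z x → ∣ z ∣ ℕ.< D ℕ.^ j → f (z + pw D (suc j) * x) ≡ f (z + pw D (suc (i ℕ.+ j)) * x)
  settle* t zero    j z x p = refl
  settle* t (suc i) j z x p = trans (settle* t i j z x p) (Tame.settle t (i ℕ.+ j) z x (ℕₚ.<-≤-trans p (^-mono 2≤D (ℕₚ.m≤n+m j i))))

  E-at : ∀ {f} → Tame f → ∀ j k z H → ∣ z ∣ ℕ.< D ℕ.^ j → j ℕ.< k → E H f z ≡ f (z + pw D k * H)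
  E-at {f} t j k z H p j<k with ℕₚ.m≤n⇒∃[o]m+o≡n j<k
  ... | o , refl = begin
    f (z + pw D (suc ∣ z ∣) * H)                             ≡⟨ settle* t (suc j ℕ.+ o) ∣ z ∣ z H (size< z) ⟩
    f (z + pw D (suc (suc j ℕ.+ o ℕ.+ ∣ z ∣)) * H)           ≡⟨ cong (λ k → f (z + pw D (suc k) * H)) (lem j o ∣ z ∣) ⟩
    f (z + pw D (suc (suc ∣ z ∣ ℕ.+ (j ℕ.+ o))) * H)         ≡⟨ settle* t (suc ∣ z ∣) (j ℕ.+ o) z H (ℕₚ.<-≤-trans p (^-mono 2≤D (ℕₚ.m≤m+n j o))) ⟨
    f (z + pw D (suc (j ℕ.+ o)) * H)                         ∎
    where
    open ≡-Reasoning
    lem : ∀ j o k → suc j ℕ.+ o ℕ.+ k ≡ suc k ℕ.+ (j ℕ.+ o)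
    lem = solveℕ

  E-at′ : ∀ {f} → Tame f → ∀ k z H → ∣ z ∣ ℕ.< k → E H f z ≡ f (z + pw D k * H)
  E-at′ t k z H p = E-at t ∣ z ∣ k z H (size< z) p

  E-zero : ∀ f z → E (+ 0) f z ≡ f z
  E-zero f z = cong f (lem z (pw D (suc ∣ z ∣)))
    where
    lem : ∀ z p → z + p * + 0 ≡ z
    lem = solve-∀

  E-pw : ∀ {f} → Tame f → ∀ c H z → E (pw D c * H) f z ≡ E H f z
  E-pw {f} t c H z = begin
    E (pw D c * H) f z                      ≡⟨⟩
    f (z + pw D k * (pw D c * H))           ≡⟨ cong (λ w → f (z + w)) (ℤₚ.*-assoc (pw D k) (pw D c) H) ⟨
    f (z + pw D k * pw D c * H)             ≡⟨ cong (λ w → f (z + w * H)) (pw-+ D k c) ⟨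
    f (z + pw D (k ℕ.+ c) * H)              ≡⟨ E-at′ t (k ℕ.+ c) z H (ℕₚ.m≤m+n k c) ⟨
    E H f z                                 ∎
    where
    open ≡-Reasoning
    k = suc ∣ z ∣

  pump* : ∀ {f} → Tame f → ∀ B → ∃ λ K → ∃ λ M → 1 ℕ.≤ M × (∀ Y s x r t → ∣ Y ∣ ℕ.≤ B → ∣ s ∣ ℕ.≤ B →
    f (Y + (rep D s (K ℕ.+ r) + pw D (K ℕ.+ r) * x)) ≡ f (Y + (rep D s (K ℕ.+ r ℕ.+ t ℕ.* M) + pw D (K ℕ.+ r ℕ.+ t ℕ.* M) * x)))
  pump* {f} tm B with Tame.pump tm B
  ... | K , M , 1≤M , step = K , M , 1≤M , λ Y s x r t p q → pump-iterate f (λ w → Y + w) D s K M (λ x → step Y s x p q) r t x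

  max-bound : ∀ n (g : Fin n → ℕ) → ∃ λ b → ∀ i → g i ℕ.≤ b
  max-bound zero    g = 0 , λ ()
  max-bound (suc n) g with max-bound n (λ i → g (Fin.suc i))
  ... | b , p = g Fin.zero ℕ.+ b , λ { Fin.zero → ℕₚ.m≤m+n _ _ ; (Fin.suc i) → ℕₚ.≤-trans (p i) (ℕₚ.m≤n+m b _) }

  -- A ladder, or a single instance of pumping or settling, has finitely many arguments. One
  -- exponent `k` serves them all, and `D ^ k * H` can then be moved into a summand of `f`.
  E-tame : ∀ {f} → Tame f → ∀ H → Tame (E H f)
  E-tame {f} t H = record { size = Tame.size t ; noLadder = nl ; pump = pm ; settle = st }
    where
    open ≡-Reasoning
    nl : NoLadder (Tame.size t) (E H f)
    nl (a , b , lad) = Tame.noLadder t (a , (λ j → b j + pw D k * H) , λ i j →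
        mk⇔ (λ e → Equivalence.to (lad i j) (trans (eq i j) e)) (λ p → trans (sym (eq i j)) (Equivalence.from (lad i j) p)))
      where
      ba = max-bound _ (λ i → ∣ a i ∣)
      bb = max-bound _ (λ i → ∣ b i ∣)
      k  = suc (proj₁ ba ℕ.+ proj₁ bb)
      eq : ∀ i j → E H f (a i + b j) ≡ f (a i + (b j + pw D k * H))
      eq i j = trans (E-at′ t k (a i + b j) H (s≤s (∣+∣≤ {a i} {b j} (proj₂ ba i) (proj₂ bb j)))) (cong f (ℤₚ.+-assoc (a i) (b j) (pw D k * H)))
    lem : ∀ Y r p x q h → Y + (r + p * x) + p * q * h ≡ Y + (r + p * (x + q * h))
    lem = solve-∀
    shift : ∀ Y s n x k → ∣ Y + (rep D s n + pw D n * x) ∣ ℕ.< k → E H f (Y + (rep D s n + pw D n * x)) ≡ f (Y + (rep D s n + pw D n * (x + pw D k * H)))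
    shift Y s n x k p = begin
      E H f y                                               ≡⟨ E-at′ t (n ℕ.+ k) y H (ℕₚ.<-≤-trans p (ℕₚ.m≤n+m k n)) ⟩
      f (y + pw D (n ℕ.+ k) * H)                            ≡⟨ cong (λ w → f (y + w * H)) (pw-+ D n k) ⟩
      f (y + pw D n * pw D k * H)                           ≡⟨ cong f (lem Y (rep D s n) (pw D n) x (pw D k) H) ⟩
      f (Y + (rep D s n + pw D n * (x + pw D k * H)))       ∎
      where y = Y + (rep D s n + pw D n * x)
    pm : ∀ B → ∃ λ K → ∃ λ M → 1 ℕ.≤ M × (∀ Y s x → ∣ Y ∣ ℕ.≤ B → ∣ s ∣ ℕ.≤ B →
           E H f (Y + (rep D s K + pw D K * x)) ≡ E H f (Y + (rep D s (K ℕ.+ M) + pw D (K ℕ.+ M) * x)))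
    pm B with Tame.pump t B
    ... | K , M , 1≤M , step = K , M , 1≤M , λ Y s x p q →
      let y₁ = Y + (rep D s K + pw D K * x)
          y₂ = Y + (rep D s (K ℕ.+ M) + pw D (K ℕ.+ M) * x)
          k  = suc (∣ y₁ ∣ ℕ.+ ∣ y₂ ∣)
      in trans (shift Y s K x k (s≤s (ℕₚ.m≤m+n _ _)))
           (trans (step Y s (x + pw D k * H) p q)
             (sym (shift Y s (K ℕ.+ M) x k (s≤s (ℕₚ.m≤n+m _ _)))))
    lem₂ : ∀ z p x q h → z + p * x + p * q * h ≡ z + p * (x + q * h)
    lem₂ = solve-∀
    shift₂ : ∀ z n x k → ∣ z + pw D n * x ∣ ℕ.< k → E H f (z + pw D n * x) ≡ f (z + pw D n * (x + pw D k * H))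
    shift₂ z n x k p = begin
      E H f y                                               ≡⟨ E-at′ t (n ℕ.+ k) y H (ℕₚ.<-≤-trans p (ℕₚ.m≤n+m k n)) ⟩
      f (y + pw D (n ℕ.+ k) * H)                            ≡⟨ cong (λ w → f (y + w * H)) (pw-+ D n k) ⟩
      f (y + pw D n * pw D k * H)                           ≡⟨ cong f (lem₂ z (pw D n) x (pw D k) H) ⟩
      f (z + pw D n * (x + pw D k * H))                     ∎
      where y = z + pw D n * x
    st : ∀ j z x → ∣ z ∣ ℕ.< D ℕ.^ j → E H f (z + pw D (suc j) * x) ≡ E H f (z + pw D (suc (suc j)) * x)
    st j z x p =
      let y₁ = z + pw D (suc j) * x
          y₂ = z + pw D (suc (suc j)) * x
          k  = suc (∣ y₁ ∣ ℕ.+ ∣ y₂ ∣)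
      in trans (shift₂ z (suc j) x k (s≤s (ℕₚ.m≤m+n _ _)))
           (trans (Tame.settle t j z (x + pw D k * H) p)
             (sym (shift₂ z (suc (suc j)) x k (s≤s (ℕₚ.m≤n+m _ _)))))

  strip : ∀ {f : ℤ → Bool} B W → (∀ x → f (W + + B * x) ≡ f x) → ∀ j x → f (rep B W j + pw B j * x) ≡ f x
  strip {f} B W loop zero x = cong f (lem x)
    where
    lem : ∀ x → + 0 + + 1 * x ≡ x
    lem = solve-∀
  strip {f} B W loop (suc j) x = begin
    f (W + + B * rep B W j + pw B (suc j) * x)      ≡⟨ cong (λ p → f (W + + B * rep B W j + p * x)) (pw-suc B j) ⟩
    f (W + + B * rep B W j + + B * pw B j * x)      ≡⟨ cong f (lem W (+ B) (rep B W j) (pw B j) x) ⟩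
    f (W + + B * (rep B W j + pw B j * x))          ≡⟨ loop _ ⟩
    f (rep B W j + pw B j * x)                      ≡⟨ strip B W loop j x ⟩
    f x                                             ∎
    where
    open ≡-Reasoning
    lem : ∀ w b r p x → w + b * r + b * p * x ≡ w + b * (r + p * x)
    lem = solve-∀

  E-loop : ∀ {f} → Tame f → ∀ s W → (∀ x → f (W + pw D s * x) ≡ f x) → ∀ G r z → E G f (rep (D ℕ.^ s) W r + pw (D ℕ.^ s) r * z) ≡ E G f z
  E-loop {f} t s W loop G r z = begin
    E G f y                                              ≡⟨ E-at′ t (s ℕ.* r ℕ.+ L) y G (ℕₚ.<-≤-trans (s≤s (ℕₚ.m≤n+m ∣ y ∣ ∣ z ∣)) (ℕₚ.m≤n+m L (s ℕ.* r))) ⟩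
    f (y + pw D (s ℕ.* r ℕ.+ L) * G)                     ≡⟨ cong (λ p → f (y + p * G)) (trans (pw-+ D (s ℕ.* r) L) (cong (_* pw D L) (sym (pw-* D s r)))) ⟩
    f (y + pw (D ℕ.^ s) r * pw D L * G)                  ≡⟨ cong f (lem (rep (D ℕ.^ s) W r) (pw (D ℕ.^ s) r) z (pw D L) G) ⟩
    f (rep (D ℕ.^ s) W r + pw (D ℕ.^ s) r * (z + pw D L * G)) ≡⟨ strip (D ℕ.^ s) W loop r _ ⟩
    f (z + pw D L * G)                                   ≡⟨ E-at′ t L z G (s≤s (ℕₚ.m≤m+n ∣ z ∣ ∣ y ∣)) ⟨
    E G f z                                              ∎
    where
    open ≡-Reasoning
    y = rep (D ℕ.^ s) W r + pw (D ℕ.^ s) r * z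
    L = suc (∣ z ∣ ℕ.+ ∣ y ∣)
    lem : ∀ w p z l g → w + p * z + p * l * g ≡ w + p * (z + l * g)
    lem = solve-∀

  -- Put `h` at height `i * s` and end the run at height `j * s + n`. For `i < j` the loop strips
  -- the run below `h`, and pumping shortens the run above it to `n`. For `i > j` the whole run is
  -- stripped and `h` lies beyond `z`, where it acts as `E h`. The two iterated limits agree by
  -- `double-swap`.
  run-perturb : ∀ {f} → Tame f → ∀ v → (∀ x → f (v + + D * x) ≡ f x) → ∀ h →
    ∃ λ n₀ → ∀ n → n₀ ℕ.≤ n → ∀ z → f (rep D v n + h + pw D n * z) ≡ E h f z
  run-perturb {f} t v loop h with pump* t (∣ h ∣ ℕ.+ ∣ v ∣)
  ... | K , M , 1≤M , pmp = K , go
    where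
    open ≡-Reasoning
    go : ∀ n → K ℕ.≤ n → ∀ z → f (rep D v n + h + pw D n * z) ≡ E h f z
    go n K≤n z with ℕₚ.m≤n⇒∃[o]m+o≡n K≤n
    ... | r₀ , refl = trans (cong f (lem₀ (rep D v n) h (pw D n * z))) (double-swap {f = f} (Tame.noLadder t) a b _ _ up down)
      where
      lem₀ : ∀ r h p → r + h + p ≡ h + (r + p)
      lem₀ = solve-∀
      -- `s` is a multiple of `M`, so that pumping can remove it, and exceeds `n + ∣ z ∣`, so that
      -- the next height lies beyond the end of the run and beyond `z`.
      c = n ℕ.+ suc ∣ z ∣
      s = c ℕ.* M
      a b : ℕ → ℤ
      a i = pw D (i ℕ.* s) * h
      b k = rep D v (k ℕ.* s ℕ.+ n) + pw D (k ℕ.* s ℕ.+ n) * z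
      lem₁ : ∀ p h r y → p * h + (r + p * y) ≡ r + p * (h + y)
      lem₁ = solve-∀
      nat₁ : ∀ i r n c M → suc (i ℕ.+ r) ℕ.* (c ℕ.* M) ℕ.+ n ≡ i ℕ.* (c ℕ.* M) ℕ.+ (n ℕ.+ (suc r ℕ.* c) ℕ.* M)
      nat₁ = solveℕ
      up : ∀ i r → f (a i + b (suc (i ℕ.+ r))) ≡ f (h + (rep D v n + pw D n * z))
      up i r = begin
        f (a i + b (suc (i ℕ.+ r)))                                    ≡⟨ cong (λ k → f (a i + (rep D v k + pw D k * z))) (nat₁ i r n c M) ⟩
        f (a i + (rep D v (is ℕ.+ L) + pw D (is ℕ.+ L) * z))           ≡⟨ cong (λ w → f (a i + w)) (rep-split D v is L z) ⟩
        f (a i + (rep D v is + pw D is * (rep D v L + pw D L * z)))    ≡⟨ cong f (lem₁ (pw D is) h (rep D v is) (rep D v L + pw D L * z)) ⟩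
        f (rep D v is + pw D is * (h + (rep D v L + pw D L * z)))      ≡⟨ strip D v loop is _ ⟩
        f (h + (rep D v L + pw D L * z))                               ≡⟨ pmp h v z r₀ (suc r ℕ.* c) (ℕₚ.m≤m+n _ _) (ℕₚ.m≤n+m _ _) ⟨
        f (h + (rep D v n + pw D n * z))                               ∎
        where
        is = i ℕ.* s
        L  = n ℕ.+ (suc r ℕ.* c) ℕ.* M
      nat₂ : ∀ k r n z u → suc (k ℕ.+ r) ℕ.* ((n ℕ.+ suc z) ℕ.+ u) ≡ (k ℕ.* ((n ℕ.+ suc z) ℕ.+ u) ℕ.+ n) ℕ.+ (suc z ℕ.+ (u ℕ.+ r ℕ.* ((n ℕ.+ suc z) ℕ.+ u)))
      nat₂ = solveℕ
      c≤s : c ℕ.≤ s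
      c≤s = subst (ℕ._≤ s) (ℕₚ.*-identityʳ c) (ℕₚ.*-monoʳ-≤ c 1≤M)
      down : ∀ j r → f (a (suc (j ℕ.+ r)) + b j) ≡ E h f z
      down j r with ℕₚ.m≤n⇒∃[o]m+o≡n c≤s
      ... | u , c+u≡s = begin
        f (a (suc (j ℕ.+ r)) + b j)                            ≡⟨ cong (λ k → f (pw D k * h + b j)) i≡ ⟩
        f (pw D (L ℕ.+ o) * h + (rep D v L + pw D L * z))      ≡⟨ cong (λ p → f (p * h + (rep D v L + pw D L * z))) (pw-+ D L o) ⟩
        f (pw D L * pw D o * h + (rep D v L + pw D L * z))     ≡⟨ cong f (lem₂ (pw D L) (pw D o) h (rep D v L) z) ⟩
        f (rep D v L + pw D L * (z + pw D o * h))              ≡⟨ strip D v loop L _ ⟩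
        f (z + pw D o * h)                                     ≡⟨ E-at′ t o z h (ℕₚ.m≤m+n (suc ∣ z ∣) _) ⟨
        E h f z                                                ∎
        where
        L = j ℕ.* s ℕ.+ n
        o = suc ∣ z ∣ ℕ.+ (u ℕ.+ r ℕ.* s)
        i≡ : suc (j ℕ.+ r) ℕ.* s ≡ L ℕ.+ o
        i≡ = subst (λ s → suc (j ℕ.+ r) ℕ.* s ≡ (j ℕ.* s ℕ.+ n) ℕ.+ (suc ∣ z ∣ ℕ.+ (u ℕ.+ r ℕ.* s))) c+u≡s (nat₂ j r n ∣ z ∣ u)
        lem₂ : ∀ p q h w z → p * q * h + (w + p * z) ≡ w + p * (z + q * h)
        lem₂ = solve-∀

  Fixes : ℤ → (ℤ → Bool) → Set
  Fixes h f = ∀ z → E h f z ≡ f z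

  -- By `run-perturb`, a long run of `v` with `h` added is again a loop `W`. A perturbation `g`
  -- inside a string of copies of `W` meets one of them, turns its `h` into `g + h` and acts as
  -- `E (g + h)`; beyond the end of the string it acts as `E g`.
  fixes-shift : ∀ {f} → Tame f → ∀ v → (∀ x → f (v + + D * x) ≡ f x) → ∀ h → Fixes h f → ∀ g z → E (g + h) f z ≡ E g f z
  fixes-shift {f} t v loop h fix g z with run-perturb t v loop h | run-perturb t v loop (g + h)
  ... | n₁ , pert₁ | n₂ , pert₂ = double-swap {f = f} (Tame.noLadder t) a b _ _ up down
    where
    open ≡-Reasoning
    s = n₁ ℕ.+ n₂ ℕ.+ suc ∣ z ∣
    n₁≤s : n₁ ℕ.≤ s
    n₁≤s = ℕₚ.≤-trans (ℕₚ.m≤m+n n₁ n₂) (ℕₚ.m≤m+n _ _)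
    n₂≤s : n₂ ℕ.≤ s
    n₂≤s = ℕₚ.≤-trans (ℕₚ.m≤n+m n₂ n₁) (ℕₚ.m≤m+n _ _)
    B = D ℕ.^ s
    W = rep D v s + h
    loopW : ∀ x → f (W + pw D s * x) ≡ f x
    loopW x = trans (pert₁ s n₁≤s x) (fix x)
    a b : ℕ → ℤ
    a i = pw B i * g
    b j = rep B W j + pw B j * z
    lem₁ : ∀ p h r y → p * h + (r + p * y) ≡ r + p * (h + y)
    lem₁ = solve-∀
    lem₃ : ∀ g w h p q r z → g + (w + h + p * q + p * r * z) ≡ w + (g + h) + p * (q + r * z)
    lem₃ = solve-∀
    up : ∀ i r → f (a i + b (suc (i ℕ.+ r))) ≡ E (g + h) f z
    up i r = begin
      f (a i + b (suc (i ℕ.+ r)))                                          ≡⟨ cong (λ k → f (a i + (rep B W k + pw B k * z))) (sym (ℕₚ.+-suc i r)) ⟩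
      f (a i + (rep B W (i ℕ.+ suc r) + pw B (i ℕ.+ suc r) * z))           ≡⟨ cong (λ w → f (a i + w)) (rep-split B W i (suc r) z) ⟩
      f (a i + (rep B W i + pw B i * (rep B W (suc r) + pw B (suc r) * z))) ≡⟨ cong f (lem₁ (pw B i) g (rep B W i) _) ⟩
      f (rep B W i + pw B i * (g + (rep B W (suc r) + pw B (suc r) * z)))  ≡⟨ strip B W loopW i _ ⟩
      f (g + (rep B W (suc r) + pw B (suc r) * z))                         ≡⟨ cong (λ p → f (g + (rep B W (suc r) + p * z))) (pw-suc B r) ⟩
      f (g + (W + + B * rep B W r + + B * pw B r * z))                     ≡⟨ cong f (lem₃ g (rep D v s) h (+ B) (rep B W r) (pw B r) z) ⟩
      f (rep D v s + (g + h) + pw D s * (rep B W r + pw B r * z))          ≡⟨ pert₂ s n₂≤s _ ⟩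
      E (g + h) f (rep B W r + pw B r * z)                                 ≡⟨ E-loop t s W loopW (g + h) r z ⟩
      E (g + h) f z                                                        ∎
    lem₂ : ∀ p q h w z → p * q * h + (w + p * z) ≡ w + p * (z + q * h)
    lem₂ = solve-∀
    down : ∀ j r → f (a (suc (j ℕ.+ r)) + b j) ≡ E g f z
    down j r = begin
      f (a (suc (j ℕ.+ r)) + b j)                                     ≡⟨ cong (λ k → f (pw B k * g + b j)) (sym (ℕₚ.+-suc j r)) ⟩
      f (pw B (j ℕ.+ suc r) * g + b j)                                ≡⟨ cong (λ p → f (p * g + b j)) (pw-+ B j (suc r)) ⟩
      f (pw B j * pw B (suc r) * g + (rep B W j + pw B j * z))        ≡⟨ cong f (lem₂ (pw B j) (pw B (suc r)) g (rep B W j) z) ⟩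
      f (rep B W j + pw B j * (z + pw B (suc r) * g))                 ≡⟨ strip B W loopW j _ ⟩
      f (z + pw B (suc r) * g)                                        ≡⟨ cong (λ p → f (z + p * g)) (pw-* D s (suc r)) ⟩
      f (z + pw D (s ℕ.* suc r) * g)                                  ≡⟨ E-at′ t (s ℕ.* suc r) z g z<sr ⟨
      E g f z                                                         ∎
      where
      z<sr : ∣ z ∣ ℕ.< s ℕ.* suc r
      z<sr = ℕₚ.≤-trans (ℕₚ.m≤n+m (suc ∣ z ∣) (n₁ ℕ.+ n₂)) (ℕₚ.m≤m*n s (suc r))

  fixes-multiple : ∀ {f} → Tame f → ∀ v → (∀ x → f (v + + D * x) ≡ f x) → ∀ h → Fixes h f → ∀ y g z → E (g + y * h) f z ≡ E g f z
  fixes-multiple {f} t v loop h fix (+ n) = nat n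
    where
    lem₀ : ∀ g h → g + + 0 * h ≡ g
    lem₀ = solve-∀
    lem₁ : ∀ g n h → g + (+ 1 + n) * h ≡ g + n * h + h
    lem₁ = solve-∀
    nat : ∀ n g z → E (g + + n * h) f z ≡ E g f z
    nat zero    g z = cong (λ w → E w f z) (lem₀ g h)
    nat (suc n) g z = trans (cong (λ w → E w f z) (lem₁ g (+ n) h)) (trans (fixes-shift t v loop h fix (g + + n * h) z) (nat n g z))
  fixes-multiple {f} t v loop h fix -[1+ n ] g z = begin
    E (g + -[1+ n ] * h) f z                     ≡⟨ fixes-multiple t v loop h fix (+ suc n) (g + -[1+ n ] * h) z ⟨
    E (g + -[1+ n ] * h + + suc n * h) f z       ≡⟨ cong (λ w → E w f z) (lem g (+ suc n) h) ⟩
    E g f z                                      ∎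
    where
    open ≡-Reasoning
    lem : ∀ g n h → g + - n * h + n * h ≡ g
    lem = solve-∀

  collision : ∀ (u : ℕ → ℤ) h → ¬ h ≡ + 0 → ∃ λ i → ∃ λ r → ∃ λ y → u (suc i ℕ.+ r) - u i ≡ y * h
  collision u h h≢0 = case
    where
    instance
      nz : NonZero ∣ h ∣
      nz = abs-nonZero h≢0
    H = ∣ h ∣
    lem : ∀ r q q′ H → r + q′ * H - (r + q * H) ≡ (q′ - q) * H
    lem = solve-∀
    case : ∃ λ i → ∃ λ r → ∃ λ y → u (suc i ℕ.+ r) - u i ≡ y * h
    case with Finₚ.pigeonhole (ℕₚ.n<1+n H) (λ i → fromℕ< (n%ℕd<d (u (toℕ i)) H))
    ... | i , j , i<j , same with ℕₚ.m≤n⇒∃[o]m+o≡n i<j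
    ...   | r , eq = toℕ i , r , proj₁ y , trans (cong₂ _-_ (trans (cong u eq) uj) ui) (trans (lem (+ (u (toℕ i) %ℕ H)) (u (toℕ i) /ℕ H) (u (toℕ j) /ℕ H) (+ H)) (proj₂ y))
      where
      ui : u (toℕ i) ≡ + (u (toℕ i) %ℕ H) + (u (toℕ i) /ℕ H) * + H
      ui = a≡a%ℕn+[a/ℕn]*n (u (toℕ i)) H
      same′ : u (toℕ j) %ℕ H ≡ u (toℕ i) %ℕ H
      same′ = trans (sym (Finₚ.toℕ-fromℕ< _)) (trans (cong toℕ (sym same)) (Finₚ.toℕ-fromℕ< _))
      uj : u (toℕ j) ≡ + (u (toℕ i) %ℕ H) + (u (toℕ j) /ℕ H) * + H
      uj = trans (a≡a%ℕn+[a/ℕn]*n (u (toℕ j)) H) (cong (λ r → + r + (u (toℕ j) /ℕ H) * + H) same′)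
      y = ∣h∣-multiple (u (toℕ j) /ℕ H - u (toℕ i) /ℕ H) h

  -- A run of `v` attached above `z` does not change the value if, up to a power of `D`, it is a
  -- multiple of `h`; `collision` supplies such a length. Then `z` and `z + h` become runs of `v`
  -- from the lowest digit on, perturbed by `z - rep D v k` and by `z - rep D v k + h`, which
  -- `fixes-shift` identifies.
  fixes⇒periodic : ∀ {f} → Tame f → ∀ v → (∀ x → f (v + + D * x) ≡ f x) → ∀ h → ¬ h ≡ + 0 → Fixes h f → ∀ z → f (z + h) ≡ f z
  fixes⇒periodic {f} t v loop h h≢0 fix z with run-perturb t v loop (z - rep D v (suc (∣ z ∣ ℕ.+ ∣ z + h ∣))) | run-perturb t v loop (z - rep D v (suc (∣ z ∣ ℕ.+ ∣ z + h ∣)) + h)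
  ... | n₁ , pert₁ | n₂ , pert₂ with collision (λ i → rep D v (i ℕ.* suc (n₁ ℕ.+ n₂))) h h≢0
  ...   | i , r , y , V-V≡yh = begin
    f (z + h)                       ≡⟨ far (z + h) (s≤s (ℕₚ.m≤n+m _ _)) ⟩
    f (z + h + pw D k * rep D v p)  ≡⟨ cong f (lem₁ z h (pw D k) (rep D v p) (rep D v k) (pw D (k ℕ.+ p))) ⟩
    f (rep D v k + pw D k * rep D v p + (z - rep D v k + h) + pw D (k ℕ.+ p) * + 0) ≡⟨ cong (λ w → f (w + (z - rep D v k + h) + pw D (k ℕ.+ p) * + 0)) (rep-+ D v k p) ⟨
    f (rep D v (k ℕ.+ p) + (z - rep D v k + h) + pw D (k ℕ.+ p) * + 0) ≡⟨ pert₂ (k ℕ.+ p) (ℕₚ.≤-trans (ℕₚ.m≤n+m n₂ n₁) N≤) (+ 0) ⟩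
    E (z - rep D v k + h) f (+ 0)   ≡⟨ fixes-shift t v loop h fix (z - rep D v k) (+ 0) ⟩
    E (z - rep D v k) f (+ 0)       ≡⟨ pert₁ (k ℕ.+ p) (ℕₚ.≤-trans (ℕₚ.m≤m+n n₁ n₂) N≤) (+ 0) ⟨
    f (rep D v (k ℕ.+ p) + (z - rep D v k) + pw D (k ℕ.+ p) * + 0) ≡⟨ cong (λ w → f (w + (z - rep D v k) + pw D (k ℕ.+ p) * + 0)) (rep-+ D v k p) ⟩
    f (rep D v k + pw D k * rep D v p + (z - rep D v k) + pw D (k ℕ.+ p) * + 0) ≡⟨ cong f (lem₂ z (pw D k) (rep D v p) (rep D v k) (pw D (k ℕ.+ p))) ⟨
    f (z + pw D k * rep D v p)      ≡⟨ far z (s≤s (ℕₚ.m≤m+n _ _)) ⟨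
    f z                             ∎
    where
    open ≡-Reasoning
    k = suc (∣ z ∣ ℕ.+ ∣ z + h ∣)
    -- Both perturbations involve only `k`, so their thresholds `n₁` and `n₂` are known before the
    -- length `p` is chosen; taking `p` a positive multiple of `N` exceeds both.
    N = suc (n₁ ℕ.+ n₂)
    p = suc r ℕ.* N
    N≤ : n₁ ℕ.+ n₂ ℕ.≤ k ℕ.+ p
    N≤ = ℕₚ.≤-trans (ℕₚ.n≤1+n _) (ℕₚ.≤-trans (ℕₚ.m≤m+n N (r ℕ.* N)) (ℕₚ.m≤n+m p k))
    lem₁ : ∀ z h q w V u → z + h + q * w ≡ V + q * w + (z - V + h) + u * + 0
    lem₁ = solve-∀
    lem₂ : ∀ z q w V u → z + q * w ≡ V + q * w + (z - V) + u * + 0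
    lem₂ = solve-∀
    lem₃ : ∀ a b → a + b - a ≡ b
    lem₃ = solve-∀
    nat : ∀ i r N → (suc i ℕ.+ r) ℕ.* N ≡ i ℕ.* N ℕ.+ suc r ℕ.* N
    nat = solveℕ
    shifted : + 0 + y * h ≡ pw D (i ℕ.* N) * rep D v p
    shifted = begin
      + 0 + y * h                                            ≡⟨ ℤₚ.+-identityˡ (y * h) ⟩
      y * h                                                  ≡⟨ V-V≡yh ⟨
      rep D v ((suc i ℕ.+ r) ℕ.* N) - rep D v (i ℕ.* N)      ≡⟨ cong (λ k → rep D v k - rep D v (i ℕ.* N)) (nat i r N) ⟩
      rep D v (i ℕ.* N ℕ.+ p) - rep D v (i ℕ.* N)            ≡⟨ cong (_- rep D v (i ℕ.* N)) (rep-+ D v (i ℕ.* N) p) ⟩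
      rep D v (i ℕ.* N) + pw D (i ℕ.* N) * rep D v p - rep D v (i ℕ.* N) ≡⟨ lem₃ (rep D v (i ℕ.* N)) (pw D (i ℕ.* N) * rep D v p) ⟩
      pw D (i ℕ.* N) * rep D v p                             ∎
    far : ∀ w → ∣ w ∣ ℕ.< k → f w ≡ f (w + pw D k * rep D v p)
    far w w<k = begin
      f w                                      ≡⟨ E-zero f w ⟨
      E (+ 0) f w                              ≡⟨ fixes-multiple t v loop h fix y (+ 0) w ⟨
      E (+ 0 + y * h) f w                      ≡⟨ cong (λ g → E g f w) shifted ⟩
      E (pw D (i ℕ.* N) * rep D v p) f w       ≡⟨ E-pw t (i ℕ.* N) (rep D v p) w ⟩
      E (rep D v p) f w                        ≡⟨ E-at′ t k w (rep D v p) w<k ⟩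
      f (w + pw D k * rep D v p)               ∎

  E-E : ∀ {f} → Tame f → ∀ x G j k → suc ∣ x ∣ ℕ.≤ D ℕ.^ j → j ℕ.< k → ∀ z → E x (E G f) z ≡ E (x + pw D k * G) f z
  E-E {f} t x G j k x<Dʲ j<k z = begin
    E G f (z + pw D L * x)                           ≡⟨ E-at t (L ℕ.+ j) (L ℕ.+ k) (z + pw D L * x) G small (ℕₚ.+-monoʳ-< L j<k) ⟩
    f (z + pw D L * x + pw D (L ℕ.+ k) * G)          ≡⟨ cong (λ p → f (z + pw D L * x + p * G)) (pw-+ D L k) ⟩
    f (z + pw D L * x + pw D L * pw D k * G)         ≡⟨ cong f (lem z (pw D L) x (pw D k) G) ⟩
    f (z + pw D L * (x + pw D k * G))                ∎
    where
    open ≡-Reasoning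
    L = suc ∣ z ∣
    lem : ∀ z l x k g → z + l * x + l * k * g ≡ z + l * (x + k * g)
    lem = solve-∀
    small : ∣ z + pw D L * x ∣ ℕ.< D ℕ.^ (L ℕ.+ j)
    small = ℕₚ.≤-<-trans (∣+∣≤ {z} {pw D L * x} (ℕₚ.≤-refl) (∣*∣≤ {pw D L} {x} ℕₚ.≤-refl ℕₚ.≤-refl))
      (ℕₚ.<-≤-trans (ℕₚ.+-monoˡ-< (D ℕ.^ L ℕ.* ∣ x ∣) (ℕₚ.<-≤-trans (size< z) (^-mono 2≤D (ℕₚ.n≤1+n ∣ z ∣))))
        (ℕₚ.≤-trans (ℕₚ.≤-reflexive (sym (ℕₚ.*-suc (D ℕ.^ L) ∣ x ∣)))
          (ℕₚ.≤-trans (ℕₚ.*-monoʳ-≤ (D ℕ.^ L) x<Dʲ) (ℕₚ.≤-reflexive (sym (ℕₚ.^-distribˡ-+-* D L j))))))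

  -- The direction of `E` matters only modulo `h`. Choose `x` so that `h` divides `x + D ^ l * s`:
  -- this direction acts trivially. By idempotence a second copy of `s` may be put on top, and
  -- modulo `h` the result is a power of `D` times `s`, which acts as `E s`.
  fixes⇒E-trivial : ∀ {f} → Tame f → ∀ v → (∀ x → f (v + + D * x) ≡ f x) → ∀ h → ¬ h ≡ + 0 → Fixes h f →
    ∀ s → (∀ z → E s (E s f) z ≡ E s f z) → ∀ z → E s f z ≡ f z
  fixes⇒E-trivial {f} t v loop h h≢0 fix s idem z = sym (begin
    f z                                           ≡⟨ E-zero f z ⟨
    E (+ 0) f z                                   ≡⟨ fixes-multiple t v loop h fix y (+ 0) z ⟨
    E (+ 0 + y * h) f z                           ≡⟨ cong (λ g → E g f z) (trans (ℤₚ.+-identityˡ (y * h)) (sym x+ls≡yh)) ⟩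
    E (x + pw D l * s) f z                        ≡⟨ E-E t x s H l sx≤ (ℕₚ.n<1+n H) z ⟨
    E x (E s f) z                                 ≡⟨ idem (z + pw D (suc ∣ z ∣) * x) ⟨
    E x (E s (E s f)) z                           ≡⟨ E-E t s s ∣ s ∣ k (size< s) (ℕₚ.n<1+n ∣ s ∣) (z + pw D (suc ∣ z ∣) * x) ⟩
    E x (E (s + pw D k * s) f) z                  ≡⟨ E-E t x _ H l sx≤ (ℕₚ.n<1+n H) z ⟩
    E (x + pw D l * (s + pw D k * s)) f z         ≡⟨ cong (λ g → E g f z) regroup ⟩
    E (pw D (l ℕ.+ k) * s + y * h) f z            ≡⟨ fixes-multiple t v loop h fix y _ z ⟩
    E (pw D (l ℕ.+ k) * s) f z                    ≡⟨ E-pw t (l ℕ.+ k) s z ⟩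
    E s f z                                       ∎)
    where
    open ≡-Reasoning
    instance
      nz : NonZero ∣ h ∣
      nz = abs-nonZero h≢0
    H = ∣ h ∣
    -- `x` will depend on `l`, so `l` has to exceed every possible `x` in advance: as a residue,
    -- `x < H < D ^ H`.
    l = suc H
    k = suc ∣ s ∣
    w = pw D l * s
    x = + ((- w) %ℕ H)
    sx≤ : suc ∣ x ∣ ℕ.≤ D ℕ.^ H
    sx≤ = ℕₚ.≤-trans (n%ℕd<d (- w) H) (ℕₚ.<⇒≤ (n<D^n D 2≤D H))
    q = (- w) /ℕ H
    ym = ∣h∣-multiple (- q) h
    y = proj₁ ym
    lem₁ : ∀ x w → x + w ≡ x - - w
    lem₁ = solve-∀
    lem₂ : ∀ x q H → x - (x + q * H) ≡ - q * H
    lem₂ = solve-∀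
    x+ls≡yh : x + w ≡ y * h
    x+ls≡yh = trans (lem₁ x w) (trans (cong (λ u → x - u) (a≡a%ℕn+[a/ℕn]*n (- w) H)) (trans (lem₂ x q (+ H)) (proj₂ ym)))
    lem₃ : ∀ x l s k → x + l * (s + k * s) ≡ l * k * s + (x + l * s)
    lem₃ = solve-∀
    regroup : x + pw D l * (s + pw D k * s) ≡ pw D (l ℕ.+ k) * s + y * h
    regroup = trans (lem₃ x (pw D l) s (pw D k)) (cong₂ (λ p q → p * s + q) (sym (pw-+ D l k)) x+ls≡yh)

  -- A long run of `v` perturbed by `u - rep D v j` is the block `u` followed by a shorter run of
  -- `v`, and loops remove both.
  loop-difference : ∀ {f} → Tame f → ∀ v → (∀ x → f (v + + D * x) ≡ f x) → ∀ u j → (∀ x → f (u + pw D j * x) ≡ f x) → Fixes (u - rep D v j) f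
  loop-difference {f} t v loop u j loopU z with run-perturb t v loop (u - rep D v j)
  ... | n₀ , pert = begin
    E h f z                                                        ≡⟨ pert (j ℕ.+ n₀) (ℕₚ.m≤n+m n₀ j) z ⟨
    f (rep D v (j ℕ.+ n₀) + h + pw D (j ℕ.+ n₀) * z)               ≡⟨ cong f (lem₁ (rep D v (j ℕ.+ n₀)) h (pw D (j ℕ.+ n₀) * z)) ⟩
    f (h + (rep D v (j ℕ.+ n₀) + pw D (j ℕ.+ n₀) * z))             ≡⟨ cong (λ w → f (h + w)) (rep-split D v j n₀ z) ⟩
    f (h + (rep D v j + pw D j * (rep D v n₀ + pw D n₀ * z)))      ≡⟨ cong f (lem₂ u (rep D v j) (pw D j * (rep D v n₀ + pw D n₀ * z))) ⟩
    f (u + pw D j * (rep D v n₀ + pw D n₀ * z))                    ≡⟨ loopU _ ⟩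
    f (rep D v n₀ + pw D n₀ * z)                                   ≡⟨ strip D v loop n₀ z ⟩
    f z                                                            ∎
    where
    open ≡-Reasoning
    h = u - rep D v j
    lem₁ : ∀ a b c → a + b + c ≡ b + (a + c)
    lem₁ = solve-∀
    lem₂ : ∀ u v w → u - v + (v + w) ≡ u + w
    lem₂ = solve-∀

-- Eventually periodic iteration and bounded quotients

suc∣! : ∀ {o n} → suc o ℕ.≤ n → suc o ∣ n !
suc∣! {o} p = ∣-trans (m∣m*n (o !)) (m≤n⇒m!∣n! p)

iterate-+ : ∀ {X : Set} (t : X → X) x m n → iterate t x (m ℕ.+ n) ≡ iterate t (iterate t x m) n
iterate-+ t x zero    n = refl
iterate-+ t x (suc m) n = iterate-+ t (t x) m n

iterate-cycle : ∀ {X : Set} (t : X → X) x g → iterate t x g ≡ x → ∀ q → iterate t x (q ℕ.* g) ≡ x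
iterate-cycle t x g e zero    = refl
iterate-cycle t x g e (suc q) = trans (iterate-+ t x g (q ℕ.* g)) (trans (cong (λ y → iterate t y (q ℕ.* g)) e) (iterate-cycle t x g e q))

-- The orbit enters a cycle after at most `n` steps, and the length of the cycle is at most `n`,
-- hence divides `n !`. Injectivity of `code` is asked only along the orbit because carries are
-- bounded only there.
iterate-periodic : ∀ {X : Set} (t : X → X) x n (code : X → Fin n) →
  (∀ i j → code (iterate t x i) ≡ code (iterate t x j) → iterate t x i ≡ iterate t x j) →
  iterate t x n ≡ iterate t x (n ℕ.+ n !)
iterate-periodic t x n code inj with Finₚ.pigeonhole (ℕₚ.n<1+n n) (λ i → code (iterate t x (toℕ i)))
... | i , j , i<j , same with ℕₚ.m≤n⇒∃[o]m+o≡n i<j | ℕₚ.m≤n⇒∃[o]m+o≡n (Finₚ.toℕ≤pred[n] i)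
...   | o , i+o≡j | u , i+u≡n with suc∣! {o} {n} (ℕₚ.≤-trans (ℕₚ.m≤n+m (suc o) (toℕ i)) (ℕₚ.≤-trans (ℕₚ.≤-reflexive (trans (ℕₚ.+-suc (toℕ i) o) i+o≡j)) (Finₚ.toℕ≤pred[n] j)))
...     | divides q n!≡qg = sym (begin
  it (n ℕ.+ n !)                             ≡⟨ cong₂ (λ a b → it (a ℕ.+ b)) (sym i+u≡n) n!≡qg ⟩
  it (k ℕ.+ u ℕ.+ q ℕ.* suc o)               ≡⟨ cong it (lem k u (q ℕ.* suc o)) ⟩
  it (k ℕ.+ q ℕ.* suc o ℕ.+ u)               ≡⟨ iterate-+ t x (k ℕ.+ q ℕ.* suc o) u ⟩
  iterate t (it (k ℕ.+ q ℕ.* suc o)) u       ≡⟨ cong (λ y → iterate t y u) (trans (iterate-+ t x k (q ℕ.* suc o)) (iterate-cycle t (it k) (suc o) cyc q)) ⟩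
  iterate t (it k) u                         ≡⟨ iterate-+ t x k u ⟨
  it (k ℕ.+ u)                               ≡⟨ cong it i+u≡n ⟩
  it n                                       ∎)
  where
  open ≡-Reasoning
  k = toℕ i
  it = iterate t x
  lem : ∀ a b c → a ℕ.+ b ℕ.+ c ≡ a ℕ.+ c ℕ.+ b
  lem = solveℕ
  cyc : iterate t (it k) (suc o) ≡ it k
  cyc = trans (sym (iterate-+ t x k (suc o))) (trans (cong it (trans (ℕₚ.+-suc k o) i+o≡j)) (sym (inj k (toℕ j) same)))

quotient-bound : ∀ {x} r q n B → r ℕ.< n → x ≡ + r + q * + n → ∣ x ∣ ℕ.≤ B ℕ.* n → ∣ q ∣ ℕ.≤ B
quotient-bound r (+ k) (suc n) B r<n refl p = ℕₚ.*-cancelʳ-≤ k B (suc n) (ℕₚ.≤-trans (ℕₚ.m≤n+m (k ℕ.* suc n) r) (subst (ℕ._≤ B ℕ.* suc n) (cong ∣_∣ (cong (λ w → + r + w) (sym (ℤₚ.pos-* k (suc n))))) p))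
quotient-bound r -[1+ k ] (suc n) B r<n refl p = ℕₚ.*-cancelʳ-< (suc n) k B (ℕₚ.<-≤-trans big (subst (ℕ._≤ B ℕ.* suc n) abs≡ p))
  where
  r≤ : r ℕ.≤ suc k ℕ.* suc n
  r≤ = ℕₚ.≤-trans (ℕₚ.<⇒≤ r<n) (ℕₚ.m≤m+n (suc n) (k ℕ.* suc n))
  abs≡ : ∣ + r + -[1+ k ] * + suc n ∣ ≡ suc k ℕ.* suc n ℕ.∸ r
  abs≡ = trans (cong (λ w → ∣ + r + w ∣) (trans (sym (ℤₚ.neg-distribˡ-* (+ suc k) (+ suc n))) (cong -_ (sym (ℤₚ.pos-* (suc k) (suc n))))))
           (trans (cong ∣_∣ (ℤₚ.m-n≡m⊖n r (suc k ℕ.* suc n))) (trans (cong ∣_∣ (ℤₚ.⊖-≤ r≤)) (ℤₚ.∣-i∣≡∣i∣ (+ (suc k ℕ.* suc n ℕ.∸ r)))))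
  big : k ℕ.* suc n ℕ.< suc k ℕ.* suc n ℕ.∸ r
  big = ℕₚ.m+n≤o⇒m≤o∸n (suc (k ℕ.* suc n)) (ℕₚ.≤-trans (ℕₚ.≤-reflexive (sym (ℕₚ.+-suc (k ℕ.* suc n) r))) (ℕₚ.≤-trans (ℕₚ.+-monoʳ-≤ (k ℕ.* suc n) r<n) (ℕₚ.≤-reflexive (ℕₚ.+-comm (k ℕ.* suc n) (suc n)))))

shift-nonneg : ∀ c B → ∣ c ∣ ℕ.≤ B → ∃ λ k → c + + B ≡ + k × k ℕ.≤ B ℕ.+ B
shift-nonneg (+ n)    B p = n ℕ.+ B , refl , ℕₚ.+-monoˡ-≤ B p
shift-nonneg -[1+ n ] B p = B ℕ.∸ suc n , ℤₚ.⊖-≥ p , ℕₚ.≤-trans (ℕₚ.m∸n≤m B (suc n)) (ℕₚ.m≤m+n B B)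

-- Residuals of the automaton

module Kernel (d : ℕ) (2≤d : 2 ℕ.≤ d) (A : ℤ → Set) (M : DFA d) (acc : ∀ σ → DFA.Accepts M σ ⇔ A (eval d σ)) where

  open DFA M

  1≤d : 1 ℕ.≤ d
  1≤d = ℕₚ.≤-trans (s≤s z≤n) 2≤d

  instance
    d≢0 : NonZero d
    d≢0 = ℕ.>-nonZero 1≤d

  d^≢0 : ∀ e → NonZero (d ℕ.^ e)
  d^≢0 e = ℕₚ.m^n≢0 d e

  val : List (Fin d) → ℤ
  val []      = + 0
  val (k ∷ κ) = + toℕ k + + d * val κ

  val-++ : ∀ κ λs → val (κ ++ λs) ≡ val κ + pw d (length κ) * val λs
  val-++ []      λs = lem (val λs)
    where
    lem : ∀ x → x ≡ + 0 + + 1 * x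
    lem = solve-∀
  val-++ (k ∷ κ) λs = trans (cong (λ w → + toℕ k + + d * w) (val-++ κ λs)) (trans (lem (+ toℕ k) (+ d) (val κ) (pw d (length κ)) (val λs)) (cong (λ p → + toℕ k + + d * val κ + p * val λs) (sym (pw-suc d (length κ)))))
    where
    lem : ∀ k d v p w → k + d * (v + p * w) ≡ k + d * v + d * p * w
    lem = solve-∀

  val-replicate : ∀ n k → val (replicate n k) ≡ rep d (+ toℕ k) n
  val-replicate zero    k = refl
  val-replicate (suc n) k = cong (λ w → + toℕ k + + d * w) (val-replicate n k)

  digits : ℕ → ℕ → List (Fin d)
  digits zero    n = []
  digits (suc L) n = fromℕ< (m%n<n n d) ∷ digits L (n / d)

  length-digits : ∀ L n → length (digits L n) ≡ L
  length-digits zero    n = refl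
  length-digits (suc L) n = cong suc (length-digits L (n / d))

  val-digits : ∀ L n → n ℕ.< d ℕ.^ L → val (digits L n) ≡ + n
  val-digits zero    zero    p = refl
  val-digits zero    (suc n) (s≤s ())
  val-digits (suc L) n p = begin
    + toℕ (fromℕ< (m%n<n n d)) + + d * val (digits L (n / d))  ≡⟨ cong₂ (λ r v → + r + + d * v) (Finₚ.toℕ-fromℕ< (m%n<n n d)) (val-digits L (n / d) (m<n*o⇒m/o<n (subst (n ℕ.<_) (ℕₚ.*-comm d (d ℕ.^ L)) p))) ⟩
    + (n % d) + + d * + (n / d)                                ≡⟨ cong (λ w → + (n % d) + w) (trans (ℤₚ.*-comm (+ d) (+ (n / d))) (sym (ℤₚ.pos-* (n / d) d))) ⟩
    + (n % d ℕ.+ n / d ℕ.* d)                                  ≡⟨ cong +_ (m≡m%n+[m/n]*n n d) ⟨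
    + n                                                        ∎
    where open ≡-Reasoning

  digit-bound : ∀ {k} → k ℕ.< d → k ℕ.+ (d ℕ.∸ 1) ℕ.< 2 ℕ.* d ℕ.∸ 1
  digit-bound p = ℕₚ.≤-trans (ℕₚ.+-monoˡ-< (d ℕ.∸ 1) p) (ℕₚ.≤-reflexive (trans (sym (ℕₚ.+-∸-assoc d 1≤d)) (cong (λ w → d ℕ.+ w ℕ.∸ 1) (sym (ℕₚ.+-identityʳ d)))))

  pos-digit : Fin d → Digit d
  pos-digit k = fromℕ< (digit-bound (Finₚ.toℕ<n k))

  neg-digit-bound : ∀ k → d ℕ.∸ 1 ℕ.∸ k ℕ.< 2 ℕ.* d ℕ.∸ 1
  neg-digit-bound k = ℕₚ.≤-<-trans (ℕₚ.m∸n≤m (d ℕ.∸ 1) k) (digit-bound 1≤d)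

  neg-digit : Fin d → Digit d
  neg-digit k = fromℕ< (neg-digit-bound (toℕ k))

  digitVal-pos : ∀ k → digitVal d (pos-digit k) ≡ + toℕ k
  digitVal-pos k = trans (cong (λ w → + w - + (d ℕ.∸ 1)) (Finₚ.toℕ-fromℕ< (digit-bound (Finₚ.toℕ<n k)))) (lem (+ toℕ k) (+ (d ℕ.∸ 1)))
    where
    lem : ∀ k c → k + c - c ≡ k
    lem = solve-∀

  digitVal-neg : ∀ k → digitVal d (neg-digit k) ≡ - + toℕ k
  digitVal-neg k = trans (cong (λ w → + w - + (d ℕ.∸ 1)) (Finₚ.toℕ-fromℕ< (neg-digit-bound (toℕ k)))) (trans (cong (_- + (d ℕ.∸ 1)) (sym (trans (ℤₚ.m-n≡m⊖n (d ℕ.∸ 1) (toℕ k)) (ℤₚ.⊖-≥ (ℕₚ.m+n≤o⇒m≤o∸n (toℕ k) (ℕₚ.≤-trans (ℕₚ.≤-reflexive (ℕₚ.+-comm (toℕ k) 1)) (Finₚ.toℕ<n k))))))) (lem (+ (d ℕ.∸ 1)) (+ toℕ k)))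
    where
    lem : ∀ c k → c - k - c ≡ - k
    lem = solve-∀

  eval-pos : ∀ κ σ → eval d (map pos-digit κ ++ σ) ≡ val κ + pw d (length κ) * eval d σ
  eval-pos []      σ = lem (eval d σ)
    where
    lem : ∀ x → x ≡ + 0 + + 1 * x
    lem = solve-∀
  eval-pos (k ∷ κ) σ = trans (cong₂ (λ a w → a + + d * w) (digitVal-pos k) (eval-pos κ σ)) (trans (lem (+ toℕ k) (+ d) (val κ) (pw d (length κ)) (eval d σ)) (cong (λ p → + toℕ k + + d * val κ + p * eval d σ) (sym (pw-suc d (length κ)))))
    where
    lem : ∀ k d v p w → k + d * (v + p * w) ≡ k + d * v + d * p * w
    lem = solve-∀

  eval-neg : ∀ κ → eval d (map neg-digit κ) ≡ - val κ
  eval-neg []      = refl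
  eval-neg (k ∷ κ) = trans (cong₂ (λ a w → a + + d * w) (digitVal-neg k) (eval-neg κ)) (lem (+ toℕ k) (+ d) (val κ))
    where
    lem : ∀ k d v → - k + d * - v ≡ - (k + d * v)
    lem = solve-∀

  word : ℤ → List (Digit d)
  word (+ n)    = map pos-digit (digits n n)
  word -[1+ n ] = map neg-digit (digits (suc n) (suc n))

  eval-word : ∀ x → eval d (word x) ≡ x
  eval-word (+ n) = begin
    eval d (map pos-digit (digits n n))           ≡⟨ cong (eval d) (Listₚ.++-identityʳ (map pos-digit (digits n n))) ⟨
    eval d (map pos-digit (digits n n) ++ [])     ≡⟨ eval-pos (digits n n) [] ⟩
    val (digits n n) + pw d (length (digits n n)) * + 0 ≡⟨ lem (val (digits n n)) (pw d (length (digits n n))) ⟩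
    val (digits n n)                              ≡⟨ val-digits n n (n<D^n d 2≤d n) ⟩
    + n                                           ∎
    where
    open ≡-Reasoning
    lem : ∀ v p → v + p * + 0 ≡ v
    lem = solve-∀
  eval-word -[1+ n ] = trans (eval-neg (digits (suc n) (suc n))) (cong -_ (val-digits (suc n) (suc n) (n<D^n d 2≤d (suc n))))

  State : Set
  State = Fin nStates

  -- Acceptance of a word depends only on its value, so for a reachable `p` the function `F p` does
  -- not depend on how `word` represents `x`: it is the residual of `f` at `p`.
  F : State → ℤ → Bool
  F p x = final (run p (word x))

  f : ℤ → Bool
  f = F start

  ⇔⇒≡ : ∀ {P : Set} {a b : Bool} → (a ≡ true ⇔ P) → (b ≡ true ⇔ P) → a ≡ b
  ⇔⇒≡ {a = true}  {true}  _ _ = refl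
  ⇔⇒≡ {a = false} {false} _ _ = refl
  ⇔⇒≡ {a = true}  {false} p q = sym (Equivalence.from q (Equivalence.to p refl))
  ⇔⇒≡ {a = false} {true}  p q = Equivalence.from p (Equivalence.to q refl)

  f-correct : ∀ x → f x ≡ true ⇔ A x
  f-correct x = subst (λ y → f x ≡ true ⇔ A y) (eval-word x) (acc (word x))

  f-eval : ∀ σ → f (eval d σ) ≡ final (run start σ)
  f-eval σ = ⇔⇒≡ (f-correct (eval d σ)) (acc σ)

  run-++ : ∀ p σ τ → run p (σ ++ τ) ≡ run (run p σ) τ
  run-++ p []      τ = refl
  run-++ p (k ∷ σ) τ = run-++ (step p k) σ τ

  go : State → List (Fin d) → State
  go p κ = run p (map pos-digit κ)

  go-++ : ∀ p κ λs → go p (κ ++ λs) ≡ go (go p κ) λs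
  go-++ p κ λs = trans (cong (run p) (Listₚ.map-++ pos-digit κ λs)) (run-++ p (map pos-digit κ) (map pos-digit λs))

  -- Nonnegative digits suffice here: since division rounds down, every integer is read from its low
  -- end with digits from `0` to `d - 1`.
  Reachable : State → Set
  Reachable p = ∃ λ κ → go start κ ≡ p

  reach-go : ∀ {p} → Reachable p → ∀ κ → Reachable (go p κ)
  reach-go (κ₀ , e) κ = κ₀ ++ κ , trans (go-++ start κ₀ κ) (cong (λ p → go p κ) e)

  F-from-start : ∀ κ x → F (go start κ) x ≡ f (val κ + pw d (length κ) * x)
  F-from-start κ x = begin
    final (run (go start κ) (word x))                    ≡⟨ cong final (run-++ start (map pos-digit κ) (word x)) ⟨
    final (run start (map pos-digit κ ++ word x))        ≡⟨ f-eval (map pos-digit κ ++ word x) ⟨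
    f (eval d (map pos-digit κ ++ word x))               ≡⟨ cong f (eval-pos κ (word x)) ⟩
    f (val κ + pw d (length κ) * eval d (word x))        ≡⟨ cong (λ y → f (val κ + pw d (length κ) * y)) (eval-word x) ⟩
    f (val κ + pw d (length κ) * x)                      ∎
    where open ≡-Reasoning

  F-go : ∀ {p} → Reachable p → ∀ κ x → F p (val κ + pw d (length κ) * x) ≡ F (go p κ) x
  F-go (κ₀ , refl) κ x = begin
    F (go start κ₀) (val κ + pw d (length κ) * x)                             ≡⟨ F-from-start κ₀ _ ⟩
    f (val κ₀ + pw d (length κ₀) * (val κ + pw d (length κ) * x))             ≡⟨ cong f (lem (val κ₀) (pw d (length κ₀)) (val κ) (pw d (length κ)) x) ⟩
    f (val κ₀ + pw d (length κ₀) * val κ + pw d (length κ₀) * pw d (length κ) * x) ≡⟨ cong₂ (λ v p → f (v + p * x)) (sym (val-++ κ₀ κ)) (trans (sym (pw-+ d (length κ₀) (length κ))) (cong (pw d) (sym (Listₚ.length-++ κ₀)))) ⟩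
    f (val (κ₀ ++ κ) + pw d (length (κ₀ ++ κ)) * x)                           ≡⟨ F-from-start (κ₀ ++ κ) x ⟨
    F (go start (κ₀ ++ κ)) x                                                  ≡⟨ cong (λ p → F p x) (go-++ start κ₀ κ) ⟩
    F (go (go start κ₀) κ) x                                                  ∎
    where
    open ≡-Reasoning
    lem : ∀ a p b q x → a + p * (b + q * x) ≡ a + p * b + p * q * x
    lem = solve-∀

  F-noLadder : ∀ {N} → SumLadderFree N A → ∀ {p} → Reachable p → NoLadder N (F p)
  F-noLadder nl (κ , refl) (a , b , lad) = nl ((λ i → val κ + pw d (length κ) * a i) , (λ j → pw d (length κ) * b j) , λ i j →
      mk⇔ (λ Ax → Equivalence.to (lad i j) (trans (eq i j) (Equivalence.from (f-correct _) Ax)))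
          (λ i≤j → Equivalence.to (f-correct _) (trans (sym (eq i j)) (Equivalence.from (lad i j) i≤j))))
    where
    lem : ∀ v p a b → v + p * (a + b) ≡ v + p * a + p * b
    lem = solve-∀
    eq : ∀ i j → F (go start κ) (a i + b j) ≡ f (val κ + pw d (length κ) * a i + pw d (length κ) * b j)
    eq i j = trans (F-from-start κ (a i + b j)) (cong f (lem (val κ) (pw d (length κ)) (a i) (b j)))

  Pump : ℕ → (ℤ → Bool) → ℕ → ℕ → ℕ → Set
  Pump e g B K N = ∀ Y c s x → ∣ Y ∣ ℕ.≤ B ℕ.* d ℕ.^ c → ∣ s ∣ ℕ.≤ B →
    g (Y + pw d c * (rep (d ℕ.^ e) s K + pw (d ℕ.^ e) K * x)) ≡ g (Y + pw d c * (rep (d ℕ.^ e) s (K ℕ.+ N) + pw (d ℕ.^ e) (K ℕ.+ N) * x))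

  remainder : ℕ → ℤ → ℕ
  remainder e x = _%ℕ_ x (d ℕ.^ e) {{d^≢0 e}}

  quotient : ℕ → ℤ → ℤ
  quotient e x = _/ℕ_ x (d ℕ.^ e) {{d^≢0 e}}

  division : ∀ e x → x ≡ val (digits e (remainder e x)) + pw d e * quotient e x
  division e x = trans (a≡a%ℕn+[a/ℕn]*n x (d ℕ.^ e) {{d^≢0 e}}) (cong₂ _+_ (sym (val-digits e (remainder e x) (n%ℕd<d x (d ℕ.^ e) {{d^≢0 e}}))) (ℤₚ.*-comm (quotient e x) (pw d e)))

  F-division : ∀ {p} → Reachable p → ∀ e x y → F p (x + pw d e * y) ≡ F (go p (digits e (remainder e x))) (quotient e x + y)
  F-division {p} rp e x y = begin
    F p (x + pw d e * y)                                         ≡⟨ cong (λ w → F p (w + pw d e * y)) (division e x) ⟩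
    F p (val κ + pw d e * quotient e x + pw d e * y)             ≡⟨ cong (F p) (lem (val κ) (pw d e) (quotient e x) y) ⟩
    F p (val κ + pw d e * (quotient e x + y))                    ≡⟨ cong (λ l → F p (val κ + pw d l * (quotient e x + y))) (sym (length-digits e (remainder e x))) ⟩
    F p (val κ + pw d (length κ) * (quotient e x + y))           ≡⟨ F-go rp κ _ ⟩
    F (go p κ) (quotient e x + y)                                ∎
    where
    open ≡-Reasoning
    κ = digits e (remainder e x)
    lem : ∀ v p q y → v + p * q + p * y ≡ v + p * (q + y)
    lem = solve-∀

  quotient≤ : ∀ e x B → ∣ x ∣ ℕ.≤ B ℕ.* d ℕ.^ e → ∣ quotient e x ∣ ℕ.≤ B
  quotient≤ e x B p = quotient-bound (remainder e x) (quotient e x) (d ℕ.^ e) B (n%ℕd<d x (d ℕ.^ e) {{d^≢0 e}}) (a≡a%ℕn+[a/ℕn]*n x (d ℕ.^ e) {{d^≢0 e}}) p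

  -- A state together with a carry: adding the digit s in base d^e acts on such pairs, and the carry stays bounded.
  carry-step : ℕ → ℤ → State × ℤ → State × ℤ
  carry-step e s (p , c) = go p (digits e (remainder e (c + s))) , quotient e (c + s)

  carry-run : ∀ e s n {p} c x → Reachable p →
    let q = iterate (carry-step e s) (p , c) n in F p (c + (rep (d ℕ.^ e) s n + pw (d ℕ.^ e) n * x)) ≡ F (proj₁ q) (proj₂ q + x)
  carry-run e s zero    {p} c x rp = cong (F p) (lem c x)
    where
    lem : ∀ c x → c + (+ 0 + + 1 * x) ≡ c + x
    lem = solve-∀
  carry-run e s (suc n) {p} c x rp = begin
    F p (c + (s + b * rep (d ℕ.^ e) s n + pw (d ℕ.^ e) (suc n) * x))    ≡⟨ cong (λ w → F p (c + (s + b * rep (d ℕ.^ e) s n + w * x))) (pw-suc (d ℕ.^ e) n) ⟩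
    F p (c + (s + b * rep (d ℕ.^ e) s n + b * pw (d ℕ.^ e) n * x))      ≡⟨ cong (F p) (lem c s b (rep (d ℕ.^ e) s n) (pw (d ℕ.^ e) n) x) ⟩
    F p (c + s + b * (rep (d ℕ.^ e) s n + pw (d ℕ.^ e) n * x))          ≡⟨ F-division rp e (c + s) _ ⟩
    F p′ (quotient e (c + s) + (rep (d ℕ.^ e) s n + pw (d ℕ.^ e) n * x)) ≡⟨ carry-run e s n (quotient e (c + s)) x (reach-go rp (digits e (remainder e (c + s)))) ⟩
    _                                                                   ∎
    where
    open ≡-Reasoning
    b = + (d ℕ.^ e)
    p′ = go p (digits e (remainder e (c + s)))
    lem : ∀ c s b r p x → c + (s + b * r + b * p * x) ≡ c + s + b * (r + p * x)
    lem = solve-∀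

  carry-bound : ∀ e → 1 ℕ.≤ e → ∀ s B → ∣ s ∣ ℕ.≤ B → ∀ n p c → ∣ c ∣ ℕ.≤ B → ∣ proj₂ (iterate (carry-step e s) (p , c) n) ∣ ℕ.≤ B
  carry-bound e 1≤e s B s≤ zero    p c c≤ = c≤
  carry-bound e 1≤e s B s≤ (suc n) p c c≤ = carry-bound e 1≤e s B s≤ n _ _ (quotient≤ e (c + s) B
    (ℕₚ.≤-trans (∣+∣≤ {c} {s} c≤ s≤) (ℕₚ.≤-trans (ℕₚ.≤-reflexive (lem B)) (ℕₚ.*-monoʳ-≤ B (2≤^ 2≤d 1≤e)))))
    where
    lem : ∀ B → B ℕ.+ B ≡ B ℕ.* 2
    lem = solveℕ

  carry-code : (B : ℕ) → State × ℤ → Fin (nStates ℕ.* suc (B ℕ.+ B))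
  carry-code B (p , c) = Fin.combine p (fromℕ< (m%n<n ∣ c + + B ∣ (suc (B ℕ.+ B))))

  carry-code-injective : ∀ B x y → ∣ proj₂ x ∣ ℕ.≤ B → ∣ proj₂ y ∣ ℕ.≤ B → carry-code B x ≡ carry-code B y → x ≡ y
  carry-code-injective B (p , c) (q , e) c≤ e≤ same with Finₚ.combine-injective p _ q _ same | shift-nonneg c B c≤ | shift-nonneg e B e≤
  ... | refl , same₂ | k , c+B≡k , k≤ | l , e+B≡l , l≤ = cong (p ,_) (trans (lem c (+ B)) (trans (cong (_- + B) (trans c+B≡k (trans (cong +_ k≡l) (sym e+B≡l)))) (sym (lem e (+ B)))))
    where
    open ≡-Reasoning
    lem : ∀ c b → c ≡ c + b - b
    lem = solve-∀
    k≡l : k ≡ l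
    k≡l = begin
      k                                    ≡⟨ m<n⇒m%n≡m (s≤s k≤) ⟨
      k % suc (B ℕ.+ B)                    ≡⟨ cong (λ w → ∣ w ∣ % suc (B ℕ.+ B)) c+B≡k ⟨
      ∣ c + + B ∣ % suc (B ℕ.+ B)          ≡⟨ Finₚ.fromℕ<-injective _ _ (m%n<n ∣ c + + B ∣ (suc (B ℕ.+ B))) (m%n<n ∣ e + + B ∣ (suc (B ℕ.+ B))) same₂ ⟩
      ∣ e + + B ∣ % suc (B ℕ.+ B)          ≡⟨ cong (λ w → ∣ w ∣ % suc (B ℕ.+ B)) e+B≡l ⟩
      l % suc (B ℕ.+ B)                    ≡⟨ m<n⇒m%n≡m (s≤s l≤) ⟩
      l                                    ∎

  -- `K` counts the pairs of a state and a carry in `[-B, B]`. Reading the `c` lowest digits of `Y`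
  -- only produces another such pair, which is why the constants are uniform in `p`, `Y` and `c`.
  F-pump : ∀ e → 1 ℕ.≤ e → ∀ B → ∃ λ K → ∃ λ N → 1 ℕ.≤ N × (∀ {p} → Reachable p → Pump e (F p) B K N)
  F-pump e 1≤e B = K , K ! , ℕₚ.1≤n! K , pump
    where
    open ≡-Reasoning
    K = nStates ℕ.* suc (B ℕ.+ B)
    pump : ∀ {p} → Reachable p → Pump e (F p) B K (K !)
    pump {p} rp Y c s x Y≤ s≤ = begin
      F p (Y + pw d c * (rep (d ℕ.^ e) s K + pw (d ℕ.^ e) K * x))                     ≡⟨ run-to K ⟩
      F (proj₁ (it K)) (proj₂ (it K) + x)                                             ≡⟨ cong (λ q → F (proj₁ q) (proj₂ q + x)) periodic ⟩
      F (proj₁ (it (K ℕ.+ K !))) (proj₂ (it (K ℕ.+ K !)) + x)                         ≡⟨ run-to (K ℕ.+ K !) ⟨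
      F p (Y + pw d c * (rep (d ℕ.^ e) s (K ℕ.+ K !) + pw (d ℕ.^ e) (K ℕ.+ K !) * x)) ∎
      where
      κ = digits c (remainder c Y)
      p′ = go p κ
      c′ = quotient c Y
      it = iterate (carry-step e s) (p′ , c′)
      run-to : ∀ n → F p (Y + pw d c * (rep (d ℕ.^ e) s n + pw (d ℕ.^ e) n * x)) ≡ F (proj₁ (it n)) (proj₂ (it n) + x)
      run-to n = trans (F-division rp c Y _) (carry-run e s n c′ x (reach-go rp κ))
      inv : ∀ n → ∣ proj₂ (it n) ∣ ℕ.≤ B
      inv n = carry-bound e 1≤e s B s≤ n p′ c′ (quotient≤ c Y B Y≤)
      periodic : it K ≡ it (K ℕ.+ K !)
      periodic = iterate-periodic (carry-step e s) (p′ , c′) K (carry-code B) (λ i j → carry-code-injective B (it i) (it j) (inv i) (inv j))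

  -- The factorial serves twice. It is at least the preperiod and a multiple of the period of
  -- reading any one digit repeatedly, and it is a multiple of the length of every loop no longer
  -- than `nStates`.
  δ : ℕ
  δ = nStates !

  1≤δ : 1 ℕ.≤ δ
  1≤δ = ℕₚ.1≤n! nStates

  D : ℕ
  D = d ℕ.^ δ

  2≤D : 2 ℕ.≤ D
  2≤D = 2≤^ 2≤d 1≤δ

  go-replicate : ∀ p n k → go p (replicate n k) ≡ iterate (λ q → step q (pos-digit k)) p n
  go-replicate p zero    k = refl
  go-replicate p (suc n) k = go-replicate (step p (pos-digit k)) n k

  n≤n! : ∀ n → n ℕ.≤ n !
  n≤n! zero    = z≤n
  n≤n! (suc n) = ℕₚ.≤-trans (ℕₚ.≤-reflexive (sym (ℕₚ.*-identityʳ (suc n)))) (ℕₚ.*-monoʳ-≤ (suc n) (ℕₚ.1≤n! n))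

  go-replicate-idempotent : ∀ p k → go p (replicate δ k) ≡ go p (replicate (δ ℕ.+ δ) k)
  go-replicate-idempotent p k with ℕₚ.m≤n⇒∃[o]m+o≡n (n≤n! nStates)
  ... | r , eq = begin
    go p (replicate δ k)                       ≡⟨ go-replicate p δ k ⟩
    iterate t p δ                              ≡⟨ cong (iterate t p) eq ⟨
    iterate t p (nStates ℕ.+ r)                ≡⟨ iterate-+ t p nStates r ⟩
    iterate t (iterate t p nStates) r          ≡⟨ cong (λ q → iterate t q r) (iterate-periodic t p nStates (λ q → q) (λ _ _ e → e)) ⟩
    iterate t (iterate t p (nStates ℕ.+ δ)) r  ≡⟨ iterate-+ t p (nStates ℕ.+ δ) r ⟨
    iterate t p (nStates ℕ.+ δ ℕ.+ r)          ≡⟨ cong (iterate t p) (trans (lem nStates δ r) (cong (ℕ._+ δ) eq)) ⟩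
    iterate t p (δ ℕ.+ δ)                      ≡⟨ go-replicate p (δ ℕ.+ δ) k ⟨
    go p (replicate (δ ℕ.+ δ) k)               ∎
    where
    open ≡-Reasoning
    t = λ q → step q (pos-digit k)
    lem : ∀ a b c → a ℕ.+ b ℕ.+ c ≡ a ℕ.+ c ℕ.+ b
    lem = solveℕ

  settle-digit : ∀ {p} → Reachable p → ∀ k y → F p (rep d (+ toℕ k) δ + pw d δ * y) ≡ F p (rep d (+ toℕ k) (δ ℕ.+ δ) + pw d (δ ℕ.+ δ) * y)
  settle-digit {p} rp k y = trans (block δ) (trans (cong (λ q → F q y) (go-replicate-idempotent p k)) (sym (block (δ ℕ.+ δ))))
    where
    block : ∀ n → F p (rep d (+ toℕ k) n + pw d n * y) ≡ F (go p (replicate n k)) y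
    block n = trans (cong₂ (λ v l → F p (v + pw d l * y)) (sym (val-replicate n k)) (sym (Listₚ.length-replicate n))) (F-go rp (replicate n k) y)

  settle-zero : ∀ {p} → Reachable p → ∀ y → F p (pw d δ * y) ≡ F p (pw d (δ ℕ.+ δ) * y)
  settle-zero {p} rp y = trans (sym (eq δ)) (trans (settle-digit rp k y) (eq (δ ℕ.+ δ)))
    where
    k = fromℕ< 1≤d
    eq : ∀ n → F p (rep d (+ toℕ k) n + pw d n * y) ≡ F p (pw d n * y)
    eq n = cong (F p) (trans (cong (_+ pw d n * y) (trans (cong (λ v → rep d (+ v) n) (Finₚ.toℕ-fromℕ< 1≤d)) (rep-zero d n))) (ℤₚ.+-identityˡ (pw d n * y)))

  -- `-1 + d ^ n * y` is a run of `n` digits `d - 1` followed by `y - 1`.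
  settle-minus-one : ∀ {p} → Reachable p → ∀ y → F p (- + 1 + pw d δ * y) ≡ F p (- + 1 + pw d (δ ℕ.+ δ) * y)
  settle-minus-one {p} rp y = trans (sym (eq δ)) (trans (settle-digit rp k (y - + 1)) (eq (δ ℕ.+ δ)))
    where
    k = fromℕ< (ℕₚ.≤-reflexive (ℕₚ.m+[n∸m]≡n 1≤d))
    lem₂ : ∀ p r y → (p * + 1 ≡ + 1 + r) → r + p * (y - + 1) ≡ - + 1 + p * y
    lem₂ p r y e = trans (lem₃ p r y) (trans (cong (λ w → + 1 + r - w + (- + 1 + p * y)) e) (lem₄ (+ 1 + r) (- + 1 + p * y)))
      where
      lem₃ : ∀ p r y → r + p * (y - + 1) ≡ + 1 + r - p * + 1 + (- + 1 + p * y)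
      lem₃ = solve-∀
      lem₄ : ∀ a b → a - a + b ≡ b
      lem₄ = solve-∀
    k≡ : + toℕ k ≡ (+ d - + 1) * + 1
    k≡ = trans (cong +_ (Finₚ.toℕ-fromℕ< (ℕₚ.≤-reflexive (ℕₚ.m+[n∸m]≡n 1≤d)))) (trans (sym (ℤₚ.⊖-≥ 1≤d)) (trans (sym (ℤₚ.m-n≡m⊖n d 1)) (sym (ℤₚ.*-identityʳ (+ d - + 1)))))
    eq : ∀ n → F p (rep d (+ toℕ k) n + pw d n * (y - + 1)) ≡ F p (- + 1 + pw d n * y)
    eq n = cong (F p) (trans (cong (λ v → rep d v n + pw d n * (y - + 1)) k≡) (lem₂ (pw d n) (rep d ((+ d - + 1) * + 1) n) y (pw-rep d n (+ 1))))

  pwD : ∀ n → pw D n ≡ pw d (δ ℕ.* n)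
  pwD n = pw-* d δ n

  -- Division of `z` by `D ^ j` leaves the quotient `0` or `-1`. What separates it from `x` is then
  -- a run of the digit `0` or `d - 1`, of length `δ` on one side and `2δ` on the other.
  F-settle : ∀ {p} → Reachable p → ∀ j z x → ∣ z ∣ ℕ.< D ℕ.^ j → F p (z + pw D (suc j) * x) ≡ F p (z + pw D (suc (suc j)) * x)
  F-settle {p} rp j z x z< = trans (reduce z 1) (trans (core (quotient e z) small) (sym (reduce z 2)))
    where
    open ≡-Reasoning
    e = δ ℕ.* j
    κ = digits e (remainder e z)
    rq : Reachable (go p κ)
    rq = reach-go rp κ
    lem : ∀ n → j ℕ.+ n ≡ n ℕ.+ j
    lem n = ℕₚ.+-comm j n
    reduce : ∀ z n → F p (z + pw D (n ℕ.+ j) * x) ≡ F (go p (digits e (remainder e z))) (quotient e z + pw d (δ ℕ.* n) * x)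
    reduce z n = begin
      F p (z + pw D (n ℕ.+ j) * x)                     ≡⟨ cong (λ w → F p (z + w * x)) (trans (cong (pw D) (sym (lem n))) (trans (pw-+ D j n) (cong₂ _*_ (pwD j) (pwD n)))) ⟩
      F p (z + pw d e * pw d (δ ℕ.* n) * x)            ≡⟨ cong (λ w → F p (z + w)) (ℤₚ.*-assoc (pw d e) (pw d (δ ℕ.* n)) x) ⟩
      F p (z + pw d e * (pw d (δ ℕ.* n) * x))          ≡⟨ F-division rp e z _ ⟩
      _                                                ∎
    δ1 : δ ℕ.* 1 ≡ δ
    δ1 = ℕₚ.*-identityʳ δ
    δ2 : δ ℕ.* 2 ≡ δ ℕ.+ δ
    δ2 = lemℕ δ
      where
      lemℕ : ∀ a → a ℕ.* 2 ≡ a ℕ.+ a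
      lemℕ = solveℕ
    small : quotient e z ≡ + 0 ⊎ quotient e z ≡ - + 1
    small = q-small (quotient e z) (a≡a%ℕn+[a/ℕn]*n z (d ℕ.^ e) {{d^≢0 e}})
      where
      z<e : ∣ z ∣ ℕ.< d ℕ.^ e
      z<e = subst (∣ z ∣ ℕ.<_) (ℕₚ.^-*-assoc d δ j) z<
      q-small : ∀ q → z ≡ + remainder e z + q * + (d ℕ.^ e) → q ≡ + 0 ⊎ q ≡ - + 1
      q-small (+ zero) _ = inj₁ refl
      q-small -[1+ zero ] _ = inj₂ refl
      q-small (+ suc k) eq = ⊥-elim (ℕₚ.<⇒≱ z<e (ℕₚ.≤-trans (ℕₚ.m≤m+n (d ℕ.^ e) (k ℕ.* d ℕ.^ e)) (ℕₚ.≤-trans (ℕₚ.m≤n+m (suc k ℕ.* d ℕ.^ e) (remainder e z)) (ℕₚ.≤-reflexive (sym (cong ∣_∣ (trans eq (cong (λ w → + remainder e z + w) (sym (ℤₚ.pos-* (suc k) (d ℕ.^ e)))))))))))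
      q-small -[1+ suc k ] eq = ⊥-elim (ℕₚ.<⇒≱ z<e (subst (d ℕ.^ e ℕ.≤_) (sym ∣z∣≡) d^e≤))
        where
        r = remainder e z
        r< : r ℕ.< d ℕ.^ e
        r< = n%ℕd<d z (d ℕ.^ e) {{d^≢0 e}}
        r≤ : r ℕ.≤ suc (suc k) ℕ.* d ℕ.^ e
        r≤ = ℕₚ.≤-trans (ℕₚ.<⇒≤ r<) (ℕₚ.m≤m+n (d ℕ.^ e) _)
        ∣z∣≡ : ∣ z ∣ ≡ suc (suc k) ℕ.* d ℕ.^ e ℕ.∸ r
        ∣z∣≡ = trans (cong ∣_∣ (trans eq (cong (λ w → + r + w) (trans (sym (ℤₚ.neg-distribˡ-* (+ suc (suc k)) (+ (d ℕ.^ e)))) (cong -_ (sym (ℤₚ.pos-* (suc (suc k)) (d ℕ.^ e))))))))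
             (trans (cong ∣_∣ (ℤₚ.m-n≡m⊖n r (suc (suc k) ℕ.* d ℕ.^ e))) (trans (cong ∣_∣ (ℤₚ.⊖-≤ r≤)) (ℤₚ.∣-i∣≡∣i∣ (+ (suc (suc k) ℕ.* d ℕ.^ e ℕ.∸ r)))))
        d^e≤ : d ℕ.^ e ℕ.≤ suc (suc k) ℕ.* d ℕ.^ e ℕ.∸ r
        d^e≤ = ℕₚ.m+n≤o⇒m≤o∸n (d ℕ.^ e) (ℕₚ.+-monoʳ-≤ (d ℕ.^ e) (ℕₚ.≤-trans (ℕₚ.<⇒≤ r<) (ℕₚ.m≤m+n (d ℕ.^ e) (k ℕ.* d ℕ.^ e))))
    core : ∀ q → q ≡ + 0 ⊎ q ≡ - + 1 → F (go p κ) (q + pw d (δ ℕ.* 1) * x) ≡ F (go p κ) (q + pw d (δ ℕ.* 2) * x)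
    core q (inj₁ refl) = begin
      F (go p κ) (+ 0 + pw d (δ ℕ.* 1) * x)  ≡⟨ cong (F (go p κ)) (trans (ℤₚ.+-identityˡ _) (cong (λ k → pw d k * x) δ1)) ⟩
      F (go p κ) (pw d δ * x)                ≡⟨ settle-zero rq x ⟩
      F (go p κ) (pw d (δ ℕ.+ δ) * x)        ≡⟨ cong (F (go p κ)) (trans (ℤₚ.+-identityˡ _) (cong (λ k → pw d k * x) δ2)) ⟨
      F (go p κ) (+ 0 + pw d (δ ℕ.* 2) * x)  ∎
    core q (inj₂ refl) = begin
      F (go p κ) (- + 1 + pw d (δ ℕ.* 1) * x)  ≡⟨ cong (λ k → F (go p κ) (- + 1 + pw d k * x)) δ1 ⟩
      F (go p κ) (- + 1 + pw d δ * x)          ≡⟨ settle-minus-one rq x ⟩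
      F (go p κ) (- + 1 + pw d (δ ℕ.+ δ) * x)  ≡⟨ cong (λ k → F (go p κ) (- + 1 + pw d k * x)) δ2 ⟨
      F (go p κ) (- + 1 + pw d (δ ℕ.* 2) * x)  ∎

  open Tameness D 2≤D public

  F-tame : ∀ {N} → SumLadderFree N A → ∀ {p} → Reachable p → Tame (F p)
  F-tame {N} nl {p} rp = record { size = N ; noLadder = F-noLadder nl rp ; pump = λ B → from-pump B (F-pump δ 1≤δ B) ; settle = F-settle rp }
    where
    open ≡-Reasoning
    lem : ∀ Y w → Y + w ≡ Y + + 1 * w
    lem = solve-∀
    from-pump : ∀ B → (∃ λ K → ∃ λ N → 1 ℕ.≤ N × (∀ {p} → Reachable p → Pump δ (F p) B K N)) →
      ∃ λ K → ∃ λ N → 1 ℕ.≤ N × (∀ Y s x → ∣ Y ∣ ℕ.≤ B → ∣ s ∣ ℕ.≤ B →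
        F p (Y + (rep D s K + pw D K * x)) ≡ F p (Y + (rep D s (K ℕ.+ N) + pw D (K ℕ.+ N) * x)))
    from-pump B (K , N′ , 1≤N′ , pump) = K , N′ , 1≤N′ , λ Y s x Y≤ s≤ → begin
        F p (Y + (rep D s K + pw D K * x))                                ≡⟨ cong (F p) (lem Y (rep D s K + pw D K * x)) ⟩
        F p (Y + pw d 0 * (rep D s K + pw D K * x))                       ≡⟨ pump rp Y 0 s x (subst (∣ Y ∣ ℕ.≤_) (sym (ℕₚ.*-identityʳ B)) Y≤) s≤ ⟩
        F p (Y + pw d 0 * (rep D s (K ℕ.+ N′) + pw D (K ℕ.+ N′) * x))     ≡⟨ cong (F p) (lem Y (rep D s (K ℕ.+ N′) + pw D (K ℕ.+ N′) * x)) ⟨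
        F p (Y + (rep D s (K ℕ.+ N′) + pw D (K ℕ.+ N′) * x))              ∎

  -- The factor between two visits to the same state is cut out. States are compared only after the
  -- first letter, so the remaining loop is nonempty.
  short-loop : ∀ fuel p κ → length κ ℕ.≤ fuel → 1 ℕ.≤ length κ → go p κ ≡ p → ∃ λ κ′ → 1 ℕ.≤ length κ′ × length κ′ ℕ.≤ nStates × go p κ′ ≡ p
  short-loop zero p κ κ≤ 1≤κ e = ⊥-elim (ℕₚ.<⇒≱ 1≤κ κ≤)
  short-loop (suc fuel) p κ κ≤ 1≤κ e with length κ ℕₚ.≤? nStates
  ... | yes q = κ , 1≤κ , q , e
  ... | no ¬q with Finₚ.pigeonhole (ℕₚ.n<1+n nStates) (λ i → go p (take (suc (toℕ i)) κ))
  ...   | i , j , i<j , same = short-loop fuel p κ′ (ℕₚ.≤-pred (ℕₚ.≤-trans shorter κ≤)) nonempty loop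
    where
    open ≡-Reasoning
    a = suc (toℕ i)
    b = suc (toℕ j)
    b≤ : b ℕ.≤ length κ
    b≤ = ℕₚ.≤-trans (Finₚ.toℕ<n j) (ℕₚ.≰⇒> ¬q)
    a≤ : a ℕ.≤ length κ
    a≤ = ℕₚ.≤-trans (s≤s (ℕₚ.<⇒≤ i<j)) b≤
    κ′ = take a κ ++ drop b κ
    len : length κ′ ≡ a ℕ.+ (length κ ℕ.∸ b)
    len = trans (Listₚ.length-++ (take a κ)) (cong₂ ℕ._+_ (trans (Listₚ.length-take a κ) (ℕₚ.m≤n⇒m⊓n≡m a≤)) (Listₚ.length-drop b κ))
    nonempty : 1 ℕ.≤ length κ′
    nonempty = subst (1 ℕ.≤_) (sym len) (s≤s z≤n)
    shorter : length κ′ ℕ.< length κ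
    shorter = subst (ℕ._< length κ) (sym len) (ℕₚ.<-≤-trans (ℕₚ.+-monoˡ-< (length κ ℕ.∸ b) (s≤s i<j)) (ℕₚ.≤-reflexive (ℕₚ.m+[n∸m]≡n b≤)))
    loop : go p κ′ ≡ p
    loop = begin
      go p (take a κ ++ drop b κ)         ≡⟨ go-++ p (take a κ) (drop b κ) ⟩
      go (go p (take a κ)) (drop b κ)     ≡⟨ cong (λ q → go q (drop b κ)) same ⟩
      go (go p (take b κ)) (drop b κ)     ≡⟨ go-++ p (take b κ) (drop b κ) ⟨
      go p (take b κ ++ drop b κ)         ≡⟨ cong (go p) (Listₚ.take++drop≡id b κ) ⟩
      go p κ                              ≡⟨ e ⟩
      p                                   ∎

  power : ℕ → List (Fin d) → List (Fin d)
  power zero    κ = []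
  power (suc q) κ = κ ++ power q κ

  length-power : ∀ q κ → length (power q κ) ≡ q ℕ.* length κ
  length-power zero    κ = refl
  length-power (suc q) κ = trans (Listₚ.length-++ κ) (cong (length κ ℕ.+_) (length-power q κ))

  go-power : ∀ q p κ → go p κ ≡ p → go p (power q κ) ≡ p
  go-power zero    p κ e = refl
  go-power (suc q) p κ e = trans (go-++ p κ (power q κ)) (trans (cong (λ r → go r (power q κ)) e) (go-power q p κ e))

  val-bound : ∀ κ → ∃ λ w → val κ ≡ + w × w ℕ.< d ℕ.^ length κ
  val-bound [] = 0 , refl , s≤s z≤n
  val-bound (k ∷ κ) with val-bound κ
  ... | w , eq , w< = toℕ k ℕ.+ d ℕ.* w , trans (cong (λ v → + toℕ k + + d * v) eq) (cong (λ v → + toℕ k + v) (sym (ℤₚ.pos-* d w))) ,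
    ℕₚ.<-≤-trans (ℕₚ.+-monoˡ-< (d ℕ.* w) (Finₚ.toℕ<n k)) (ℕₚ.≤-trans (ℕₚ.≤-reflexive (sym (ℕₚ.*-suc d w))) (ℕₚ.*-monoʳ-≤ d w<))

  -- The length of a short loop divides δ = nStates !, so a power of it is a single digit in base D.
  block-loop : ∀ {p} → Reachable p → ∀ κ → 1 ℕ.≤ length κ → go p κ ≡ p → ∃ λ v → v ℕ.< D × (∀ x → F p (+ v + + D * x) ≡ F p x)
  block-loop {p} rp κ 1≤κ e with short-loop (length κ) p κ ℕₚ.≤-refl 1≤κ e
  ... | k ∷ κ′ , _ , κ′≤ , e′ with suc∣! κ′≤
  ...   | divides q δ≡ = finish (val-bound ℓ)
    where
    ℓ = power q (k ∷ κ′)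
    ∣ℓ∣ : δ ≡ length ℓ
    ∣ℓ∣ = trans δ≡ (sym (length-power q (k ∷ κ′)))
    loop : ∀ x → F p (val ℓ + + D * x) ≡ F p x
    loop x = trans (cong (λ n → F p (val ℓ + pw d n * x)) ∣ℓ∣) (trans (F-go rp ℓ x) (cong (λ r → F r x) (go-power q p (k ∷ κ′) e′)))
    finish : (∃ λ w → val ℓ ≡ + w × w ℕ.< d ℕ.^ length ℓ) → ∃ λ v → v ℕ.< D × (∀ x → F p (+ v + + D * x) ≡ F p x)
    finish (w , eq , w<) = w , subst (λ n → w ℕ.< d ℕ.^ n) (sym ∣ℓ∣) w< , λ x → trans (cong (λ u → F p (u + + D * x)) (sym eq)) (loop x)

-- Comparison of `f` with its limit `E s f`

module Covering (d : ℕ) (2≤d : 2 ℕ.≤ d) (A : ℤ → Set) (M : DFA d) (acc : ∀ σ → DFA.Accepts M σ ⇔ A (eval d σ)) (N : ℕ) (nl : SumLadderFree N A) where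

  open Kernel d 2≤d A M acc

  open DFA M using (nStates; start)

  tame : ∀ {p} → Reachable p → Tame (F p)
  tame rp = F-tame nl rp

  -- The base `D * D` puts a zero after each digit `1` of `s`. In base `D`, the top digit of one
  -- copy of `s` would touch the next copy, whereas `E-E` needs a free digit between them.
  spread : ℕ
  spread = d ℕ.^ (δ ℕ.+ δ)

  spread≡ : spread ≡ D ℕ.* D
  spread≡ = ℕₚ.^-distribˡ-+-* d δ δ

  2≤spread : 2 ℕ.≤ spread
  2≤spread = subst (2 ℕ.≤_) (sym spread≡) (ℕₚ.≤-trans 2≤D (ℕₚ.m≤m*n D D {{ℕ.>-nonZero 1≤D}}))

  ones-pump : ∃ λ K → ∃ λ M → 1 ℕ.≤ M × (∀ {p} → Reachable p → Pump (δ ℕ.+ δ) (F p) 1 K M)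
  ones-pump = F-pump (δ ℕ.+ δ) (ℕₚ.≤-trans 1≤δ (ℕₚ.m≤m+n δ δ)) 1

  -- `ones-count` is at least `K₁` and a positive multiple of `M₁`, so pumping can double the number
  -- of ones.
  K₁ M₁ ones-count : ℕ
  K₁ = proj₁ ones-pump
  M₁ = proj₁ (proj₂ ones-pump)
  ones-count = suc K₁ ℕ.* M₁

  s : ℤ
  s = rep spread (+ 1) ones-count

  count-split : ∃ λ r → ones-count ≡ K₁ ℕ.+ r
  count-split = let r , eq = ℕₚ.m≤n⇒∃[o]m+o≡n K≤ in r , sym eq
    where
    K≤ : K₁ ℕ.≤ ones-count
    K≤ = ℕₚ.≤-trans (ℕₚ.n≤1+n K₁) (ℕₚ.≤-trans (ℕₚ.≤-reflexive (sym (ℕₚ.*-identityʳ (suc K₁)))) (ℕₚ.*-monoʳ-≤ (suc K₁) (proj₁ (proj₂ (proj₂ ones-pump)))))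

  count-suc : ∃ λ a → ones-count ≡ suc a
  count-suc = let r , eq = ℕₚ.m≤n⇒∃[o]m+o≡n 1≤ in r , sym eq
    where
    1≤ : 1 ℕ.≤ ones-count
    1≤ = ℕₚ.*-mono-≤ {1} {suc K₁} (s≤s z≤n) (proj₁ (proj₂ (proj₂ ones-pump)))

  ones-bound : ∀ a → ∃ λ r → rep spread (+ 1) (suc a) ≡ + suc r × suc (suc r) ℕ.≤ D ℕ.* spread ℕ.^ a
  ones-bound zero = 0 , trans (cong (λ w → + 1 + w) (ℤₚ.*-zeroʳ (+ spread))) refl , ℕₚ.≤-trans 2≤D (ℕₚ.≤-reflexive (sym (ℕₚ.*-identityʳ D)))
  ones-bound (suc a) with ones-bound a
  ... | r , eq , r< = spread ℕ.* suc r , trans (cong (λ w → + 1 + + spread * w) eq) (cong (λ w → + 1 + w) (sym (ℤₚ.pos-* spread (suc r)))) ,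
    ℕₚ.≤-trans (ℕₚ.+-monoˡ-≤ (spread ℕ.* suc r) 2≤spread) (ℕₚ.≤-trans (ℕₚ.≤-reflexive (sym (ℕₚ.*-suc spread (suc r))))
      (ℕₚ.≤-trans (ℕₚ.*-monoʳ-≤ spread r<) (ℕₚ.≤-reflexive (lem spread D (spread ℕ.^ a)))))
    where
    lem : ∀ b D p → b ℕ.* (D ℕ.* p) ≡ D ℕ.* (b ℕ.* p)
    lem = solveℕ

  s≢0 : ¬ s ≡ + 0
  s≢0 e = absurd (trans (sym (cong (rep spread (+ 1)) (proj₂ count-suc))) e)
    where
    absurd : ¬ rep spread (+ 1) (suc (proj₁ count-suc)) ≡ + 0
    absurd e′ with trans (sym (proj₁ (proj₂ (ones-bound (proj₁ count-suc))))) e′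
    ... | ()

  spread^ : ∀ a → spread ℕ.^ a ≡ D ℕ.^ (a ℕ.+ a)
  spread^ a = trans (ℕₚ.^-*-assoc d (δ ℕ.+ δ) a) (trans (cong (d ℕ.^_) (lem δ a)) (sym (ℕₚ.^-*-assoc d δ (a ℕ.+ a))))
    where
    lem : ∀ δ a → (δ ℕ.+ δ) ℕ.* a ≡ δ ℕ.* (a ℕ.+ a)
    lem = solveℕ

  ∣s∣< : ∃ λ j → suc ∣ s ∣ ℕ.≤ D ℕ.^ j × j ℕ.< ones-count ℕ.+ ones-count
  ∣s∣< = suc (a ℕ.+ a) , ℕₚ.≤-trans (ℕₚ.≤-reflexive (cong suc ∣s∣≡)) (ℕₚ.≤-trans (proj₂ (proj₂ (ones-bound a))) (ℕₚ.≤-reflexive (cong (D ℕ.*_) (spread^ a)))) ,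
    subst (λ c → suc (a ℕ.+ a) ℕ.< c ℕ.+ c) (sym (proj₂ count-suc)) (s≤s (ℕₚ.≤-reflexive (sym (ℕₚ.+-suc a a))))
    where
    a = proj₁ count-suc
    ∣s∣≡ : ∣ s ∣ ≡ suc (proj₁ (ones-bound a))
    ∣s∣≡ = cong ∣_∣ (trans (cong (rep spread (+ 1)) (proj₂ count-suc)) (proj₁ (proj₂ (ones-bound a))))

  -- Nesting the limits puts a second copy of `s` directly above the first, which gives the same
  -- pattern with twice as many ones.
  E-idempotent : ∀ {p} → Reachable p → ∀ z → E s (E s (F p)) z ≡ E s (F p) z
  E-idempotent {p} rp z = begin
    E s (E s (F p)) z                                         ≡⟨ E-E (tame rp) s s (proj₁ ∣s∣<) (c ℕ.+ c) (proj₁ (proj₂ ∣s∣<)) (proj₂ (proj₂ ∣s∣<)) z ⟩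
    F p (z + q * (s + pw D (c ℕ.+ c) * s))                    ≡⟨ cong (λ w → F p (z + q * (s + w * s))) (sym (cong +_ (spread^ c))) ⟩
    F p (z + q * (s + pw spread c * s))                       ≡⟨ cong (λ w → F p (z + q * w)) (rep-+ spread (+ 1) c c) ⟨
    F p (z + q * rep spread (+ 1) (c ℕ.+ c))                  ≡⟨ cong (λ w → F p (z + w * rep spread (+ 1) (c ℕ.+ c))) (pwD l) ⟩
    F p (z + q′ * rep spread (+ 1) (c ℕ.+ c))                 ≡⟨ cong (F p) (lem z q′ (rep spread (+ 1) (c ℕ.+ c)) (pw spread (c ℕ.+ c))) ⟩
    at (c ℕ.+ c)                                              ≡⟨ cong (λ k → at (k ℕ.+ c)) c≡ ⟩
    at (K₁ ℕ.+ r ℕ.+ suc K₁ ℕ.* M₁)                           ≡⟨ pump-iterate (F p) (λ w → z + q′ * w) spread (+ 1) K₁ M₁ (λ x → proj₂ (proj₂ (proj₂ ones-pump)) rp z (δ ℕ.* l) (+ 1) x z≤ ℕₚ.≤-refl) r (suc K₁) (+ 0) ⟨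
    at (K₁ ℕ.+ r)                                             ≡⟨ cong at c≡ ⟨
    at c                                                      ≡⟨ cong (F p) (lem z q′ s (pw spread c)) ⟨
    F p (z + q′ * s)                                          ≡⟨ cong (λ w → F p (z + w * s)) (pwD l) ⟨
    E s (F p) z                                               ∎
    where
    open ≡-Reasoning
    c = ones-count
    l = suc ∣ z ∣
    q = pw D l
    q′ = pw d (δ ℕ.* l)
    r = proj₁ count-split
    c≡ : c ≡ K₁ ℕ.+ r
    c≡ = proj₂ count-split
    at : ℕ → Bool
    at k = F p (z + q′ * (rep spread (+ 1) k + pw spread k * + 0))
    lem : ∀ z q w u → z + q * w ≡ z + q * (w + u * + 0)
    lem = solve-∀
    z≤ : ∣ z ∣ ℕ.≤ 1 ℕ.* d ℕ.^ (δ ℕ.* l)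
    z≤ = ℕₚ.≤-trans (ℕₚ.<⇒≤ (ℕₚ.<-≤-trans (size< z) (^-mono 2≤D (ℕₚ.n≤1+n ∣ z ∣)))) (ℕₚ.≤-reflexive (trans (ℕₚ.^-*-assoc d δ l) (sym (ℕₚ.*-identityˡ _))))

  E-go : ∀ {p} → Reachable p → ∀ κ j → length κ ≡ δ ℕ.* j → ∀ x → E s (F p) (val κ + pw D j * x) ≡ E s (F (go p κ)) x
  E-go {p} rp κ j len x = begin
    E s (F p) y                                             ≡⟨ E-at′ (tame rp) (j ℕ.+ L) y s (ℕₚ.<-≤-trans (s≤s (ℕₚ.m≤m+n ∣ y ∣ ∣ x ∣)) (ℕₚ.m≤n+m L j)) ⟩
    F p (y + pw D (j ℕ.+ L) * s)                            ≡⟨ cong (λ w → F p (y + w * s)) (pw-+ D j L) ⟩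
    F p (y + pw D j * pw D L * s)                           ≡⟨ cong (F p) (lem (val κ) (pw D j) x (pw D L) s) ⟩
    F p (val κ + pw D j * (x + pw D L * s))                 ≡⟨ cong (λ w → F p (val κ + w * (x + pw D L * s))) (trans (pwD j) (cong (pw d) (sym len))) ⟩
    F p (val κ + pw d (length κ) * (x + pw D L * s))        ≡⟨ F-go rp κ _ ⟩
    F (go p κ) (x + pw D L * s)                             ≡⟨ E-at′ (tame (reach-go rp κ)) L x s (s≤s (ℕₚ.m≤n+m ∣ x ∣ ∣ y ∣)) ⟨
    E s (F (go p κ)) x                                      ∎
    where
    open ≡-Reasoning
    y = val κ + pw D j * x
    L = suc (∣ y ∣ ℕ.+ ∣ x ∣)
    lem : ∀ v p x q s → v + p * x + p * q * s ≡ v + p * (x + q * s)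
    lem = solve-∀

  F-goD : ∀ {p} → Reachable p → ∀ κ j → length κ ≡ δ ℕ.* j → ∀ x → F p (val κ + pw D j * x) ≡ F (go p κ) x
  F-goD {p} rp κ j len x = trans (cong (λ w → F p (val κ + w * x)) (trans (pwD j) (cong (pw d) (sym len)))) (F-go rp κ x)

  letters : ℕ → ℤ → List (Fin d)
  letters zero    z = []
  letters (suc n) z = digits δ (remainder δ z) ++ letters n (quotient δ z)

  rest : ℕ → ℤ → ℤ
  rest zero    z = z
  rest (suc n) z = rest n (quotient δ z)

  length-letters : ∀ n z → length (letters n z) ≡ δ ℕ.* n
  length-letters zero    z = sym (ℕₚ.*-zeroʳ δ)
  length-letters (suc n) z = trans (Listₚ.length-++ (digits δ (remainder δ z))) (trans (cong₂ ℕ._+_ (length-digits δ (remainder δ z)) (length-letters n (quotient δ z))) (sym (ℕₚ.*-suc δ n)))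

  letters-rest : ∀ n z → z ≡ val (letters n z) + pw D n * rest n z
  letters-rest zero z = lem z
    where
    lem : ∀ z → z ≡ + 0 + + 1 * z
    lem = solve-∀
  letters-rest (suc n) z = begin
    z                                                                ≡⟨ division δ z ⟩
    val κ + pw d δ * q                                               ≡⟨ cong (λ w → val κ + pw d δ * w) (letters-rest n q) ⟩
    val κ + pw d δ * (val (letters n q) + pw D n * rest n q)         ≡⟨ lem (val κ) (pw d δ) (val (letters n q)) (pw D n) (rest n q) ⟩
    val κ + pw d δ * val (letters n q) + + D * pw D n * rest n q     ≡⟨ cong₂ (λ u w → u + w * rest n q) (trans (cong (λ l → val κ + pw d l * val (letters n q)) (sym (length-digits δ (remainder δ z)))) (sym (val-++ κ (letters n q)))) (sym (pw-suc D n)) ⟩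
    val (κ ++ letters n q) + pw D (suc n) * rest n q                 ∎
    where
    open ≡-Reasoning
    κ = digits δ (remainder δ z)
    q = quotient δ z
    lem : ∀ v d w p r → v + d * (w + p * r) ≡ v + d * w + d * p * r
    lem = solve-∀

  letters-+ : ∀ m n z → letters (m ℕ.+ n) z ≡ letters m z ++ letters n (rest m z)
  letters-+ zero    n z = refl
  letters-+ (suc m) n z = trans (cong (digits δ (remainder δ z) ++_) (letters-+ m n (quotient δ z))) (sym (Listₚ.++-assoc (digits δ (remainder δ z)) _ _))

  rest-+ : ∀ m n z → rest (m ℕ.+ n) z ≡ rest n (rest m z)
  rest-+ zero    n z = refl
  rest-+ (suc m) n z = rest-+ m n (quotient δ z)

  block : State → ℤ → ℕ → State
  block p z n = go p (letters n z)

  block-+ : ∀ p z m n → block p z (m ℕ.+ n) ≡ block (block p z m) (rest m z) n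
  block-+ p z m n = trans (cong (go p) (letters-+ m n z)) (go-++ p (letters m z) (letters n (rest m z)))

  -- `E s (F p)` inherits the loop, and `E-idempotent` says that `s` fixes it, so `fixes⇒periodic`
  -- applies with `h = s`.
  loop⇒periodic : ∀ {p} → Reachable p → ∀ v → (∀ x → F p (v + + D * x) ≡ F p x) → ∀ n z → E s (F p) (z + + n * s) ≡ E s (F p) z
  loop⇒periodic {p} rp v loop zero    z = cong (E s (F p)) (lem z s)
    where
    lem : ∀ z s → z + + 0 * s ≡ z
    lem = solve-∀
  loop⇒periodic {p} rp v loop (suc n) z = begin
    E s (F p) (z + + suc n * s)        ≡⟨ cong (E s (F p)) (lem z (+ n) s) ⟩
    E s (F p) (z + + n * s + s)        ≡⟨ fixes⇒periodic (E-tame (tame rp) s) v E-run s s≢0 (E-idempotent rp) (z + + n * s) ⟩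
    E s (F p) (z + + n * s)            ≡⟨ loop⇒periodic rp v loop n z ⟩
    E s (F p) z                        ∎
    where
    open ≡-Reasoning
    lem : ∀ z n s → z + (+ 1 + n) * s ≡ z + n * s + s
    lem = solve-∀
    D1 : D ℕ.^ 1 ≡ D
    D1 = ℕₚ.*-identityʳ D
    E-run : ∀ x → E s (F p) (v + + D * x) ≡ E s (F p) x
    E-run x = begin
      E s (F p) (v + + D * x)                                   ≡⟨ cong (λ b → E s (F p) (v + + b * x)) (sym (trans (ℕₚ.*-identityʳ (D ℕ.^ 1)) D1)) ⟩
      E s (F p) (v + pw (D ℕ.^ 1) 1 * x)                        ≡⟨ cong (λ u → E s (F p) (u + pw (D ℕ.^ 1) 1 * x)) (lem₃ v (+ (D ℕ.^ 1))) ⟩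
      E s (F p) (rep (D ℕ.^ 1) v 1 + pw (D ℕ.^ 1) 1 * x)        ≡⟨ E-loop (tame rp) 1 v (λ y → trans (cong (λ b → F p (v + + b * y)) D1) (loop y)) s 1 x ⟩
      E s (F p) x                                               ∎
      where
      lem₃ : ∀ v b → v ≡ v + b * + 0
      lem₃ = solve-∀

  -- Among the first `nStates + 1` states read along `z` one repeats, from a position `a ≤ nStates`
  -- that varies with `z`. Once the `a` lowest digits are removed, the factor `D ^ nStates` still
  -- leaves a multiple of `s`.
  period : ℤ
  period = pw D nStates * s

  E-periodic : ∀ z → E s f (z + period) ≡ E s f z
  E-periodic z = cycle (Finₚ.pigeonhole (ℕₚ.n<1+n nStates) (λ i → block start z (toℕ i)))
    where
    open ≡-Reasoning
    rstart : Reachable start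
    rstart = [] , refl
    cycle : (∃ λ i → ∃ λ j → i Fin.< j × block start z (toℕ i) ≡ block start z (toℕ j)) → E s f (z + period) ≡ E s f z
    cycle (i , j , i<j , same) = begin
      E s f (z + period)                                    ≡⟨ cong (λ w → E s f (w + period)) (letters-rest a z) ⟩
      E s f (val κ + pw D a * y + period)                   ≡⟨ cong (λ w → E s f (val κ + pw D a * y + w * s)) (trans (cong (pw D) (sym a+c≡)) (pw-+ D a c)) ⟩
      E s f (val κ + pw D a * y + pw D a * pw D c * s)      ≡⟨ cong (E s f) (lem (val κ) (pw D a) y (pw D c) s) ⟩
      E s f (val κ + pw D a * (y + pw D c * s))             ≡⟨ E-go rstart κ a (length-letters a z) _ ⟩
      E s (F p) (y + pw D c * s)                            ≡⟨ loop⇒periodic rp (+ proj₁ lp) (proj₂ (proj₂ lp)) (D ℕ.^ c) y ⟩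
      E s (F p) y                                           ≡⟨ E-go rstart κ a (length-letters a z) y ⟨
      E s f (val κ + pw D a * y)                            ≡⟨ cong (E s f) (letters-rest a z) ⟨
      E s f z                                               ∎
      where
      a = toℕ i
      κ = letters a z
      y = rest a z
      p = block start z a
      rp : Reachable p
      rp = reach-go rstart κ
      lem : ∀ v p y c s → v + p * y + p * c * s ≡ v + p * (y + c * s)
      lem = solve-∀
      c = nStates ℕ.∸ a
      a+c≡ : a ℕ.+ c ≡ nStates
      a+c≡ = ℕₚ.m+[n∸m]≡n (Finₚ.toℕ≤pred[n] i)
      g = proj₁ (ℕₚ.m≤n⇒∃[o]m+o≡n i<j)
      g≡ : suc a ℕ.+ g ≡ toℕ j
      g≡ = proj₂ (ℕₚ.m≤n⇒∃[o]m+o≡n i<j)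
      back : go p (letters (suc g) y) ≡ p
      back = trans (sym (block-+ start z a (suc g))) (trans (cong (block start z) (trans (ℕₚ.+-suc a g) g≡)) (sym same))
      lp = block-loop rp (letters (suc g) y) (subst (1 ℕ.≤_) (sym (length-letters (suc g) y)) (ℕₚ.*-mono-≤ {1} {δ} 1≤δ (s≤s (z≤n {g})))) back

  Stop : ℤ → Set
  Stop t = t ≡ + 0 ⊎ t ≡ - + 1

  -- Covered k z says that the base-D digits of z form at most k constant runs, up to single separating digits.
  Covered : ℕ → ℤ → Set
  Covered zero    z = ⊥
  Covered (suc k) z = ∃ λ v → v ℕ.< D × ∃ λ n →
    (∃ λ t → Stop t × z ≡ rep D (+ v) n + pw D n * t) ⊎
    (∃ λ c → c ℕ.< D × ∃ λ z′ → Covered k z′ × z ≡ rep D (+ v) n + pw D n * (+ c + + D * z′))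

  last-visit : ∀ (P : ℕ → Set) → (∀ i → Dec (P i)) → P 0 → ∀ n → ∃ λ i → i ℕ.≤ n × P i × (∀ j → i ℕ.< j → j ℕ.≤ n → ¬ P j)
  last-visit P P? p₀ zero    = 0 , z≤n , p₀ , λ j 0<j j≤0 _ → ℕₚ.<⇒≱ 0<j j≤0
  last-visit P P? p₀ (suc n) with P? (suc n)
  ... | yes p = suc n , ℕₚ.≤-refl , p , λ j n<j j≤n _ → ℕₚ.<⇒≱ n<j j≤n
  ... | no ¬p with last-visit P P? p₀ n
  ...   | i , i≤n , pᵢ , later = i , ℕₚ.m≤n⇒m≤1+n i≤n , pᵢ , after
    where
    after : ∀ j → i ℕ.< j → j ℕ.≤ suc n → ¬ P j
    after j i<j j≤ with ℕₚ.m≤n⇒m<n∨m≡n j≤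
    ... | inj₁ j<  = later j i<j (ℕₚ.≤-pred j<)
    ... | inj₂ refl = ¬p

  -- Either the loop read at p before the last visit repeats a single digit, or p has two different loops, and then E s fixes F p.
  run-or-trivial : ∀ {p} → Reachable p → ∀ z i → block p z i ≡ p →
    (∃ λ v → v ℕ.< D × val (letters i z) ≡ rep D (+ v) i) ⊎ (∀ x → E s (F p) x ≡ F p x)
  run-or-trivial rp z zero    back = inj₁ (0 , 1≤D , refl)
  run-or-trivial {p} rp z (suc i) back = decide (block-loop rp κ (subst (1 ℕ.≤_) (sym (length-letters (suc i) z)) (ℕₚ.*-mono-≤ {1} {δ} 1≤δ (s≤s (z≤n {i})))) back)
    where
    κ = letters (suc i) z
    lem : ∀ u v → (u - v ≡ + 0) → u ≡ v
    lem u v e = trans (lem₁ u v) (trans (cong (_+ v) e) (ℤₚ.+-identityˡ v))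
      where
      lem₁ : ∀ u v → u ≡ u - v + v
      lem₁ = solve-∀
    decide : (∃ λ v → v ℕ.< D × (∀ x → F p (+ v + + D * x) ≡ F p x)) → _
    decide (v , v<D , loop) with val κ ℤₚ.≟ rep D (+ v) (suc i)
    ... | yes e = inj₁ (v , v<D , e)
    ... | no ¬e = inj₂ (fixes⇒E-trivial (tame rp) (+ v) loop (val κ - rep D (+ v) (suc i)) (λ e → ¬e (lem _ _ e))
            (loop-difference (tame rp) (+ v) loop (val κ) (suc i) (λ x → trans (F-goD rp κ (suc i) (length-letters (suc i) z) x) (cong (λ q → F q x) back)))
            s (E-idempotent rp))

  -- `Y` lists the states that may still be visited. Cutting at the last visit to the current state
  -- removes it from `Y`, so each state contributes at most one run. If the part before the cut is
  -- not a run, `E s` fixes `F p`; and an equality found at a later residual is carried back by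
  -- `E-go` and `F-goD`.
  covering : ∀ k (Y : List State) → length Y ℕ.≤ k → ∀ {p} → Reachable p → ∀ n z → Stop (rest n z) →
    (∀ i → i ℕ.≤ n → block p z i ∈ Y) → E s (F p) z ≡ F p z ⊎ Covered k z
  covering zero    []      _  rp n z stop inY with inY 0 z≤n
  ... | ()
  covering (suc k) Y Y≤ {p} rp n z stop inY = visit (last-visit (λ i → block p z i ≡ p) (λ i → block p z i Finₚ.≟ p) refl n)
    where
    open ≡-Reasoning
    visit : (∃ λ i → i ℕ.≤ n × block p z i ≡ p × (∀ j → i ℕ.< j → j ℕ.≤ n → ¬ block p z j ≡ p)) → E s (F p) z ≡ F p z ⊎ Covered (suc k) z
    visit (i , i≤n , back , later) = result (run-or-trivial rp z i back) (ℕₚ.m≤n⇒m<n∨m≡n i≤n)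
      where
      y = rest i z
      κ = digits δ (remainder δ y)
      y′ = quotient δ y
      p′ = go p κ
      c = remainder δ y
      c<D : c ℕ.< D
      c<D = n%ℕd<d y D {{d^≢0 δ}}
      y≡ : y ≡ + c + + D * y′
      y≡ = trans (a≡a%ℕn+[a/ℕn]*n y D {{d^≢0 δ}}) (cong (λ w → + c + w) (ℤₚ.*-comm y′ (+ D)))
      F-here : F p z ≡ F p y
      F-here = trans (cong (F p) (letters-rest i z)) (trans (F-goD rp (letters i z) i (length-letters i z) y) (cong (λ q → F q y) back))
      E-here : E s (F p) z ≡ E s (F p) y
      E-here = trans (cong (E s (F p)) (letters-rest i z)) (trans (E-go rp (letters i z) i (length-letters i z) y) (cong (λ q → E s (F q) y) back))
      κ-len : length κ ≡ δ ℕ.* 1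
      κ-len = trans (length-digits δ c) (sym (ℕₚ.*-identityʳ δ))
      y-κ : y ≡ val κ + pw D 1 * y′
      y-κ = trans (division δ y) (cong (λ b → val κ + + b * y′) (sym (ℕₚ.*-identityʳ D)))
      F-next : F p y ≡ F p′ y′
      F-next = trans (cong (F p) y-κ) (F-goD rp κ 1 κ-len y′)
      E-next : E s (F p) y ≡ E s (F p′) y′
      E-next = trans (cong (E s (F p)) y-κ) (E-go rp κ 1 κ-len y′)
      Y′ : List State
      Y′ = filter (λ q → ¬? (q Finₚ.≟ p)) Y
      Y′≤ : length Y′ ℕ.≤ k
      Y′≤ = ℕₚ.≤-pred (ℕₚ.≤-trans (Listₚ.filter-notAll (λ q → ¬? (q Finₚ.≟ p)) Y (lose (inY 0 z≤n) (λ ¬e → ¬e refl))) Y≤)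
      shift : ∀ l → block p z (suc i ℕ.+ l) ≡ block p′ y′ l
      shift l = begin
        block p z (suc i ℕ.+ l)                   ≡⟨ cong (block p z) (sym (ℕₚ.+-suc i l)) ⟩
        block p z (i ℕ.+ suc l)                   ≡⟨ block-+ p z i (suc l) ⟩
        block (block p z i) y (suc l)             ≡⟨ cong (λ q → block q y (suc l)) back ⟩
        block p y (suc l)                         ≡⟨ go-++ p κ (letters l y′) ⟩
        block p′ y′ l                             ∎
      result : (∃ λ v → v ℕ.< D × val (letters i z) ≡ rep D (+ v) i) ⊎ (∀ x → E s (F p) x ≡ F p x) → i ℕ.< n ⊎ i ≡ n → E s (F p) z ≡ F p z ⊎ Covered (suc k) z
      result (inj₂ trivial) _ = inj₁ (trivial z)
      result (inj₁ (v , v<D , run)) (inj₂ refl) = inj₂ (v , v<D , i , inj₁ (y , stop , trans (letters-rest i z) (cong (λ w → w + pw D i * y) run)))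
      result (inj₁ (v , v<D , run)) (inj₁ i<n) = next (ℕₚ.m≤n⇒∃[o]m+o≡n i<n)
        where
        next : (∃ λ l → suc i ℕ.+ l ≡ n) → E s (F p) z ≡ F p z ⊎ Covered (suc k) z
        next (l , refl) = combine (covering k Y′ Y′≤ (reach-go rp κ) l y′ stop′ inY′)
          where
          stop′ : Stop (rest l y′)
          stop′ = subst Stop (trans (cong (λ m → rest m z) (sym (ℕₚ.+-suc i l))) (rest-+ i (suc l) z)) stop
          inY′ : ∀ j → j ℕ.≤ l → block p′ y′ j ∈ Y′
          inY′ j j≤l = subst (_∈ Y′) (shift j) (∈-filter⁺ (λ q → ¬? (q Finₚ.≟ p)) (inY (suc i ℕ.+ j) (ℕₚ.+-monoʳ-≤ (suc i) j≤l)) (later (suc i ℕ.+ j) (s≤s (ℕₚ.m≤m+n i j)) (ℕₚ.+-monoʳ-≤ (suc i) j≤l)))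
          combine : E s (F p′) y′ ≡ F p′ y′ ⊎ Covered k y′ → E s (F p) z ≡ F p z ⊎ Covered (suc k) z
          combine (inj₁ e)   = inj₁ (trans E-here (trans E-next (trans e (sym (trans F-here F-next)))))
          combine (inj₂ cov) = inj₂ (v , v<D , i , inj₂ (c , c<D , y′ , cov , trans (letters-rest i z) (cong₂ (λ u w → u + pw D i * w) run y≡)))

  quotient-shrinks : ∀ z B → ∣ z ∣ ℕ.≤ suc (suc B) → ∣ quotient δ z ∣ ℕ.≤ suc B
  quotient-shrinks z B p = quotient≤ δ z (suc B) (ℕₚ.≤-trans p (ℕₚ.≤-trans (ℕₚ.≤-trans (ℕₚ.m≤m+n (suc (suc B)) B) (ℕₚ.≤-reflexive (lem B))) (ℕₚ.*-monoʳ-≤ (suc B) 2≤D)))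
    where
    lem : ∀ B → suc (suc B) ℕ.+ B ≡ suc B ℕ.* 2
    lem = solveℕ

  stops : ∀ B z → ∣ z ∣ ℕ.≤ suc B → ∃ λ n → Stop (rest n z)
  stops (suc B) z p with stops B (quotient δ z) (quotient-shrinks z B p)
  ... | n , st = suc n , st
  stops zero (+ 0) p = 0 , inj₁ refl
  stops zero -[1+ 0 ] p = 0 , inj₂ refl
  stops zero -[1+ suc n ] (s≤s ())
  stops zero (+ suc (suc n)) (s≤s ())
  -- Of the two numbers of absolute value `1`, only `+ 1` takes another division; `-1` is already a
  -- stopping value.
  stops zero (+ 1) p = 1 , inj₁ (one-quotient)
    where
    one-quotient : quotient δ (+ 1) ≡ + 0
    one-quotient = cong +_ (m<n⇒m/n≡0 {1} {D} {{d^≢0 δ}} 2≤D)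

  f-E-or-covered : ∀ z → E s f z ≡ f z ⊎ Covered nStates z
  f-E-or-covered z = let n , st = stops ∣ z ∣ z (ℕₚ.n≤1+n ∣ z ∣) in
    covering nStates (allFin nStates) (ℕₚ.≤-reflexive (Listₚ.length-tabulate (λ i → i))) ([] , refl) n z st (λ i _ → ∈-allFin (block start z i))

-- Sums of runs with pairwise distant lengths

module RunLengths (b : ℕ) (2≤b : 2 ℕ.≤ b) (N : ℕ) (f : ℤ → Bool) (nl : NoLadder N f) where

  tot : Runs → ℤ
  tot = total b

  raise : ℕ → Runs → Runs
  raise u = map (λ { (a , n) → a , n ℕ.+ u })

  weight-raise : ∀ u C → weight (raise u C) ≡ weight C
  weight-raise u []            = refl
  weight-raise u ((a , n) ∷ C) = cong (∣ a ∣ ℕ.+_) (weight-raise u C)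

  raise-0 : ∀ C → raise 0 C ≡ C
  raise-0 []            = refl
  raise-0 ((a , n) ∷ C) = cong₂ (λ m C → (a , m) ∷ C) (ℕₚ.+-identityʳ n) (raise-0 C)

  raise-raise : ∀ u v C → raise v (raise u C) ≡ raise (u ℕ.+ v) C
  raise-raise u v []            = refl
  raise-raise u v ((a , n) ∷ C) = cong₂ (λ m C → (a , m) ∷ C) (ℕₚ.+-assoc n u v) (raise-raise u v C)

  tot-++ : ∀ C C′ → tot (C ++ C′) ≡ tot C + tot C′
  tot-++ []            C′ = sym (ℤₚ.+-identityˡ (tot C′))
  tot-++ ((a , n) ∷ C) C′ = trans (cong (λ w → rep b a n + w) (tot-++ C C′)) (sym (ℤₚ.+-assoc (rep b a n) (tot C) (tot C′)))

  weight-++ : ∀ C C′ → weight (C ++ C′) ≡ weight C ℕ.+ weight C′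
  weight-++ []            C′ = refl
  weight-++ ((a , n) ∷ C) C′ = trans (cong (∣ a ∣ ℕ.+_) (weight-++ C C′)) (sym (ℕₚ.+-assoc ∣ a ∣ (weight C) (weight C′)))

  below-bound : ∀ c Lo → All (Below c) Lo → ∣ tot Lo ∣ ℕ.≤ weight Lo ℕ.* b ℕ.^ c
  below-bound c []             []       = z≤n
  below-bound c ((a , n) ∷ Lo) (p ∷ ps) = ℕₚ.≤-trans (∣+∣≤ {rep b a n} {tot Lo} (ℕₚ.≤-trans (∣rep∣≤ b 2≤b a n) (ℕₚ.*-monoʳ-≤ ∣ a ∣ (^-mono 2≤b p))) (below-bound c Lo ps))
    (ℕₚ.≤-reflexive (sym (ℕₚ.*-distribʳ-+ (b ℕ.^ c) ∣ a ∣ (weight Lo))))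

  -- On the `K` positions from `c` on all the runs are present, so they form one run of the sum `s`
  -- of the coefficients; `Y` and `x` collect the parts below and above. Raising all runs together
  -- by `u` only lengthens this common stretch.
  above-split : ∀ c K Hi → All (Above (c ℕ.+ K)) Hi → ∃ λ Y → ∃ λ s → ∃ λ x →
    ∣ Y ∣ ℕ.≤ weight Hi ℕ.* b ℕ.^ c × ∣ s ∣ ℕ.≤ weight Hi × (∀ u → tot (raise u Hi) ≡ Y + pw b c * (rep b s (K ℕ.+ u) + pw b (K ℕ.+ u) * x))
  above-split c K [] [] = + 0 , + 0 , + 0 , z≤n , z≤n , λ u → sym (trans (cong (λ r → + 0 + pw b c * (r + pw b (K ℕ.+ u) * + 0)) (rep-zero b (K ℕ.+ u))) (lem (pw b c) (pw b (K ℕ.+ u))))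
    where
    lem : ∀ p q → + 0 + p * (+ 0 + q * + 0) ≡ + 0
    lem = solve-∀
  above-split c K ((a , n) ∷ Hi) (p ∷ ps) with above-split c K Hi ps | ℕₚ.m≤n⇒∃[o]m+o≡n p
  ... | Y , s , x , Y≤ , s≤ , eq | r , refl =
      rep b a c + Y , a + s , rep b a r + x ,
      ℕₚ.≤-trans (∣+∣≤ {rep b a c} {Y} (∣rep∣≤ b 2≤b a c) Y≤) (ℕₚ.≤-reflexive (sym (ℕₚ.*-distribʳ-+ (b ℕ.^ c) ∣ a ∣ (weight Hi)))) ,
      ∣+∣≤ {a} {s} ℕₚ.≤-refl s≤ , step
    where
    open ≡-Reasoning
    nat : ∀ c K r u → c ℕ.+ K ℕ.+ r ℕ.+ u ≡ c ℕ.+ (K ℕ.+ u ℕ.+ r)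
    nat = solveℕ
    lem : ∀ R p q t y Y S x → R + p * (q + t * y) + (Y + p * (S + t * x)) ≡ R + Y + p * (q + S + t * (y + x))
    lem = solve-∀
    step : ∀ u → rep b a (c ℕ.+ K ℕ.+ r ℕ.+ u) + tot (raise u Hi) ≡ rep b a c + Y + pw b c * (rep b (a + s) (K ℕ.+ u) + pw b (K ℕ.+ u) * (rep b a r + x))
    step u = begin
      rep b a (c ℕ.+ K ℕ.+ r ℕ.+ u) + tot (raise u Hi)                  ≡⟨ cong₂ (λ m w → rep b a m + w) (nat c K r u) (eq u) ⟩
      rep b a (c ℕ.+ (k ℕ.+ r)) + (Y + pw b c * (rep b s k + pw b k * x)) ≡⟨ cong (_+ (Y + pw b c * (rep b s k + pw b k * x))) (rep-+ b a c (k ℕ.+ r)) ⟩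
      rep b a c + pw b c * rep b a (k ℕ.+ r) + (Y + pw b c * (rep b s k + pw b k * x)) ≡⟨ cong (λ w → rep b a c + pw b c * w + (Y + pw b c * (rep b s k + pw b k * x))) (rep-+ b a k r) ⟩
      rep b a c + pw b c * (rep b a k + pw b k * rep b a r) + (Y + pw b c * (rep b s k + pw b k * x)) ≡⟨ lem (rep b a c) (pw b c) (rep b a k) (pw b k) (rep b a r) Y (rep b s k) x ⟩
      rep b a c + Y + pw b c * (rep b a k + rep b s k + pw b k * (rep b a r + x)) ≡⟨ cong (λ w → rep b a c + Y + pw b c * (w + pw b k * (rep b a r + x))) (rep-add b a s k) ⟨
      rep b a c + Y + pw b c * (rep b (a + s) k + pw b k * (rep b a r + x)) ∎
      where k = K ℕ.+ u

  PumpAt : ℕ → ℕ → ℕ → Set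
  PumpAt B K M = ∀ Y c s x → ∣ Y ∣ ℕ.≤ B ℕ.* b ℕ.^ c → ∣ s ∣ ℕ.≤ B →
    f (Y + pw b c * (rep b s K + pw b K * x)) ≡ f (Y + pw b c * (rep b s (K ℕ.+ M) + pw b (K ℕ.+ M) * x))

  gap-pump : ∀ {B K M} → PumpAt B K M → ∀ y Lo Hi c u t → u ≡ t ℕ.* M → ∣ y ∣ ℕ.+ (weight Lo ℕ.+ weight Hi) ℕ.≤ B →
    All (Below c) Lo → All (Above (c ℕ.+ K)) Hi → f (y + (tot Lo + tot Hi)) ≡ f (y + (tot Lo + tot (raise u Hi)))
  gap-pump {B} {K} {M} pump y Lo Hi c u t refl w≤ lo hi with above-split c K Hi hi
  ... | Y , s , x , Y≤ , s≤ , eq = begin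
    f (y + (tot Lo + tot Hi))                    ≡⟨ cong (λ C → f (y + (tot Lo + tot C))) (raise-0 Hi) ⟨
    f (y + (tot Lo + tot (raise 0 Hi)))          ≡⟨ form 0 ⟩
    at (K ℕ.+ 0)                                 ≡⟨ pump-iterate f (λ w → Z + pw b c * w) b s K M (λ x → pump Z c s x Z≤ s≤B) 0 t x ⟩
    at (K ℕ.+ 0 ℕ.+ t ℕ.* M)                     ≡⟨ cong (λ k → at (k ℕ.+ t ℕ.* M)) (ℕₚ.+-identityʳ K) ⟩
    at (K ℕ.+ t ℕ.* M)                           ≡⟨ form (t ℕ.* M) ⟨
    f (y + (tot Lo + tot (raise (t ℕ.* M) Hi)))  ∎
    where
    open ≡-Reasoning
    Z = y + (tot Lo + Y)
    at : ℕ → Bool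
    at k = f (Z + pw b c * (rep b s k + pw b k * x))
    lem : ∀ y l Y w → y + (l + (Y + w)) ≡ y + (l + Y) + w
    lem = solve-∀
    form : ∀ u → f (y + (tot Lo + tot (raise u Hi))) ≡ at (K ℕ.+ u)
    form u = cong f (trans (cong (λ w → y + (tot Lo + w)) (eq u)) (lem y (tot Lo) Y _))
    s≤B : ∣ s ∣ ℕ.≤ B
    s≤B = ℕₚ.≤-trans s≤ (ℕₚ.≤-trans (ℕₚ.m≤n+m (weight Hi) (weight Lo)) (ℕₚ.≤-trans (ℕₚ.m≤n+m _ ∣ y ∣) w≤))
    P = b ℕ.^ c
    1≤P : 1 ℕ.≤ P
    1≤P = ^-mono 2≤b (z≤n {c})
    Z≤ : ∣ Z ∣ ℕ.≤ B ℕ.* P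
    Z≤ = ℕₚ.≤-trans (∣+∣≤ {y} {tot Lo + Y} (ℕₚ.≤-trans (ℕₚ.≤-reflexive (sym (ℕₚ.*-identityʳ ∣ y ∣))) (ℕₚ.*-monoʳ-≤ ∣ y ∣ 1≤P)) (∣+∣≤ {tot Lo} {Y} (below-bound c Lo lo) Y≤))
      (ℕₚ.≤-trans (ℕₚ.≤-reflexive (dist ∣ y ∣ (weight Lo) (weight Hi) P)) (ℕₚ.*-monoˡ-≤ P w≤))
      where
      dist : ∀ y l h P → y ℕ.* P ℕ.+ (l ℕ.* P ℕ.+ h ℕ.* P) ≡ (y ℕ.+ (l ℕ.+ h)) ℕ.* P
      dist = solveℕ

  raise-above : ∀ c u Hi → All (Above c) Hi → All (Above (c ℕ.+ u)) (raise u Hi)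
  raise-above c u []       []       = []
  raise-above c u (_ ∷ Hi) (p ∷ ps) = ℕₚ.+-monoˡ-≤ u p ∷ raise-above c u Hi ps

  raise-below : ∀ c u Hi → All (Below c) Hi → All (Below (c ℕ.+ u)) (raise u Hi)
  raise-below c u []       []       = []
  raise-below c u (_ ∷ Hi) (p ∷ ps) = ℕₚ.+-monoˡ-≤ u p ∷ raise-below c u Hi ps

  -- A run of length n can be prolonged past all longer runs: both orders are compared by shifting the longer runs together.
  move-run : ∀ {B K M} → PumpAt B K M → ∀ y a n Lo Hi s t → s ≡ t ℕ.* M → ∣ y ∣ ℕ.+ (∣ a ∣ ℕ.+ (weight Lo ℕ.+ weight Hi)) ℕ.≤ B →
    K ℕ.≤ n → K ℕ.≤ s → All (λ r → proj₂ r ℕ.+ K ℕ.≤ n) Lo → All (Above (n ℕ.+ K)) Hi → All (λ r → proj₂ r ℕ.+ K ℕ.≤ s) Hi →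
    f (y + (rep b a n + (tot Lo + tot Hi))) ≡ f (y + (rep b a (n ℕ.+ s) + (tot Lo + tot Hi)))
  move-run {B} {K} {M} pump y a n Lo Hi s t s≡ w≤ K≤n K≤s lo hi hi-s with ℕₚ.m≤n⇒∃[o]m+o≡n K≤n
  ... | c , refl = double-swap {f = f} nl A′ B′ _ _ up down
    where
    open ≡-Reasoning
    A′ B′ : ℕ → ℤ
    A′ i = y + (tot Lo + rep b a (n ℕ.+ i ℕ.* s))
    B′ j = tot (raise (j ℕ.* s) Hi)
    mult : ∀ i → i ℕ.* s ≡ (i ℕ.* t) ℕ.* M
    mult i = trans (cong (i ℕ.*_) s≡) (sym (ℕₚ.*-assoc i t M))
    lo-c : All (Below c) Lo
    lo-c = All.map (λ {r} p → ℕₚ.+-cancelʳ-≤ K (proj₂ r) c (ℕₚ.≤-trans p (ℕₚ.≤-reflexive (ℕₚ.+-comm K c)))) lo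
    w₁ : ∣ y ∣ ℕ.+ (weight Lo ℕ.+ (∣ a ∣ ℕ.+ weight Hi)) ℕ.≤ B
    w₁ = ℕₚ.≤-trans (ℕₚ.≤-reflexive (lemℕ ∣ y ∣ ∣ a ∣ (weight Lo) (weight Hi))) w≤
      where
      lemℕ : ∀ y a l h → y ℕ.+ (l ℕ.+ (a ℕ.+ h)) ≡ y ℕ.+ (a ℕ.+ (l ℕ.+ h))
      lemℕ = solveℕ
    w₂ : ∀ u → ∣ y ∣ ℕ.+ (∣ a ∣ ℕ.+ weight Lo ℕ.+ weight (raise u Hi)) ℕ.≤ B
    w₂ u = ℕₚ.≤-trans (ℕₚ.≤-reflexive (trans (cong (λ h → ∣ y ∣ ℕ.+ (∣ a ∣ ℕ.+ weight Lo ℕ.+ h)) (weight-raise u Hi)) (cong (∣ y ∣ ℕ.+_) (ℕₚ.+-assoc ∣ a ∣ (weight Lo) (weight Hi))))) w≤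
    lem₁ : ∀ y r l h → y + (r + (l + h)) ≡ y + (l + (r + h))
    lem₁ = solve-∀
    lem₂ : ∀ y r l h → y + (l + (r + h)) ≡ y + (r + l + h)
    lem₂ = solve-∀
    lem₃ : ∀ y r l h → y + (r + l + h) ≡ y + (l + r) + h
    lem₃ = solve-∀
    K+c : K ℕ.+ c ≡ c ℕ.+ K
    K+c = ℕₚ.+-comm K c
    n-above : All (Above (c ℕ.+ K)) ((a , n) ∷ Hi)
    n-above = ℕₚ.≤-reflexive (sym K+c) ∷ All.map (λ p → ℕₚ.≤-trans (ℕₚ.≤-trans (ℕₚ.≤-reflexive (sym K+c)) (ℕₚ.m≤m+n n K)) p) hi
    -- Here `Hi` stays longer than the moved run: both are raised by `i * s`, then `Hi` alone.
    up : ∀ i r → f (A′ i + B′ (suc (i ℕ.+ r))) ≡ f (y + (rep b a n + (tot Lo + tot Hi)))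
    up i r = sym (begin
      f (y + (rep b a n + (tot Lo + tot Hi)))                    ≡⟨ cong f (lem₁ y (rep b a n) (tot Lo) (tot Hi)) ⟩
      f (y + (tot Lo + tot ((a , n) ∷ Hi)))                      ≡⟨ gap-pump pump y Lo ((a , n) ∷ Hi) c is (i ℕ.* t) (mult i) w₁ lo-c n-above ⟩
      f (y + (tot Lo + (rep b a (n ℕ.+ is) + tot (raise is Hi)))) ≡⟨ cong f (lem₂ y (rep b a (n ℕ.+ is)) (tot Lo) (tot (raise is Hi))) ⟩
      f (y + (tot ((a , n ℕ.+ is) ∷ Lo) + tot (raise is Hi)))    ≡⟨ gap-pump pump y ((a , n ℕ.+ is) ∷ Lo) (raise is Hi) (n ℕ.+ is) (suc r ℕ.* s) (suc r ℕ.* t) (mult (suc r)) (w₂ is) lo′ hi′ ⟩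
      f (y + (tot ((a , n ℕ.+ is) ∷ Lo) + tot (raise (suc r ℕ.* s) (raise is Hi)))) ≡⟨ cong (λ C → f (y + (tot ((a , n ℕ.+ is) ∷ Lo) + tot C))) (trans (raise-raise is (suc r ℕ.* s) Hi) (cong (λ k → raise k Hi) (natlem i r s))) ⟩
      f (y + (rep b a (n ℕ.+ is) + tot Lo + B′ (suc (i ℕ.+ r)))) ≡⟨ cong f (lem₃ y (rep b a (n ℕ.+ is)) (tot Lo) (B′ (suc (i ℕ.+ r)))) ⟩
      f (A′ i + B′ (suc (i ℕ.+ r)))                              ∎)
      where
      is = i ℕ.* s
      natlem : ∀ i r s → i ℕ.* s ℕ.+ suc r ℕ.* s ≡ suc (i ℕ.+ r) ℕ.* s
      natlem = solveℕ
      lo′ : All (Below (n ℕ.+ is)) ((a , n ℕ.+ is) ∷ Lo)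
      lo′ = ℕₚ.≤-refl ∷ All.map (λ p → ℕₚ.≤-trans p (ℕₚ.≤-trans (ℕₚ.m≤n+m c K) (ℕₚ.m≤m+n n is))) lo-c
      hi′ : All (Above (n ℕ.+ is ℕ.+ K)) (raise is Hi)
      hi′ = subst (λ m → All (Above m) (raise is Hi)) (swap n K is) (raise-above (n ℕ.+ K) is Hi hi)
        where
        swap : ∀ n K i → n ℕ.+ K ℕ.+ i ≡ n ℕ.+ i ℕ.+ K
        swap = solveℕ
    -- Here the run has passed `Hi`: both are raised by `j * s`, then the run alone.
    down : ∀ j r → f (A′ (suc (j ℕ.+ r)) + B′ j) ≡ f (y + (rep b a (n ℕ.+ s) + (tot Lo + tot Hi)))
    down j r = sym (begin
      f (y + (rep b a (n ℕ.+ s) + (tot Lo + tot Hi)))            ≡⟨ cong f (lem₁ y (rep b a (n ℕ.+ s)) (tot Lo) (tot Hi)) ⟩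
      f (y + (tot Lo + tot ((a , n ℕ.+ s) ∷ Hi)))                ≡⟨ gap-pump pump y Lo ((a , n ℕ.+ s) ∷ Hi) n js (j ℕ.* t) (mult j) w₁ lo-n (ℕₚ.+-monoʳ-≤ n K≤s ∷ hi) ⟩
      f (y + (tot Lo + (rep b a m + tot (raise js Hi))))         ≡⟨ cong f (lem₄ y (tot Lo) (rep b a m) (tot (raise js Hi))) ⟩
      f (y + (tot (raise js Hi) + tot Lo + (rep b a m + + 0)))   ≡⟨ cong (λ w → f (y + (w + (rep b a m + + 0)))) (sym (tot-++ (raise js Hi) Lo)) ⟩
      f (y + (tot (raise js Hi ++ Lo) + tot ((a , m) ∷ [])))     ≡⟨ gap-pump pump y (raise js Hi ++ Lo) ((a , m) ∷ []) c₂ (r ℕ.* s) (r ℕ.* t) (mult r) w₃ (Allₚ.++⁺ hi″ lo″) (m-above ∷ []) ⟩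
      f (y + (tot (raise js Hi ++ Lo) + (rep b a (m ℕ.+ r ℕ.* s) + + 0))) ≡⟨ cong₂ (λ w k → f (y + (w + (rep b a k + + 0)))) (tot-++ (raise js Hi) Lo) (natlem n s j r) ⟩
      f (y + (tot (raise js Hi) + tot Lo + (rep b a (n ℕ.+ suc (j ℕ.+ r) ℕ.* s) + + 0))) ≡⟨ cong f (lem₅ y (tot (raise js Hi)) (tot Lo) (rep b a (n ℕ.+ suc (j ℕ.+ r) ℕ.* s))) ⟩
      f (A′ (suc (j ℕ.+ r)) + B′ j)                              ∎)
      where
      js = j ℕ.* s
      m = n ℕ.+ s ℕ.+ js
      c₂ = c ℕ.+ s ℕ.+ js
      natlem : ∀ n s j r → n ℕ.+ s ℕ.+ j ℕ.* s ℕ.+ r ℕ.* s ≡ n ℕ.+ suc (j ℕ.+ r) ℕ.* s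
      natlem = solveℕ
      lem₄ : ∀ y l r h → y + (l + (r + h)) ≡ y + (h + l + (r + + 0))
      lem₄ = solve-∀
      lem₅ : ∀ y h l r → y + (h + l + (r + + 0)) ≡ y + (l + r) + h
      lem₅ = solve-∀
      lo-n : All (Below n) Lo
      lo-n = All.map (λ p → ℕₚ.≤-trans p (ℕₚ.m≤n+m c K)) lo-c
      w₃ : ∣ y ∣ ℕ.+ (weight (raise js Hi ++ Lo) ℕ.+ (∣ a ∣ ℕ.+ 0)) ℕ.≤ B
      w₃ = ℕₚ.≤-trans (ℕₚ.≤-reflexive (trans (cong (λ w → ∣ y ∣ ℕ.+ (w ℕ.+ (∣ a ∣ ℕ.+ 0))) (trans (weight-++ (raise js Hi) Lo) (cong (ℕ._+ weight Lo) (weight-raise js Hi)))) (lemℕ ∣ y ∣ ∣ a ∣ (weight Lo) (weight Hi)))) w≤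
        where
        lemℕ : ∀ y a l h → y ℕ.+ (h ℕ.+ l ℕ.+ (a ℕ.+ 0)) ≡ y ℕ.+ (a ℕ.+ (l ℕ.+ h))
        lemℕ = solveℕ
      hi″ : All (Below c₂) (raise js Hi)
      hi″ = raise-below (c ℕ.+ s) js Hi (All.map (λ {r} p → ℕₚ.≤-trans (ℕₚ.≤-trans (ℕₚ.m≤m+n (proj₂ r) K) p) (ℕₚ.m≤n+m s c)) hi-s)
      lo″ : All (Below c₂) Lo
      lo″ = All.map (λ p → ℕₚ.≤-trans p (ℕₚ.≤-trans (ℕₚ.m≤m+n c s) (ℕₚ.m≤m+n (c ℕ.+ s) js))) lo-c
      m-above : c₂ ℕ.+ K ℕ.≤ m
      m-above = ℕₚ.≤-reflexive (lemℕ c s js K)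
        where
        lemℕ : ∀ c s j K → c ℕ.+ s ℕ.+ j ℕ.+ K ≡ K ℕ.+ c ℕ.+ s ℕ.+ j
        lemℕ = solveℕ

  partition-far : ∀ K n (Q : ℤ × ℕ → Set) O → All (Far K n) O → All Q O → ∃ λ Lo → ∃ λ Hi →
    tot O ≡ tot Lo + tot Hi × weight O ≡ weight Lo ℕ.+ weight Hi × All (λ r → proj₂ r ℕ.+ K ℕ.≤ n) Lo × All (Above (n ℕ.+ K)) Hi × All Q Hi
  partition-far K n Q [] [] [] = [] , [] , refl , refl , [] , [] , []
  partition-far K n Q ((a , m) ∷ O) (p ∷ ps) (q ∷ qs) with partition-far K n Q O ps qs | p
  ... | Lo , Hi , tot≡ , weight≡ , lo , hi , qhi | inj₁ low  = (a , m) ∷ Lo , Hi ,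
          trans (cong (λ w → rep b a m + w) tot≡) (sym (ℤₚ.+-assoc (rep b a m) (tot Lo) (tot Hi))) ,
          trans (cong (∣ a ∣ ℕ.+_) weight≡) (sym (ℕₚ.+-assoc ∣ a ∣ (weight Lo) (weight Hi))) , low ∷ lo , hi , qhi
  ... | Lo , Hi , tot≡ , weight≡ , lo , hi , qhi | inj₂ high = Lo , (a , m) ∷ Hi ,
          trans (cong (λ w → rep b a m + w) tot≡) (lem (rep b a m) (tot Lo) (tot Hi)) ,
          trans (cong (∣ a ∣ ℕ.+_) weight≡) (lemℕ ∣ a ∣ (weight Lo) (weight Hi)) , lo , high ∷ hi , q ∷ qhi
    where
    lem : ∀ r l h → r + (l + h) ≡ l + (r + h)
    lem = solve-∀
    lemℕ : ∀ r l h → r ℕ.+ (l ℕ.+ h) ≡ l ℕ.+ (r ℕ.+ h)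
    lemℕ = solveℕ

  move-run-far : ∀ {B K M} → PumpAt B K M → ∀ y a n O s t → s ≡ t ℕ.* M → ∣ y ∣ ℕ.+ (∣ a ∣ ℕ.+ weight O) ℕ.≤ B →
    K ℕ.≤ n → K ℕ.≤ s → All (Far K n) O → All (λ r → proj₂ r ℕ.+ K ℕ.≤ s) O →
    f (y + (rep b a n + tot O)) ≡ f (y + (rep b a (n ℕ.+ s) + tot O))
  move-run-far {B} {K} {M} pump y a n O s t s≡ w≤ K≤n K≤s far small with partition-far K n (λ r → proj₂ r ℕ.+ K ℕ.≤ s) O far small
  ... | Lo , Hi , tot≡ , weight≡ , lo , hi , hi-s = subst (λ w → f (y + (rep b a n + w)) ≡ f (y + (rep b a (n ℕ.+ s) + w))) (sym tot≡)
        (move-run pump y a n Lo Hi s t s≡ (subst (λ w → ∣ y ∣ ℕ.+ (∣ a ∣ ℕ.+ w) ℕ.≤ B) weight≡ w≤) K≤n K≤s lo hi hi-s)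

  Pairs : Set
  Pairs = List (ℤ × ℕ × ℕ × ℕ)

  left right : ℕ → Pairs → Runs
  left  M = map (λ { (a , ρ , t , t′) → a , ρ ℕ.+ t ℕ.* M })
  right M = map (λ { (a , ρ , t , t′) → a , ρ ℕ.+ t′ ℕ.* M })

  weight-left : ∀ M rem → weight (left M rem) ≡ weight (right M rem)
  weight-left M []                        = refl
  weight-left M ((a , ρ , t , t′) ∷ rem) = cong (∣ a ∣ ℕ.+_) (weight-left M rem)

  -- In both configurations the first run is moved to one common length `T`, which is far above all
  -- the others, and joins the list `C` of runs that already agree. `T` is symmetric in `t` and
  -- `t′`, so it differs from either length by a multiple of `M`.
  separated-constant : ∀ {B K M} → PumpAt B K M → 1 ℕ.≤ M → ∀ y rem C → ∣ y ∣ ℕ.+ (weight C ℕ.+ weight (left M rem)) ℕ.≤ B →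
    Separated K (left M rem) → Separated K (right M rem) →
    All (λ r → All (Far K (proj₂ r)) C) (left M rem) → All (λ r → All (Far K (proj₂ r)) C) (right M rem) →
    f (y + (tot C + tot (left M rem))) ≡ f (y + (tot C + tot (right M rem)))
  separated-constant pump 1≤M y [] C w≤ _ _ _ _ = refl
  separated-constant {B} {K} {M} pump 1≤M y ((a , ρ , t , t′) ∷ rem) C w≤ (K≤n , far , sep) (K≤n′ , far′ , sep′) (farC ∷ farsC) (farC′ ∷ farsC′) = begin
    f (y + (tot C + (rep b a n + tot L)))            ≡⟨ to-target n (t′ ℕ.+ X) L (eqL ρ t t′ X M) L-bound K≤n (Allₚ.++⁺ farC far) wL (X≤ t′) ⟩
    f (y + (tot ((a , T) ∷ C) + tot L))              ≡⟨ separated-constant pump 1≤M y rem ((a , T) ∷ C) wT sep sep′ (farT L farsC L-bound) (farT R farsC′ R-bound) ⟩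
    f (y + (tot ((a , T) ∷ C) + tot R))              ≡⟨ to-target n′ (t ℕ.+ X) R (eqR ρ t t′ X M) R-bound K≤n′ (Allₚ.++⁺ farC′ far′) wR (X≤ t) ⟨
    f (y + (tot C + (rep b a n′ + tot R)))           ∎
    where
    open ≡-Reasoning
    L = left M rem
    R = right M rem
    n  = ρ ℕ.+ t ℕ.* M
    n′ = ρ ℕ.+ t′ ℕ.* M
    X = K ℕ.+ (lengths C ℕ.+ (lengths L ℕ.+ lengths R))
    T = ρ ℕ.+ (t ℕ.+ t′ ℕ.+ X) ℕ.* M
    eqL : ∀ ρ t t′ X M → ρ ℕ.+ t ℕ.* M ℕ.+ (t′ ℕ.+ X) ℕ.* M ≡ ρ ℕ.+ (t ℕ.+ t′ ℕ.+ X) ℕ.* M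
    eqL = solveℕ
    eqR : ∀ ρ t t′ X M → ρ ℕ.+ t′ ℕ.* M ℕ.+ (t ℕ.+ X) ℕ.* M ≡ ρ ℕ.+ (t ℕ.+ t′ ℕ.+ X) ℕ.* M
    eqR = solveℕ
    X≤ : ∀ u → X ℕ.≤ (u ℕ.+ X) ℕ.* M
    X≤ u = ℕₚ.≤-trans (ℕₚ.m≤n+m X u) (ℕₚ.≤-trans (ℕₚ.≤-reflexive (sym (ℕₚ.*-identityʳ (u ℕ.+ X)))) (ℕₚ.*-monoʳ-≤ (u ℕ.+ X) 1≤M))
    X≤T : X ℕ.≤ T
    X≤T = ℕₚ.≤-trans (X≤ (t ℕ.+ t′)) (ℕₚ.m≤n+m _ ρ)
    up-to-X : ∀ k → k ℕ.≤ lengths C ℕ.+ (lengths L ℕ.+ lengths R) → k ℕ.+ K ℕ.≤ X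
    up-to-X k p = ℕₚ.≤-trans (ℕₚ.≤-reflexive (ℕₚ.+-comm k K)) (ℕₚ.+-monoʳ-≤ K p)
    C-bound : All (λ r → proj₂ r ℕ.+ K ℕ.≤ X) C
    C-bound = All.map (λ {r} p → up-to-X (proj₂ r) (ℕₚ.≤-trans p (ℕₚ.m≤m+n _ _))) (lengths-bound C)
    L-bound : All (λ r → proj₂ r ℕ.+ K ℕ.≤ X) L
    L-bound = All.map (λ {r} p → up-to-X (proj₂ r) (ℕₚ.≤-trans p (ℕₚ.≤-trans (ℕₚ.m≤m+n _ _) (ℕₚ.m≤n+m _ (lengths C))))) (lengths-bound L)
    R-bound : All (λ r → proj₂ r ℕ.+ K ℕ.≤ X) R
    R-bound = All.map (λ {r} p → up-to-X (proj₂ r) (ℕₚ.≤-trans p (ℕₚ.≤-trans (ℕₚ.m≤n+m (lengths R) (lengths L)) (ℕₚ.m≤n+m _ (lengths C))))) (lengths-bound R)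
    lem₁ : ∀ y c r l → y + (c + (r + l)) ≡ y + (r + (c + l))
    lem₁ = solve-∀
    lem₂ : ∀ y c r l → y + (r + (c + l)) ≡ y + (r + c + l)
    lem₂ = solve-∀
    wL : ∣ y ∣ ℕ.+ (∣ a ∣ ℕ.+ (weight C ℕ.+ weight L)) ℕ.≤ B
    wL = ℕₚ.≤-trans (ℕₚ.≤-reflexive (lemℕ ∣ y ∣ ∣ a ∣ (weight C) (weight L))) w≤
      where
      lemℕ : ∀ y a c l → y ℕ.+ (a ℕ.+ (c ℕ.+ l)) ≡ y ℕ.+ (c ℕ.+ (a ℕ.+ l))
      lemℕ = solveℕ
    wR : ∣ y ∣ ℕ.+ (∣ a ∣ ℕ.+ (weight C ℕ.+ weight R)) ℕ.≤ B
    wR = subst (λ w → ∣ y ∣ ℕ.+ (∣ a ∣ ℕ.+ (weight C ℕ.+ w)) ℕ.≤ B) (weight-left M rem) wL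
    wT : ∣ y ∣ ℕ.+ (∣ a ∣ ℕ.+ weight C ℕ.+ weight L) ℕ.≤ B
    wT = ℕₚ.≤-trans (ℕₚ.≤-reflexive (cong (∣ y ∣ ℕ.+_) (ℕₚ.+-assoc ∣ a ∣ (weight C) (weight L)))) wL
    to-target : ∀ m u O → m ℕ.+ (u ℕ.* M) ≡ T → All (λ r → proj₂ r ℕ.+ K ℕ.≤ X) O → K ℕ.≤ m → All (Far K m) (C ++ O) →
      ∣ y ∣ ℕ.+ (∣ a ∣ ℕ.+ (weight C ℕ.+ weight O)) ℕ.≤ B → X ℕ.≤ u ℕ.* M →
      f (y + (tot C + (rep b a m + tot O))) ≡ f (y + (tot ((a , T) ∷ C) + tot O))
    to-target m u O eq O-bound K≤m farO w X≤u = begin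
      f (y + (tot C + (rep b a m + tot O)))            ≡⟨ cong f (lem₁ y (tot C) (rep b a m) (tot O)) ⟩
      f (y + (rep b a m + (tot C + tot O)))            ≡⟨ cong (λ v → f (y + (rep b a m + v))) (tot-++ C O) ⟨
      f (y + (rep b a m + tot (C ++ O)))               ≡⟨ move-run-far pump y a m (C ++ O) (u ℕ.* M) u refl (subst (λ v → ∣ y ∣ ℕ.+ (∣ a ∣ ℕ.+ v) ℕ.≤ B) (sym (weight-++ C O)) w) K≤m (ℕₚ.≤-trans (ℕₚ.m≤m+n K _) X≤u) farO (All.map (λ p → ℕₚ.≤-trans p X≤u) (Allₚ.++⁺ C-bound O-bound)) ⟩
      f (y + (rep b a (m ℕ.+ u ℕ.* M) + tot (C ++ O))) ≡⟨ cong₂ (λ k v → f (y + (rep b a k + v))) eq (tot-++ C O) ⟩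
      f (y + (rep b a T + (tot C + tot O)))            ≡⟨ cong f (lem₂ y (tot C) (rep b a T) (tot O)) ⟩
      f (y + (rep b a T + tot C + tot O))              ∎
    farT : ∀ O → All (λ r → All (Far K (proj₂ r)) C) O → All (λ r → proj₂ r ℕ.+ K ℕ.≤ X) O → All (λ r → All (Far K (proj₂ r)) ((a , T) ∷ C)) O
    farT []      []       []       = []
    farT (r ∷ O) (p ∷ ps) (q ∷ qs) = (inj₂ (ℕₚ.≤-trans q X≤T) ∷ p) ∷ farT O ps qs

-- Boolean combinations and sums of geometric progressions

module BooleanCombinations (d : ℕ) where

  IsBC : (ℤ → Set) → Set₁
  IsBC P = Σ (BoolComb d) λ φ → ∀ x → P x ⇔ ⟦ φ ⟧ x

  bc-⇔ : ∀ {P Q : ℤ → Set} → (∀ x → Q x → P x) → (∀ x → P x → Q x) → IsBC P → IsBC Q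
  bc-⇔ to from (φ , e) = φ , λ x → mk⇔ (λ q → Equivalence.to (e x) (to x q)) (λ p → from x (Equivalence.from (e x) p))

  bc-⊥ : IsBC (λ _ → ⊥)
  bc-⊥ = empty , λ x → mk⇔ (λ p → p) (λ p → p)

  bc-¬ : ∀ {P} → IsBC P → IsBC (λ x → ¬ P x)
  bc-¬ (φ , e) = compl φ , λ x → mk⇔ (λ ¬p q → ¬p (Equivalence.from (e x) q)) (λ ¬q p → ¬q (Equivalence.to (e x) p))

  bc-⊎ : ∀ {P Q} → IsBC P → IsBC Q → IsBC (λ x → P x ⊎ Q x)
  bc-⊎ (φ , e) (ψ , g) = union φ ψ , λ x → mk⇔ (Sum.map (Equivalence.to (e x)) (Equivalence.to (g x))) (Sum.map (Equivalence.from (e x)) (Equivalence.from (g x)))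

  bc-× : ∀ {P Q} → IsBC P → IsBC Q → IsBC (λ x → P x × Q x)
  bc-× (φ , e) (ψ , g) = inter φ ψ , λ x → mk⇔ (λ { (p , q) → Equivalence.to (e x) p , Equivalence.to (g x) q }) (λ { (p , q) → Equivalence.from (e x) p , Equivalence.from (g x) q })

  bc-guard : ∀ {P} (c : Bool) → IsBC P → IsBC (λ x → c ≡ true × P x)
  bc-guard true  bc = bc-⇔ (λ x → proj₂) (λ x p → refl , p) bc
  bc-guard false bc = bc-⇔ (λ x ()) (λ x ()) bc-⊥

  true≢false : ¬ true ≡ false
  true≢false ()

  bc-complement : ∀ {P} (g : ℤ → Bool) → IsBC P → IsBC (λ x → P x × g x ≡ true) → IsBC (λ x → P x × g x ≡ false)
  bc-complement {P} g bc bc-g = bc-⇔ (λ x (p , e) → p , λ { (_ , e′) → true≢false (trans (sym e′) e) }) (λ { x (p , ¬t) → p , is-false x (λ t → ¬t (p , t)) }) (bc-× bc (bc-¬ bc-g))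
    where
    is-false : ∀ x → ¬ g x ≡ true → g x ≡ false
    is-false x ¬t with g x
    ... | true  = ⊥-elim (¬t refl)
    ... | false = refl

  bc-Any : ∀ {X : Set} {P : X → ℤ → Set} L → All (λ a → IsBC (P a)) L → IsBC (λ x → Any (λ a → P a x) L)
  bc-Any []      []         = bc-⇔ (λ x ()) (λ x ()) bc-⊥
  bc-Any (a ∷ L) (bc ∷ bcs) = bc-⇔ (λ x → Any.toSum) (λ x → Any.fromSum) (bc-⊎ bc (bc-Any L bcs))

  bc-< : ∀ {P : ℕ → ℤ → Set} n → (∀ i → IsBC (P i)) → IsBC (λ x → ∃ λ i → i ℕ.< n × P i x)
  bc-< zero    bc = bc-⇔ (λ { x (i , () , _) }) (λ x ()) bc-⊥
  bc-< {P} (suc n) bc = bc-⇔ to from (bc-⊎ (bc n) (bc-< n bc))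
    where
    to : ∀ x → (∃ λ i → i ℕ.< suc n × P i x) → P n x ⊎ (∃ λ i → i ℕ.< n × P i x)
    to x (i , i<n , p) with ℕₚ.m≤n⇒m<n∨m≡n (ℕₚ.≤-pred i<n)
    ... | inj₁ i<  = inj₂ (i , i< , p)
    ... | inj₂ refl = inj₁ p
    from : ∀ x → P n x ⊎ (∃ λ i → i ℕ.< n × P i x) → ∃ λ i → i ℕ.< suc n × P i x
    from x (inj₁ p)           = n , ℕₚ.≤-refl , p
    from x (inj₂ (i , i< , p)) = i , ℕₚ.m≤n⇒m≤1+n i< , p

  bc-vectors : ∀ M k {P : Vec ℕ k → ℤ → Set} → (∀ ρs → IsBC (P ρs)) → IsBC (λ x → ∃ λ ρs → AllV (ℕ._< M) ρs × P ρs x)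
  bc-vectors M zero    bc = bc-⇔ (λ { x ([] , _ , p) → p }) (λ x p → [] , [] , p) (bc [])
  bc-vectors M (suc k) bc = bc-⇔ (λ { x (ρ ∷ ρs , q ∷ qs , p) → ρ , q , ρs , qs , p }) (λ { x (ρ , q , ρs , qs , p) → ρ ∷ ρs , q ∷ qs , p })
    (bc-< M (λ ρ → bc-vectors M k (λ ρs → bc (ρ ∷ ρs))))

  Periodic : ℤ → (ℤ → Bool) → Set
  Periodic n g = ∀ z → g (z + n) ≡ g z

  periodic-multiple : ∀ {g n} → Periodic n g → ∀ k z → g (z + k * n) ≡ g z
  periodic-multiple {g} {n} per (+ k) z = nat k z
    where
    lem₀ : ∀ z n → z + + 0 * n ≡ z
    lem₀ = solve-∀
    lem₁ : ∀ z k n → z + (+ 1 + k) * n ≡ z + k * n + n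
    lem₁ = solve-∀
    nat : ∀ k z → g (z + + k * n) ≡ g z
    nat zero    z = cong g (lem₀ z n)
    nat (suc k) z = trans (cong g (lem₁ z (+ k) n)) (trans (per (z + + k * n)) (nat k z))
  periodic-multiple {g} {n} per -[1+ k ] z = trans (sym (periodic-multiple {g} per (+ suc k) (z + -[1+ k ] * n))) (cong g (lem z (+ suc k) n))
    where
    lem : ∀ z k n → z + - k * n + k * n ≡ z
    lem = solve-∀

  multiples : ℤ → Subgroup
  multiples n = record
    { carrier = λ x → ∃ λ k → x ≡ k * n
    ; has-zero = + 0 , refl
    ; +-closed = λ { {x} {y} (k , p) (l , q) → k + l , trans (cong₂ _+_ p q) (sym (ℤₚ.*-distribʳ-+ n k l)) }
    ; neg-closed = λ { {x} (k , p) → - k , trans (cong -_ p) (ℤₚ.neg-distribˡ-* k n) }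
    }

  bc-periodic : ∀ {g n} → ¬ n ≡ + 0 → Periodic n g → IsBC (λ x → g x ≡ true)
  bc-periodic {g} {n} n≢0 per = bc-⇔ to from (bc-< ∣ n ∣ (λ r → bc-guard (g (+ r)) (coset (+ r) (multiples n) , λ x → mk⇔ (λ p → p) (λ p → p))))
    where
    instance
      nz : NonZero ∣ n ∣
      nz = abs-nonZero n≢0
    lem₁ : ∀ x r → x ≡ r + (x - r)
    lem₁ = solve-∀
    lem₂ : ∀ r q → r + q - r ≡ q
    lem₂ = solve-∀
    value : ∀ x r k → x - r ≡ k * n → g x ≡ g r
    value x r k e = trans (cong g (trans (lem₁ x r) (cong (λ w → r + w) e))) (periodic-multiple {g} per k r)
    to : ∀ x → g x ≡ true → ∃ λ r → r ℕ.< ∣ n ∣ × (g (+ r) ≡ true × ∃ λ k → x - + r ≡ k * n)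
    to x e = r , n%ℕd<d x ∣ n ∣ , trans (sym (value x (+ r) (proj₁ k) x-r)) e , proj₁ k , x-r
      where
      r = x %ℕ ∣ n ∣
      q = x /ℕ ∣ n ∣
      k = ∣h∣-multiple q n
      x-r : x - + r ≡ proj₁ k * n
      x-r = trans (cong (_- + r) (a≡a%ℕn+[a/ℕn]*n x ∣ n ∣)) (trans (lem₂ (+ r) (q * + ∣ n ∣)) (proj₂ k))
    from : ∀ x → (∃ λ r → r ℕ.< ∣ n ∣ × (g (+ r) ≡ true × ∃ λ k → x - + r ≡ k * n)) → g x ≡ true
    from x (r , _ , e , k , x-r) = trans (value x (+ r) k x-r) e

  -- The length is `suc n` because every element of `C(a;δ)` has at least the term `a`.
  runs : ∀ {k} → Vec ℤ k → Vec ℕ k → Runs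
  runs []       []       = []
  runs (a ∷ as) (n ∷ ns) = (a , suc n) ∷ runs as ns

  SumSet : ℕ → ℤ → ∀ {k} → Vec ℤ k → ℤ → Set
  SumSet B y as x = ∃ λ ns → x ≡ y + total B (runs as ns)

  pos-^ : ∀ d k → (+ d) ℤ.^ k ≡ pw d k
  pos-^ d zero    = refl
  pos-^ d (suc k) = trans (cong (λ w → + d * w) (pos-^ d k)) (sym (pw-suc d k))

  geomSum-rep : ∀ a e n → geomSum d a e n ≡ rep (d ℕ.^ e) a (suc n)
  geomSum-rep a e zero    = lem a (+ (d ℕ.^ e))
    where
    lem : ∀ a b → a ≡ a + b * + 0
    lem = solve-∀
  geomSum-rep a e (suc n) = begin
    geomSum d a e n + (+ d) ℤ.^ (suc n ℕ.* e) * a                ≡⟨ cong₂ (λ g p → g + p * a) (geomSum-rep a e n) (trans (pos-^ d (suc n ℕ.* e)) (trans (cong (pw d) (ℕₚ.*-comm (suc n) e)) (sym (pw-* d e (suc n))))) ⟩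
    rep B a (suc n) + pw B (suc n) * a                           ≡⟨ cong (λ w → rep B a (suc n) + pw B (suc n) * w) (lem a (+ B)) ⟩
    rep B a (suc n) + pw B (suc n) * rep B a 1                   ≡⟨ rep-+ B a (suc n) 1 ⟨
    rep B a (suc n ℕ.+ 1)                                        ≡⟨ cong (rep B a) (ℕₚ.+-comm (suc n) 1) ⟩
    rep B a (suc (suc n))                                        ∎
    where
    open ≡-Reasoning
    B = d ℕ.^ e
    lem : ∀ a b → a ≡ a + b * + 0
    lem = solve-∀

  params : ∀ e → 1 ℕ.≤ e → ∀ {k} → Vec ℤ k → List CParam
  params e 1≤e []       = []
  params e 1≤e (a ∷ as) = cparam a e 1≤e ∷ params e 1≤e as

  SumSet⇒tsum : ∀ e (1≤e : 1 ℕ.≤ e) y {k} (as : Vec ℤ k) x → SumSet (d ℕ.^ e) y as x → InTranslateSum d y (params e 1≤e as) x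
  SumSet⇒tsum e 1≤e y []       x ([] , eq)     = trans eq (ℤₚ.+-identityʳ y)
  SumSet⇒tsum e 1≤e y (a ∷ as) x (n ∷ ns , eq) = rep (d ℕ.^ e) a (suc n) , (n , sym (geomSum-rep a e n)) ,
    SumSet⇒tsum e 1≤e y as _ (ns , trans (cong (_- rep (d ℕ.^ e) a (suc n)) eq) (lem y (rep (d ℕ.^ e) a (suc n)) (total (d ℕ.^ e) (runs as ns))))
    where
    lem : ∀ y r t → y + (r + t) - r ≡ y + t
    lem = solve-∀

  tsum⇒SumSet : ∀ e (1≤e : 1 ℕ.≤ e) y {k} (as : Vec ℤ k) x → InTranslateSum d y (params e 1≤e as) x → SumSet (d ℕ.^ e) y as x
  tsum⇒SumSet e 1≤e y []       x eq = [] , trans eq (sym (ℤₚ.+-identityʳ y))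
  tsum⇒SumSet e 1≤e y (a ∷ as) x (_ , (n , refl) , rest) with tsum⇒SumSet e 1≤e y as _ rest
  ... | ns , eq = n ∷ ns , trans (lem₁ x (geomSum d a e n)) (trans (cong₂ _+_ (geomSum-rep a e n) eq) (lem₂ (rep (d ℕ.^ e) a (suc n)) y (total (d ℕ.^ e) (runs as ns))))
    where
    lem₁ : ∀ x g → x ≡ g + (x - g)
    lem₁ = solve-∀
    lem₂ : ∀ r y t → r + (y + t) ≡ y + (r + t)
    lem₂ = solve-∀

  bc-SumSet : ∀ e → 1 ℕ.≤ e → ∀ y {k} (as : Vec ℤ k) → IsBC (SumSet (d ℕ.^ e) y as)
  bc-SumSet e 1≤e y as = tsum y (params e 1≤e as) , λ x → mk⇔ (SumSet⇒tsum e 1≤e y as x) (tsum⇒SumSet e 1≤e y as x)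

  Family : ℕ → Set
  Family k = ℤ × Vec ℤ k

  InFamily : ℕ → ∀ {k} → ℤ → Family k → Set
  InFamily B x (y , as) = SumSet B y as x

  SumSet-cons : ∀ B {k j} (as : Vec ℤ k) (as′ : Vec ℤ j) y y′ →
    (∀ x → SumSet B y as x → SumSet B y′ as′ x) → ∀ a x → SumSet B y (a ∷ as) x → SumSet B y′ (a ∷ as′) x
  SumSet-cons B as as′ y y′ sub a x (n ∷ ns , eq) with sub (y + total B (runs as ns)) (ns , refl)
  ... | ns′ , eq′ = n ∷ ns′ , trans eq (trans (lem y (rep B a (suc n)) (total B (runs as ns))) (trans (cong (λ w → rep B a (suc n) + w) eq′) (sym (lem y′ (rep B a (suc n)) (total B (runs as′ ns′))))))
    where
    lem : ∀ y r t → y + (r + t) ≡ r + (y + t)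
    lem = solve-∀

  SumSet-swap : ∀ B {k} (as : Vec ℤ k) y a a′ x → SumSet B y (a ∷ a′ ∷ as) x → SumSet B y (a′ ∷ a ∷ as) x
  SumSet-swap B as y a a′ x (n ∷ n′ ∷ ns , eq) = n′ ∷ n ∷ ns , trans eq (lem y (rep B a (suc n)) (rep B a′ (suc n′)) (total B (runs as ns)))
    where
    lem : ∀ y r q t → y + (r + (q + t)) ≡ y + (q + (r + t))
    lem = solve-∀

  -- The longer run consists of its first `t` terms, which become part of the translate, and a
  -- shifted run as long as the shorter one; runs of equal length add up to a single run.
  merge-two : ∀ B a a′ t n y r → y + rep B a′ t + (rep B (a + pw B t * a′) (suc n) + r) ≡ y + (rep B a (suc n) + (rep B a′ (suc (t ℕ.+ n)) + r))
  merge-two B a a′ t n y r = begin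
    y + rep B a′ t + (rep B (a + pw B t * a′) (suc n) + r)                          ≡⟨ cong (λ w → y + rep B a′ t + (w + r)) (trans (rep-add B a (pw B t * a′) (suc n)) (cong (λ w → rep B a (suc n) + w) (rep-scale B (pw B t) a′ (suc n)))) ⟩
    y + rep B a′ t + (rep B a (suc n) + pw B t * rep B a′ (suc n) + r)              ≡⟨ lem y (rep B a′ t) (rep B a (suc n)) (pw B t * rep B a′ (suc n)) r ⟩
    y + (rep B a (suc n) + (rep B a′ t + pw B t * rep B a′ (suc n) + r))            ≡⟨ cong (λ w → y + (rep B a (suc n) + (w + r))) (rep-+ B a′ t (suc n)) ⟨
    y + (rep B a (suc n) + (rep B a′ (t ℕ.+ suc n) + r))                            ≡⟨ cong (λ k → y + (rep B a (suc n) + (rep B a′ k + r))) (ℕₚ.+-suc t n) ⟩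
    y + (rep B a (suc n) + (rep B a′ (suc (t ℕ.+ n)) + r))                          ∎
    where
    open ≡-Reasoning
    lem : ∀ y p q s r → y + p + (q + s + r) ≡ y + (q + (p + s + r))
    lem = solve-∀

  merged : ℕ → ℤ → ℤ → ℤ → ∀ {k} → Vec ℤ k → ℕ → List (Family (suc k))
  merged B y a a′ as t = (y + rep B a′ t , (a + pw B t * a′) ∷ as) ∷ (y + rep B a t , (a′ + pw B t * a) ∷ as) ∷ []

  prepend : ℤ → ∀ {k} → Family k → Family (suc k)
  prepend a (y , as) = y , a ∷ as

  merge : ℕ → ℕ → ℤ → ℤ → ∀ {k} → Vec ℤ k → List (Family k)
  merge B K y a []        = []
  merge B K y a (a′ ∷ as) = concatMap (merged B y a a′ as) (upTo K) ++ map (prepend a′) (merge B K y a as)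

  -- Covers every tuple that fails to be `Separated K`: the first run is short, or close to a later
  -- one, or the later ones fail among themselves. Each failure fixes a length or a difference below
  -- `K`, which uses up one free length.
  lower : ℕ → ℕ → ℤ → ∀ {k} → Vec ℤ (suc k) → List (Family k)
  lower B K y (a ∷ [])           = map (λ t → y + rep B a (suc t) , []) (upTo K)
  lower B K y (a ∷ as@(_ ∷ _))   = map (λ t → y + rep B a (suc t) , as) (upTo K) ++ (merge B K y a as ++ map (prepend a) (lower B K y as))

  Sound : ℕ → ∀ {j k} → ℤ → Vec ℤ j → Family k → Set
  Sound B y as F = ∀ x → InFamily B x F → SumSet B y as x

  All-concatMap : ∀ {X Y : Set} {P : Y → Set} (g : X → List Y) L → (∀ a → All P (g a)) → All P (concatMap g L)
  All-concatMap g []      p = []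
  All-concatMap g (a ∷ L) p = Allₚ.++⁺ (p a) (All-concatMap g L p)

  merged-sound : ∀ B y a a′ {k} (as : Vec ℤ k) t → All (Sound B y (a ∷ a′ ∷ as)) (merged B y a a′ as t)
  merged-sound B y a a′ as t =
    (λ { x (n ∷ ns , eq) → n ∷ t ℕ.+ n ∷ ns , trans eq (merge-two B a a′ t n y (total B (runs as ns))) }) ∷
    (λ { x (n ∷ ns , eq) → SumSet-swap B as y a′ a x (n ∷ t ℕ.+ n ∷ ns , trans eq (merge-two B a′ a t n y (total B (runs as ns)))) }) ∷ []

  merge-sound : ∀ B K y a {k} (as : Vec ℤ k) → All (Sound B y (a ∷ as)) (merge B K y a as)
  merge-sound B K y a []        = []
  merge-sound B K y a (a′ ∷ as) = Allₚ.++⁺ (All-concatMap (merged B y a a′ as) (upTo K) (merged-sound B y a a′ as))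
    (Allₚ.map⁺ (All.map (λ { {y′ , as′} sound x q → SumSet-swap B as y a′ a x (SumSet-cons B as′ (a ∷ as) y′ y sound a′ x q) }) (merge-sound B K y a as)))

  lower-head-sound : ∀ B y a {k} (as : Vec ℤ k) t → Sound B y (a ∷ as) (y + rep B a (suc t) , as)
  lower-head-sound B y a as t x (ns , eq) = t ∷ ns , trans eq (ℤₚ.+-assoc y (rep B a (suc t)) (total B (runs as ns)))

  lower-sound : ∀ B K y {k} (as : Vec ℤ (suc k)) → All (Sound B y as) (lower B K y as)
  lower-sound B K y (a ∷ [])         = Allₚ.map⁺ (All.universal (lower-head-sound B y a []) (upTo K))
  lower-sound B K y (a ∷ as@(_ ∷ _)) = Allₚ.++⁺ (Allₚ.map⁺ (All.universal (lower-head-sound B y a as) (upTo K)))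
    (Allₚ.++⁺ (merge-sound B K y a as) (Allₚ.map⁺ (All.map (λ { {y′ , as′} sound x q → SumSet-cons B as′ as y′ y sound a x q }) (lower-sound B K y as))))

  near-or-far : ∀ K n n′ → (suc n′ ℕ.+ K ℕ.≤ suc n ⊎ suc n ℕ.+ K ℕ.≤ suc n′) ⊎ ((∃ λ t → t ℕ.< K × t ℕ.+ n ≡ n′) ⊎ (∃ λ t → t ℕ.< K × t ℕ.+ n′ ≡ n))
  near-or-far K n n′ with ℕₚ.≤-total n n′
  ... | inj₁ n≤n′ = half n n′ n≤n′
    where
    half : ∀ n n′ → n ℕ.≤ n′ → (suc n′ ℕ.+ K ℕ.≤ suc n ⊎ suc n ℕ.+ K ℕ.≤ suc n′) ⊎ ((∃ λ t → t ℕ.< K × t ℕ.+ n ≡ n′) ⊎ (∃ λ t → t ℕ.< K × t ℕ.+ n′ ≡ n))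
    half n n′ n≤n′ with ℕₚ.m≤n⇒∃[o]m+o≡n n≤n′
    ... | t , eq with t ℕₚ.<? K
    ...   | yes t<K = inj₂ (inj₁ (t , t<K , trans (ℕₚ.+-comm t n) eq))
    ...   | no t≮K  = inj₁ (inj₂ (s≤s (ℕₚ.≤-trans (ℕₚ.+-monoʳ-≤ n (ℕₚ.≮⇒≥ t≮K)) (ℕₚ.≤-reflexive eq))))
  ... | inj₂ n′≤n with ℕₚ.m≤n⇒∃[o]m+o≡n n′≤n
  ...   | t , eq with t ℕₚ.<? K
  ...     | yes t<K = inj₂ (inj₂ (t , t<K , trans (ℕₚ.+-comm t n′) eq))
  ...     | no t≮K  = inj₁ (inj₁ (s≤s (ℕₚ.≤-trans (ℕₚ.+-monoʳ-≤ n′ (ℕₚ.≮⇒≥ t≮K)) (ℕₚ.≤-reflexive eq))))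

  InFamily-prepend : ∀ B {k} a n y r (F : Family k) → InFamily B (y + r) F → InFamily B (y + (rep B a (suc n) + r)) (prepend a F)
  InFamily-prepend B a n y r (y′ , as′) (ns , eq) = n ∷ ns , trans (lem y (rep B a (suc n)) r) (trans (cong (λ w → rep B a (suc n) + w) eq) (sym (lem y′ (rep B a (suc n)) (total B (runs as′ ns)))))
    where
    lem : ∀ y r t → y + (r + t) ≡ r + (y + t)
    lem = solve-∀

  merge-complete : ∀ B K y a {k} (as : Vec ℤ k) n ns →
    All (Far K (suc n)) (runs as ns) ⊎ Any (InFamily B (y + (rep B a (suc n) + total B (runs as ns)))) (merge B K y a as)
  merge-complete B K y a [] n [] = inj₁ []
  merge-complete B K y a (a′ ∷ as) n (n′ ∷ ns) with near-or-far K n n′ | merge-complete B K y a as n ns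
  ... | inj₂ (inj₁ (t , t<K , refl)) | _ = inj₂ (Anyₚ.++⁺ˡ (Anyₚ.concatMap⁺ (merged B y a a′ as) (lose (∈-upTo⁺ t<K) (here (n ∷ ns , sym (merge-two B a a′ t n y (total B (runs as ns))))))))
  ... | inj₂ (inj₂ (t , t<K , refl)) | _ = inj₂ (Anyₚ.++⁺ˡ (Anyₚ.concatMap⁺ (merged B y a a′ as) (lose (∈-upTo⁺ t<K) (there (here (n′ ∷ ns ,
          trans (lem y (rep B a (suc (t ℕ.+ n′))) (rep B a′ (suc n′)) (total B (runs as ns))) (sym (merge-two B a′ a t n′ y (total B (runs as ns))))))))))
    where
    lem : ∀ y r q t → y + (r + (q + t)) ≡ y + (q + (r + t))
    lem = solve-∀
  ... | inj₁ far | inj₁ fars = inj₁ (far ∷ fars)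
  ... | inj₁ far | inj₂ any  = inj₂ (Anyₚ.++⁺ʳ (concatMap (merged B y a a′ as) (upTo K)) (Anyₚ.map⁺ (Any.map (λ {F} q →
          subst (λ w → InFamily B w (prepend a′ F)) (lem y (rep B a′ (suc n′)) (rep B a (suc n)) (total B (runs as ns))) (InFamily-prepend B a′ n′ y (rep B a (suc n) + total B (runs as ns)) F q)) any)))
    where
    lem : ∀ y r q t → y + (r + (q + t)) ≡ y + (q + (r + t))
    lem = solve-∀

  lower-complete : ∀ B K y {k} (as : Vec ℤ (suc k)) ns → Separated K (runs as ns) ⊎ Any (InFamily B (y + total B (runs as ns))) (lower B K y as)
  lower-complete B K y (a ∷ []) (n ∷ []) with n ℕₚ.<? K
  ... | yes n<K = inj₂ (Anyₚ.map⁺ (lose (∈-upTo⁺ n<K) ([] , lem y (rep B a (suc n)))))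
    where
    lem : ∀ y r → y + (r + + 0) ≡ y + r + + 0
    lem = solve-∀
  ... | no n≮K  = inj₁ (ℕₚ.≤-trans (ℕₚ.≮⇒≥ n≮K) (ℕₚ.n≤1+n n) , [] , tt)
  lower-complete B K y (a ∷ as@(_ ∷ _)) (n ∷ ns) with n ℕₚ.<? K
  ... | yes n<K = inj₂ (Anyₚ.++⁺ˡ (Anyₚ.map⁺ (lose (∈-upTo⁺ n<K) (ns , sym (ℤₚ.+-assoc y (rep B a (suc n)) (total B (runs as ns)))))))
  ... | no n≮K with merge-complete B K y a as n ns | lower-complete B K y as ns
  ...   | inj₂ any | _        = inj₂ (Anyₚ.++⁺ʳ (map (λ t → y + rep B a (suc t) , as) (upTo K)) (Anyₚ.++⁺ˡ any))
  ...   | inj₁ _   | inj₂ any = inj₂ (Anyₚ.++⁺ʳ (map (λ t → y + rep B a (suc t) , as) (upTo K)) (Anyₚ.++⁺ʳ (merge B K y a as) (Anyₚ.map⁺ (Any.map (λ {F} q → InFamily-prepend B a n y (total B (runs as ns)) F q) any))))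
  ...   | inj₁ far | inj₁ sep = inj₁ (ℕₚ.≤-trans (ℕₚ.≮⇒≥ n≮K) (ℕₚ.n≤1+n n) , far , sep)

-- Intersection of a sum set with `A`

module Intersections (d : ℕ) (2≤d : 2 ℕ.≤ d) (N : ℕ) (f : ℤ → Bool) (nl : NoLadder N f) (pumps : Pumpable d f) where

  open BooleanCombinations d

  -- Since runs adds one to every length, this encodes the lengths ρ + (t + 1) M with M = suc m.
  lens : ℕ → ∀ {k} → Vec ℕ k → Vec ℕ k → Vec ℕ k
  lens m []       []       = []
  lens m (ρ ∷ ρs) (t ∷ ts) = ρ ℕ.+ (m ℕ.+ t ℕ.* suc m) ∷ lens m ρs ts

  lens-suc : ∀ m ρ t → suc (ρ ℕ.+ (m ℕ.+ t ℕ.* suc m)) ≡ ρ ℕ.+ suc t ℕ.* suc m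
  lens-suc m ρ t = sym (ℕₚ.+-suc ρ (m ℕ.+ t ℕ.* suc m))

  residue-shift : ℕ → ∀ {k} → Vec ℤ k → Vec ℕ k → ℤ
  residue-shift B []       []       = + 0
  residue-shift B (a ∷ as) (ρ ∷ ρs) = rep B a ρ + residue-shift B as ρs

  residue-coeffs : ℕ → ℕ → ∀ {k} → Vec ℤ k → Vec ℕ k → Vec ℤ k
  residue-coeffs B M []       []       = []
  residue-coeffs B M (a ∷ as) (ρ ∷ ρs) = pw B ρ * rep B a M ∷ residue-coeffs B M as ρs

  -- A run of length `ρ + (t + 1) M` is `ρ` single terms followed by `t + 1` blocks of `M` terms,
  -- and a block is one term in base `B ^ M`. Hence fixing the residues gives a sum set again, with
  -- `δ` replaced by a multiple.
  residue-total : ∀ B m {k} (as : Vec ℤ k) ρs ts →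
    residue-shift B as ρs + total (B ℕ.^ suc m) (runs (residue-coeffs B (suc m) as ρs) ts) ≡ total B (runs as (lens m ρs ts))
  residue-total B m []       []       []       = refl
  residue-total B m (a ∷ as) (ρ ∷ ρs) (t ∷ ts) = begin
    rep B a ρ + S + (rep B′ (pw B ρ * rep B a M) (suc t) + T)          ≡⟨ cong (λ w → rep B a ρ + S + (w + T)) (rep-scale B′ (pw B ρ) (rep B a M) (suc t)) ⟩
    rep B a ρ + S + (pw B ρ * rep B′ (rep B a M) (suc t) + T)          ≡⟨ cong (λ w → rep B a ρ + S + (pw B ρ * w + T)) (rep-* B a M (suc t)) ⟨
    rep B a ρ + S + (pw B ρ * rep B a (suc t ℕ.* M) + T)               ≡⟨ lem (rep B a ρ) S (pw B ρ * rep B a (suc t ℕ.* M)) T ⟩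
    rep B a ρ + pw B ρ * rep B a (suc t ℕ.* M) + (S + T)               ≡⟨ cong₂ _+_ (sym (rep-+ B a ρ (suc t ℕ.* M))) (residue-total B m as ρs ts) ⟩
    rep B a (ρ ℕ.+ suc t ℕ.* M) + total B (runs as (lens m ρs ts))     ≡⟨ cong (λ k → rep B a k + total B (runs as (lens m ρs ts))) (lens-suc m ρ t) ⟨
    total B (runs (a ∷ as) (lens m (ρ ∷ ρs) (t ∷ ts)))                 ∎
    where
    open ≡-Reasoning
    M  = suc m
    B′ = B ℕ.^ M
    S  = residue-shift B as ρs
    T  = total B′ (runs (residue-coeffs B M as ρs) ts)
    lem : ∀ r s q t → r + s + (q + t) ≡ r + q + (s + t)
    lem = solve-∀

  pairs : ∀ {k} → Vec ℤ k → Vec ℕ k → Vec ℕ k → Vec ℕ k → List (ℤ × ℕ × ℕ × ℕ)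
  pairs []       []       []       []       = []
  pairs (a ∷ as) (ρ ∷ ρs) (t ∷ ts) (u ∷ us) = (a , ρ , suc t , suc u) ∷ pairs as ρs ts us

  weight-sum : ∀ {k} → Vec ℤ k → ℕ
  weight-sum []       = 0
  weight-sum (a ∷ as) = ∣ a ∣ ℕ.+ weight-sum as

  weight-runs : ∀ {k} (as : Vec ℤ k) ns → weight (runs as ns) ≡ weight-sum as
  weight-runs []       []       = refl
  weight-runs (a ∷ as) (n ∷ ns) = cong (∣ a ∣ ℕ.+_) (weight-runs as ns)

  spread-out : ∀ K m {k} (as : Vec ℤ k) ρs → ∃ λ us → Separated K (runs as (lens m ρs us))
  spread-out K m []       []       = [] , tt
  spread-out K m (a ∷ as) (ρ ∷ ρs) with spread-out K m as ρs
  ... | us , sep = u ∷ us , ℕₚ.≤-trans (ℕₚ.m≤m+n K _) u≤n , All.map (λ {r} p → inj₁ (ℕₚ.≤-trans (ℕₚ.≤-reflexive (ℕₚ.+-comm (proj₂ r) K)) (ℕₚ.≤-trans (ℕₚ.+-monoʳ-≤ K p) u≤n))) (lengths-bound (runs as (lens m ρs us))) , sep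
    where
    u = K ℕ.+ lengths (runs as (lens m ρs us))
    u≤n : u ℕ.≤ suc (ρ ℕ.+ (m ℕ.+ u ℕ.* suc m))
    u≤n = ℕₚ.m≤n⇒m≤1+n (ℕₚ.≤-trans (ℕₚ.m≤m*n u (suc m)) (ℕₚ.≤-trans (ℕₚ.m≤n+m (u ℕ.* suc m) m) (ℕₚ.m≤n+m _ ρ)))

  residues : ∀ K m → suc m ℕ.≤ K → ∀ {k} (as : Vec ℤ k) ns → Separated K (runs as ns) → ∃ λ ρs → ∃ λ ts → AllV (ℕ._< suc m) ρs × ns ≡ lens m ρs ts
  residues K m m<K []       []       _ = [] , [] , [] , refl
  residues K m m<K (a ∷ as) (n ∷ ns) (K≤ , _ , sep) with residues K m m<K as ns sep | suc n / suc m in q≡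
  -- Quotient `0` is impossible because separated lengths are at least `K`, hence at least `M`; this
  -- matches the encoding of quotients as `suc t`.
  ... | ρs , ts , small , eq | zero  = ⊥-elim (ℕₚ.<⇒≱ (subst (ℕ._< suc m) (sym n≡) (m%n<n (suc n) (suc m))) (ℕₚ.≤-trans m<K K≤))
    where
    n≡ : suc n ≡ suc n % suc m
    n≡ = trans (m≡m%n+[m/n]*n (suc n) (suc m)) (trans (cong (λ q → suc n % suc m ℕ.+ q ℕ.* suc m) q≡) (ℕₚ.+-identityʳ _))
  ... | ρs , ts , small , eq | suc t = suc n % suc m ∷ ρs , t ∷ ts , m%n<n (suc n) (suc m) ∷ small ,
    cong₂ _∷_ (ℕₚ.suc-injective (trans (m≡m%n+[m/n]*n (suc n) (suc m)) (trans (cong (λ q → suc n % suc m ℕ.+ q ℕ.* suc m) q≡) (sym (lens-suc m (suc n % suc m) t))))) eq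

  -- Packages the points of tuples that are not separated, so that one step serves the whole
  -- induction: nothing for `k = 0`, the families from `lower` otherwise. `In` may also contain
  -- points that come from separated tuples.
  record Boundary (B K : ℕ) (y : ℤ) {k : ℕ} (as : Vec ℤ k) : Set₁ where
    field
      In       : ℤ → Set
      bc       : IsBC In
      bc-f     : IsBC (λ x → In x × f x ≡ true)
      inside   : ∀ x → In x → SumSet B y as x
      complete : ∀ ns → Separated K (runs as ns) ⊎ In (y + total B (runs as ns))

  module Step (e : ℕ) (1≤e : 1 ℕ.≤ e) (y : ℤ) (k : ℕ) (as : Vec ℤ k) (K m : ℕ) (m<K : suc m ℕ.≤ K)
    (pump : RunLengths.PumpAt (d ℕ.^ e) (2≤^ 2≤d 1≤e) N f nl (∣ y ∣ ℕ.+ weight-sum as) K (suc m)) (L : Boundary (d ℕ.^ e) K y as) where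

    open Boundary L

    b = d ℕ.^ e
    M = suc m

    at : Vec ℕ k → Vec ℕ k → ℤ
    at ρs ts = y + total b (runs as (lens m ρs ts))

    left-pairs : ∀ {k} (as : Vec ℤ k) ρs ts us → RunLengths.left b (2≤^ 2≤d 1≤e) N f nl M (pairs as ρs ts us) ≡ runs as (lens m ρs ts)
    left-pairs []       []       []       []       = refl
    left-pairs (a ∷ as) (ρ ∷ ρs) (t ∷ ts) (u ∷ us) = cong₂ (λ n C → (a , n) ∷ C) (sym (lens-suc m ρ t)) (left-pairs as ρs ts us)

    right-pairs : ∀ {k} (as : Vec ℤ k) ρs ts us → RunLengths.right b (2≤^ 2≤d 1≤e) N f nl M (pairs as ρs ts us) ≡ runs as (lens m ρs us)
    right-pairs []       []       []       []       = refl
    right-pairs (a ∷ as) (ρ ∷ ρs) (t ∷ ts) (u ∷ us) = cong₂ (λ n C → (a , n) ∷ C) (sym (lens-suc m ρ u)) (right-pairs as ρs ts us)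

    constant : ∀ ρs ts us → Separated K (runs as (lens m ρs ts)) → Separated K (runs as (lens m ρs us)) → f (at ρs ts) ≡ f (at ρs us)
    constant ρs ts us sepT sepU = begin
      f (y + total b (runs as (lens m ρs ts)))         ≡⟨ cong (λ C → f (y + total b C)) (left-pairs as ρs ts us) ⟨
      f (y + total b l)                                ≡⟨ cong (λ w → f (y + w)) (ℤₚ.+-identityˡ (total b l)) ⟨
      f (y + (+ 0 + total b l))                        ≡⟨ RunLengths.separated-constant b (2≤^ 2≤d 1≤e) N f nl pump (s≤s z≤n) y (pairs as ρs ts us) []
                                                            (ℕₚ.≤-reflexive (cong (∣ y ∣ ℕ.+_) (trans (cong weight (left-pairs as ρs ts us)) (weight-runs as (lens m ρs ts)))))
                                                            (subst (Separated K) (sym (left-pairs as ρs ts us)) sepT) (subst (Separated K) (sym (right-pairs as ρs ts us)) sepU)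
                                                            (All.universal (λ _ → []) l) (All.universal (λ _ → []) r) ⟩
      f (y + (+ 0 + total b r))                        ≡⟨ cong (λ w → f (y + w)) (ℤₚ.+-identityˡ (total b r)) ⟩
      f (y + total b r)                                ≡⟨ cong (λ C → f (y + total b C)) (right-pairs as ρs ts us) ⟩
      f (y + total b (runs as (lens m ρs us)))         ∎
      where
      open ≡-Reasoning
      l = RunLengths.left b (2≤^ 2≤d 1≤e) N f nl M (pairs as ρs ts us)
      r = RunLengths.right b (2≤^ 2≤d 1≤e) N f nl M (pairs as ρs ts us)

    canonical : Vec ℕ k → Vec ℕ k
    canonical ρs = proj₁ (spread-out K m as ρs)

    limit : Vec ℕ k → Bool
    limit ρs = f (at ρs (canonical ρs))

    f-limit : ∀ ρs ts → Separated K (runs as (lens m ρs ts)) → f (at ρs ts) ≡ limit ρs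
    f-limit ρs ts sep = constant ρs ts (canonical ρs) sep (proj₂ (spread-out K m as ρs))

    Class : Vec ℕ k → ℤ → Set
    Class ρs = SumSet (d ℕ.^ (e ℕ.* M)) (y + residue-shift b as ρs) (residue-coeffs b M as ρs)

    class-total : ∀ ρs ts → y + residue-shift b as ρs + total (d ℕ.^ (e ℕ.* M)) (runs (residue-coeffs b M as ρs) ts) ≡ at ρs ts
    class-total ρs ts = trans (cong (λ B → y + residue-shift b as ρs + total B (runs (residue-coeffs b M as ρs) ts)) (sym (ℕₚ.^-*-assoc d e M)))
      (trans (ℤₚ.+-assoc y (residue-shift b as ρs) _) (cong (λ w → y + w) (residue-total b m as ρs ts)))

    Out : ℤ → Set
    Out x = In x × f x ≡ false

    bc-Out : IsBC Out
    bc-Out = bc-complement f bc bc-f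

    -- `Class ρs` also contains points of tuples that are not separated, for which `limit ρs` need
    -- not be the value of `f`. Such points lie in `In`, so subtracting `Out` corrects them, and no
    -- point with value `true` is lost.
    Target : ℤ → Set
    Target x = (In x × f x ≡ true) ⊎ (∃ λ ρs → AllV (ℕ._< M) ρs × (limit ρs ≡ true × (Class ρs x × ¬ Out x)))

    bc-Target : IsBC Target
    bc-Target = bc-⊎ bc-f (bc-vectors M k (λ ρs → bc-guard (limit ρs) (bc-× (bc-SumSet (e ℕ.* M) (ℕₚ.*-mono-≤ {1} {e} 1≤e (s≤s z≤n)) (y + residue-shift b as ρs) (residue-coeffs b M as ρs)) (bc-¬ bc-Out))))

    to : ∀ x → SumSet b y as x × f x ≡ true → Target x
    to x ((ns , refl) , fx) with complete ns
    ... | inj₂ i = inj₁ (i , fx)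
    ... | inj₁ sep with residues K m m<K as ns sep
    ...   | ρs , ts , small , refl = inj₂ (ρs , small , trans (sym (f-limit ρs ts sep)) fx , (ts , sym (class-total ρs ts)) , λ { (_ , fx′) → true≢false (trans (sym fx) fx′) })

    from : ∀ x → Target x → SumSet b y as x × f x ≡ true
    from x (inj₁ (i , fx)) = inside x i , fx
    from x (inj₂ (ρs , small , lim , (ts , x≡) , ¬out)) = (lens m ρs ts , x≡at) , fx
      where
      x≡at : x ≡ at ρs ts
      x≡at = trans x≡ (class-total ρs ts)
      by-cases : Separated K (runs as (lens m ρs ts)) ⊎ In (at ρs ts) → f (at ρs ts) ≡ true
      by-cases (inj₁ sep) = trans (f-limit ρs ts sep) lim
      by-cases (inj₂ i) with f (at ρs ts) in eq
      ... | true  = refl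
      ... | false = ⊥-elim (¬out (subst Out (sym x≡at) (i , eq)))
      fx : f x ≡ true
      fx = trans (cong f x≡at) (by-cases (complete (lens m ρs ts)))

    result : IsBC (λ x → SumSet b y as x × f x ≡ true)
    result = bc-⇔ to from bc-Target

  bc-from-boundary : ∀ e (1≤e : 1 ℕ.≤ e) y {k} (as : Vec ℤ k) → (∀ K → Boundary (d ℕ.^ e) K y as) → IsBC (λ x → SumSet (d ℕ.^ e) y as x × f x ≡ true)
  bc-from-boundary e 1≤e y {k} as L with pumps e 1≤e (∣ y ∣ ℕ.+ weight-sum as)
  -- `K` is enlarged to `K + M` so that it is at least `M`; the pumping identity persists for longer
  -- runs.
  ... | K , suc m , _ , pump = Step.result e 1≤e y k as (K ℕ.+ suc m) m (ℕₚ.m≤n+m (suc m) K)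
          (λ Y c s x Y≤ s≤ → trans (pump-iterate f (λ w → Y + pw b c * w) b s K (suc m) (λ x → pump Y c s x Y≤ s≤) (suc m) 1 x)
            (cong (λ n → f (Y + pw b c * (rep b s (K ℕ.+ suc m ℕ.+ n) + pw b (K ℕ.+ suc m ℕ.+ n) * x))) (ℕₚ.*-identityˡ (suc m))))
          (L (K ℕ.+ suc m))
    where b = d ℕ.^ e

  Any-×ʳ : ∀ {X : Set} {P : X → Set} {Q : Set} {L} → Any P L × Q → Any (λ a → P a × Q) L
  Any-×ʳ (any , q) = Any.map (λ p → p , q) any

  Any-×ˡ : ∀ {X : Set} {P : X → Set} {Q : Set} {L} → Any (λ a → P a × Q) L → Any P L × Q
  Any-×ˡ any = Any.map proj₁ any , proj₂ (proj₂ (Any.satisfied any))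

  sound-Any : ∀ B {j k} y (as : Vec ℤ j) (L : List (Family k)) → All (Sound B y as) L → ∀ x → Any (InFamily B x) L → SumSet B y as x
  sound-Any B y as (F ∷ L) (p ∷ ps) x (here q)  = p x q
  sound-Any B y as (F ∷ L) (p ∷ ps) x (there q) = sound-Any B y as L ps x q

  bc-SumSet-f : ∀ k e (1≤e : 1 ℕ.≤ e) y (as : Vec ℤ k) → IsBC (λ x → SumSet (d ℕ.^ e) y as x × f x ≡ true)
  bc-SumSet-f zero    e 1≤e y [] = bc-from-boundary e 1≤e y [] (λ K → record
    { In = λ _ → ⊥ ; bc = bc-⊥ ; bc-f = bc-⇔ (λ x → proj₁) (λ x ()) bc-⊥ ; inside = λ x () ; complete = λ { [] → inj₁ tt } })
  bc-SumSet-f (suc k) e 1≤e y as = bc-from-boundary e 1≤e y as (λ K → record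
    { In       = λ x → Any (InFamily b x) (lower b K y as)
    ; bc       = bc-Any (lower b K y as) (All.universal (λ { (y′ , as′) → bc-SumSet e 1≤e y′ as′ }) (lower b K y as))
    ; bc-f     = bc-⇔ (λ x → Any-×ʳ) (λ x → Any-×ˡ) (bc-Any (lower b K y as) (All.universal (λ { (y′ , as′) → bc-SumSet-f k e 1≤e y′ as′ }) (lower b K y as)))
    ; inside   = sound-Any b y as (lower b K y as) (lower-sound b K y as)
    ; complete = lower-complete b K y as
    })
    where b = d ℕ.^ e

-- Numbers with few runs as finitely many sum sets

module Families (d : ℕ) where

  open BooleanCombinations d

  vsum : ∀ {k} → Vec ℤ k → ℤ
  vsum []       = + 0
  vsum (a ∷ as) = a + vsum as

  scale : ℕ → ∀ {k} → Vec ℤ k → Vec ℤ k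
  scale D = Vec.map (+ D *_)

  total-scale : ∀ D {k} (as : Vec ℤ k) ns → total D (runs (scale D as) ns) ≡ + D * total D (runs as ns)
  total-scale D []       []       = sym (ℤₚ.*-zeroʳ (+ D))
  total-scale D (a ∷ as) (n ∷ ns) = trans (cong₂ _+_ (rep-scale D (+ D) a (suc n)) (total-scale D as ns)) (sym (ℤₚ.*-distribˡ-+ (+ D) (rep D a (suc n)) (total D (runs as ns))))

  -- Sum sets have no shifted runs. A shift by `n` digits is therefore expressed by prolonging every
  -- run by `n` and subtracting the added low terms, which together form one run with coefficient
  -- `vsum as`.
  total-delay : ∀ D {k} (as : Vec ℤ k) n ns → rep D (vsum as) n + pw D n * total D (runs as ns) ≡ total D (runs as (Vec.map (n ℕ.+_) ns))
  total-delay D []       n []       = trans (cong (_+ pw D n * + 0) (rep-zero D n)) (lem (pw D n))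
    where
    lem : ∀ p → + 0 + p * + 0 ≡ + 0
    lem = solve-∀
  total-delay D (a ∷ as) n (m ∷ ns) = begin
    rep D (a + vsum as) n + pw D n * (rep D a (suc m) + T)           ≡⟨ cong (_+ pw D n * (rep D a (suc m) + T)) (rep-add D a (vsum as) n) ⟩
    rep D a n + rep D (vsum as) n + pw D n * (rep D a (suc m) + T)   ≡⟨ lem (rep D a n) (rep D (vsum as) n) (pw D n) (rep D a (suc m)) T ⟩
    rep D a n + pw D n * rep D a (suc m) + (rep D (vsum as) n + pw D n * T) ≡⟨ cong₂ _+_ (trans (sym (rep-+ D a n (suc m))) (cong (rep D a) (ℕₚ.+-suc n m))) (total-delay D as n ns) ⟩
    rep D a (suc (n ℕ.+ m)) + total D (runs as (Vec.map (n ℕ.+_) ns)) ∎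
    where
    open ≡-Reasoning
    T = total D (runs as ns)
    lem : ∀ r s p q t → r + s + p * (q + t) ≡ r + p * q + (s + p * t)
    lem = solve-∀

  SomeFamily : Set
  SomeFamily = Σ ℕ Family

  InSome : ℕ → ℤ → SomeFamily → Set
  InSome B x (k , F) = InFamily B x F

  -- For n = 0 the run of v's is absent; otherwise D^n y = y + Σ_{i<n} D^i (D-1) y is absorbed into the first run.
  extended : ℕ → ℤ → ∀ {k} → Family k → List SomeFamily
  extended D v (y , as) = (_ , y , as) ∷ (_ , y , (v + (+ D - + 1) * y - vsum as) ∷ as) ∷ []

  in-extended : ∀ D v n {k} (F : Family k) w → InFamily D w F → Any (InSome D (rep D v n + pw D n * w)) (extended D v F)
  in-extended D v zero (y , as) w (ns , eq) = here (ns , trans (lem w) eq)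
    where
    lem : ∀ w → + 0 + + 1 * w ≡ w
    lem = solve-∀
  in-extended D v (suc n) (y , as) w (ns , refl) = there (here (n ∷ Vec.map (suc n ℕ.+_) ns , (begin
    rep D v N + pw D N * (y + T)                                          ≡⟨ lem₁ (rep D v N) (pw D N) y T (rep D (vsum as) N) ⟩
    rep D v N + pw D N * y - rep D (vsum as) N + (rep D (vsum as) N + pw D N * T) ≡⟨ cong₂ (λ p q → rep D v N + p - rep D (vsum as) N + q) (pw-rep D N y) (total-delay D as N ns) ⟩
    rep D v N + (y + rep D c N) - rep D (vsum as) N + T′                  ≡⟨ lem₂ (rep D v N) y (rep D c N) (rep D (vsum as) N) T′ ⟩
    y + (rep D v N + rep D c N + - + 1 * rep D (vsum as) N + T′)          ≡⟨ cong₂ (λ p q → y + (p + q + T′)) (rep-add D v c N) (rep-scale D (- + 1) (vsum as) N) ⟨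
    y + (rep D (v + c) N + rep D (- + 1 * vsum as) N + T′)                ≡⟨ cong (λ p → y + (p + T′)) (rep-add D (v + c) (- + 1 * vsum as) N) ⟨
    y + (rep D (v + c + - + 1 * vsum as) N + T′)                          ≡⟨ cong (λ a → y + (rep D a N + T′)) (lem₃ (v + c) (vsum as)) ⟩
    y + (rep D (v + c - vsum as) N + T′)                                  ∎)))
    where
    open ≡-Reasoning
    N = suc n
    c = (+ D - + 1) * y
    T = total D (runs as ns)
    T′ = total D (runs as (Vec.map (N ℕ.+_) ns))
    lem₁ : ∀ r p y t s → r + p * (y + t) ≡ r + p * y - s + (s + p * t)
    lem₁ = solve-∀
    lem₂ : ∀ r y c s t → r + (y + c) - s + t ≡ y + (r + c + - + 1 * s + t)
    lem₂ = solve-∀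
    lem₃ : ∀ a s → a + - + 1 * s ≡ a - s
    lem₃ = solve-∀

  tails : ℕ → SomeFamily → ℕ → SomeFamily
  tails D (k , y , as) c = k , + c + + D * y , scale D as

  in-tails : ∀ D c F z → InSome D z F → InSome D (+ c + + D * z) (tails D F c)
  in-tails D c (k , y , as) z (ns , refl) = ns , trans (lem (+ c) (+ D) y (total D (runs as ns))) (cong (λ w → + c + + D * y + w) (sym (total-scale D as ns)))
    where
    lem : ∀ c d y t → c + d * (y + t) ≡ c + d * y + d * t
    lem = solve-∀

  ends : List SomeFamily
  ends = (0 , + 0 , []) ∷ (0 , - + 1 , []) ∷ []

  inner : ℕ → List SomeFamily → List SomeFamily
  inner D L = ends ++ concatMap (λ F → map (tails D F) (upTo D)) L

  families : ℕ → ℕ → List SomeFamily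
  families D zero    = []
  families D (suc k) = concatMap (λ v → concatMap (λ F → extended D (+ v) (proj₂ F)) (inner D (families D k))) (upTo D)

  in-families : ∀ D k v n w → v ℕ.< D → Any (InSome D w) (inner D (families D k)) → Any (InSome D (rep D (+ v) n + pw D n * w)) (families D (suc k))
  in-families D k v n w v<D any = Anyₚ.concatMap⁺ (λ v → concatMap (λ F → extended D (+ v) (proj₂ F)) (inner D (families D k)))
    (lose (∈-upTo⁺ v<D) (Anyₚ.concatMap⁺ (λ F → extended D (+ v) (proj₂ F)) (Any.map (λ {F} q → in-extended D (+ v) n (proj₂ F) w q) any)))

-- Assembly of the periodic and the sparse part

module Proof (d : ℕ) (2≤d : 2 ℕ.≤ d) (A : ℤ → Set) (M : DFA d) (acc : ∀ σ → DFA.Accepts M σ ⇔ A (eval d σ)) (N : ℕ) (nl : SumLadderFree N A) where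

  open Kernel d 2≤d A M acc using (F; f; f-correct; F-noLadder; F-pump; D; δ; 1≤δ; E; Reachable)
  open Covering d 2≤d A M acc N nl using (Covered; Stop; f-E-or-covered; E-periodic; period; s; s≢0)
  open BooleanCombinations d
  open Families d

  nl-f : NoLadder N f
  nl-f = F-noLadder nl ([] , refl)

  pumps : Pumpable d f
  pumps e 1≤e B = let K , M , 1≤M , pump = F-pump e 1≤e B in K , M , 1≤M , λ Y c s x Y≤ s≤ →
    subst (λ p → f (Y + p * (rep (d ℕ.^ e) s K + pw (d ℕ.^ e) K * x)) ≡ f (Y + p * (rep (d ℕ.^ e) s (K ℕ.+ M) + pw (d ℕ.^ e) (K ℕ.+ M) * x)))
      (sym (pw-* d e c)) (pump ([] , refl) Y (e ℕ.* c) s x (subst (λ p → ∣ Y ∣ ℕ.≤ B ℕ.* p) (ℕₚ.^-*-assoc d e c) Y≤) s≤)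

  open Intersections d 2≤d N f nl-f pumps using (bc-SumSet-f; Any-×ʳ; Any-×ˡ)

  covered⇒family : ∀ k z → Covered k z → Any (InSome D z) (families D k)
  covered⇒family (suc k) z (v , v<D , n , inj₁ (t , stop , refl)) = in-families D k v n t v<D (Anyₚ.++⁺ˡ (end stop))
    where
    end : Stop t → Any (InSome D t) ends
    end (inj₁ refl) = here ([] , refl)
    end (inj₂ refl) = there (here ([] , refl))
  covered⇒family (suc k) z (v , v<D , n , inj₂ (c , c<D , z′ , cov , refl)) = in-families D k v n (+ c + + D * z′) v<D
    (Anyₚ.++⁺ʳ ends (Anyₚ.concatMap⁺ (λ F → map (tails D F) (upTo D)) (Any.map (λ {F} q → Anyₚ.map⁺ (lose (∈-upTo⁺ c<D) (in-tails D c F z′ q))) (covered⇒family k z′ cov))))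

  L : List SomeFamily
  L = families D (DFA.nStates M)

  InL : ℤ → Set
  InL x = Any (InSome D x) L

  bc-InL : IsBC InL
  bc-InL = bc-Any L (All.universal (λ { (k , y , as) → bc-SumSet δ 1≤δ y as }) L)

  bc-InL-f : IsBC (λ x → InL x × f x ≡ true)
  bc-InL-f = bc-⇔ (λ x → Any-×ʳ) (λ x → Any-×ˡ) (bc-Any L (All.universal (λ { (k , y , as) → bc-SumSet-f k δ 1≤δ y as }) L))

  Exceptional : ℤ → Set
  Exceptional x = InL x × f x ≡ false

  bc-Exceptional : IsBC Exceptional
  bc-Exceptional = bc-complement f bc-InL bc-InL-f

  period≢0 : ¬ period ≡ + 0
  period≢0 e = Sum.[ (λ p → ℕₚ.<⇒≢ (ℕₚ.m^n>0 D {{ℕₚ.m^n≢0 d δ {{ℕ.>-nonZero (ℕₚ.≤-trans (s≤s z≤n) 2≤d)}}}} (DFA.nStates M)) (sym (ℤₚ.+-injective p))) , s≢0 ] (ℤₚ.i*j≡0⇒i≡0∨j≡0 (pw D (DFA.nStates M)) e)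

  bc-A : IsBC A
  bc-A = bc-⇔ to from (bc-⊎ (bc-× (bc-periodic {E s f} period≢0 E-periodic) (bc-¬ bc-Exceptional)) bc-InL-f)
    where
    to : ∀ x → A x → (E s f x ≡ true × ¬ Exceptional x) ⊎ (InL x × f x ≡ true)
    to x Ax with f-E-or-covered x
    ... | inj₁ e = inj₁ (trans e fx , λ { (_ , fx′) → true≢false (trans (sym fx) fx′) })
      where
      fx : f x ≡ true
      fx = Equivalence.from (f-correct x) Ax
    ... | inj₂ cov = inj₂ (covered⇒family (DFA.nStates M) x cov , Equivalence.from (f-correct x) Ax)
    from : ∀ x → (E s f x ≡ true × ¬ Exceptional x) ⊎ (InL x × f x ≡ true) → A x
    from x (inj₂ (_ , fx)) = Equivalence.to (f-correct x) fx
    from x (inj₁ (Ex , ¬exc)) with f-E-or-covered x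
    ... | inj₁ e   = Equivalence.to (f-correct x) (trans (sym e) Ex)
    ... | inj₂ cov = Equivalence.to (f-correct x) (by-value (f x) refl)
      where
      by-value : ∀ c → f x ≡ c → f x ≡ true
      by-value true  e = e
      by-value false e = ⊥-elim (¬exc (covered⇒family (DFA.nStates M) x cov , e))

theorem5p1 : (d : ℕ) → 2 ≤ d → (A : ℤ → Set) → Automatic d A → StableInℤ A →
    Σ (BoolComb d) λ φ → ∀ x → A x ⇔ ⟦ φ ⟧ x
theorem5p1 d 2≤d A (M , acc) (N , nl) = Proof.bc-A d 2≤d A M acc N nl
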